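{- Let $p$ be a prime number and $0\neq f(t)\in\mathbb{Z}[t]$. Then the sequence $(\mathrm{Res}(t^{p^n}-1,f(t)))_{n}$ converges in $\mathbb{Z}_p$, and its limit is $0$ if and only if $p\mid f(1)$. Moreover, in any case, if $\mathrm{Res}(t^{p^n}-1,f(t))\neq 0$ for all $n$, then the non-$p$ parts of $\mathrm{Res}(t^{p^n}-1,f(t))$ converge in $\mathbb{Z}_p$ to a non-zero value. For each prime number $l$, similar assertions hold for the $l$-parts of $\mathrm{Res}(t^{p^n}-1,f(t))$; in particular these $l$-parts converge in $\mathbb{Z}_p$.
   Context: For $n\in\mathbb{Z}_{>0}$, $\mathrm{Res}(t^n-1,f(t))=\prod_{\zeta^n=1}f(\zeta)$, the product over all $n$-th roots of unity in $\overline{\mathbb{Q}}$; it is an integer. The non-$p$ part of a nonzero integer $x=mp^r$ with $m\in\mathbb{Z}$, $p\nmid m$, $r\in\mathbb{Z}_{\geq0}$ is $m$. For a prime $l$, the $l$-part of a nonzero integer $x$ is the largest power of $l$ dividing $x$, i.e. $|x|_l^{ -1}$. -}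

module Defs where

open import Data.Bool using (Bool; true; false; if_then_else_; _∧_)
open import Data.Nat using (ℕ; zero; suc; _^_; _∸_; _<?_; _≤?_; _≡ᵇ_; _≤_)
  renaming (_+_ to _+ℕ_)
open import Data.Fin using (Fin; zero; suc; toℕ; fromℕ<; punchIn)
open import Data.List using (List; foldr; map; allFin)
open import Data.Integer using (ℤ; +_; _+_; _-_; _*_; -_; 0ℤ; 1ℤ)
open import Data.Integer.Divisibility using (_∣_)
open import Data.Product using (Σ; _×_; ∃)
open import Relation.Nullary using (¬_; does; yes; no)
open import Relation.Binary.PropositionalEquality using (_≡_)

sumℤ : List ℤ → ℤ
sumℤ = foldr _+_ 0ℤ

altSign : ℕ → ℤ
altSign zero = 1ℤ
altSign (suc k) = - altSign k

det : (n : ℕ) → (Fin n → Fin n → ℤ) → ℤ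
det zero M = 1ℤ
det (suc n) M =
  sumℤ (map (λ j → altSign (toℕ j) * M zero j * det n (λ r c → M (suc r) (punchIn j c)))
            (allFin (suc n)))

-- A nonzero polynomial f of degree d is given by d and its coefficients
-- c : Fin (suc d) → ℤ (c i = coefficient of t^i) with c (fromℕ d) ≢ 0.
-- coefficient function ℕ → ℤ (zero above the degree)
coeffN : (d : ℕ) → (Fin (suc d) → ℤ) → ℕ → ℤ
coeffN d c k with k <? suc d
... | yes k<d = c (fromℕ< k<d)
... | no _ = 0ℤ

evalAt1 : (d : ℕ) → (Fin (suc d) → ℤ) → ℤ
evalAt1 d c = sumℤ (map c (allFin (suc d)))

cycCoeff : ℕ → ℕ → ℤ
cycCoeff m k = (if k ≡ᵇ m then 1ℤ else 0ℤ) - (if k ≡ᵇ 0 then 1ℤ else 0ℤ)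

-- a row of the Sylvester matrix: coefficients a_deg,...,a_0 placed in
-- columns r, ..., r + deg
band : (ℕ → ℤ) → ℕ → ℕ → ℕ → ℤ
band a deg r j = if does (r ≤? j) ∧ does (j ≤? r +ℕ deg) then a (deg +ℕ r ∸ j) else 0ℤ

sylvester : (m d : ℕ) → (ℕ → ℤ) → (ℕ → ℤ) → Fin (m +ℕ d) → Fin (m +ℕ d) → ℤ
sylvester m d a b i j =
  if does (toℕ i <? d) then band a m (toℕ i) (toℕ j) else band b d (toℕ i ∸ d) (toℕ j)

-- Res(A, B) = det Sylvester(A, B) = lc(A)^deg B * ∏_{A(α)=0} B(α)
resultant : (m : ℕ) → (ℕ → ℤ) → (d : ℕ) → (ℕ → ℤ) → ℤ
resultant m a d b = det (m +ℕ d) (sylvester m d a b)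

resSeq : (p d : ℕ) → (Fin (suc d) → ℤ) → ℕ → ℤ
resSeq p d c n = resultant (p ^ n) (cycCoeff (p ^ n)) d (coeffN d c)

-- p-adic integers as the inverse limit of ℤ/p^k (coherent sequences of
-- integer representatives), and p-adic convergence of integer sequences

record ℤp (p : ℕ) : Set where
  field
    approx : ℕ → ℤ
    coherent : ∀ k → (+ (p ^ k)) ∣ (approx (suc k) - approx k)
open ℤp public

IsZeroℤp : (p : ℕ) → ℤp p → Set
IsZeroℤp p x = ∀ k → (+ (p ^ k)) ∣ approx x k

ConvergesTo : (p : ℕ) → (ℕ → ℤ) → ℤp p → Set
ConvergesTo p a x = ∀ k → ∃ λ N → ∀ n → N ≤ n → (+ (p ^ k)) ∣ (a n - approx x k)

IsNonPPart : (p : ℕ) → ℤ → ℤ → Set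
IsNonPPart p x m = Σ ℕ λ r → (x ≡ m * + (p ^ r)) × ¬ ((+ p) ∣ m)

IsLPart : (l : ℕ) → ℤ → ℤ → Set
IsLPart l x y = Σ ℕ λ r → (y ≡ + (l ^ r)) × ((+ (l ^ r)) ∣ x) × ¬ ((+ (l ^ suc r)) ∣ x)

{-# OPTIONS --safe #-}
module Submission where

-- Put q = p^k. The resultant R k = Res(t^q − 1, f) is det f(P) for the cyclic shift P of order q, and
-- R (k + 1) = R k · N k, where N k = det f(Z), with Z the companion matrix of Φ(t) = 1 + t^q + ⋯ + t^((p−1)q),
-- is the norm of f(ζ) for a primitive p^(k+1)-th root of unity ζ. Everything follows from three facts on N k.
--
-- Since Z is unipotent modulo p, the Frobenius map gives N k ≡ 1 mod p if p ∤ f(1); if p ∣ f(1), then 1 − Z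
-- divides f(Z), and det (1 − Z) = Φ(1) = p. Hence p^(k+1) ∣ R k in the second case.
--
-- Let e be the prime-to-p part of N k, or its l-part for a prime l ≠ p. Diagonalizing f(Z) over ℤ shows that Z
-- acts on a group of order e, namely that part of the cokernel of f(Z). A vector fixed by Z^q is killed by Φ(1) = p,
-- so it is 0; all other orbits have p^(k+1) elements, and e ≡ 1 mod p^(k+1).
--
-- For odd p the sign of the prime-to-p part follows from the first fact, after splitting off factors 1 − Z from f(Z).
-- For p = 2 and k ≥ 1, Z^(q/2) is a complex structure commuting with f(Z), so N k is a sum of two squares.

-- The cokernel of f(Z) stands in for ℤ[ζ]/(f(ζ)), and the action of Z on it for multiplication by
-- ζ, so that only integer matrices occur. Diagonalizing presents this group as a product of cyclic
-- groups ℤ/dᵢ; replacing each dᵢ by its prime-to-p part or its l-part selects the part whose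
-- elements are counted. Parts are multiplicative, so the part of R (k + 1) minus the part of R k is
-- a multiple of e - 1, up to sign. Thus a congruence for e is a Cauchy condition, and a limit of
-- integers prime to p is not zero. If p does not divide f(1), then N k is its own non-p part, so
-- the resultants themselves are covered. The obstacle is the sign: the order of a group gives only
-- the absolute value, while the non-p part of an integer keeps its sign. A congruence modulo p
-- decides the sign when p is odd. It cannot do so when p = 2, because -1 ≡ 1 mod 2; this is why
-- positivity is proved there through sums of squares.

module Determinants where
  open import Algebra.Bundles using (CommutativeRing; Ring)
  open import Level using (0ℓ)
  open import Data.Nat.Base using (ℕ; zero; suc; s≤s; z≤n)
  import Data.Nat.Base as ℕ
  open import Data.Fin.Base using (Fin; zero; suc; toℕ; punchIn; _↑ˡ_; _↑ʳ_)
  open import Data.Fin.Properties using (_≟_; ↑ˡ-injective)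
  open import Data.Vec.Functional using (_∷_; _++_; removeAt; tail)
  open import Data.Vec.Functional.Properties using (lookup-++ˡ; lookup-++ʳ)
  open import Data.Product using (_,_)
  open import Function.Base using (_∘_)
  open import Relation.Nullary using (¬_; yes; no; contradiction)
  open import Relation.Binary.PropositionalEquality as ≡ using (_≡_; _≢_)

  -- Determinants as alternating functions of the rows.

  module LinAlg (R : CommutativeRing 0ℓ 0ℓ) where
    open CommutativeRing R hiding (zero)
    open import Algebra.Properties.Ring ring using (-‿involutive; -‿distribˡ-*; -‿distribʳ-*; +-inverseˡ-unique)
    import Algebra.Properties.Semiring.Sum semiring as Sum
    open import Algebra.Properties.CommutativeSemigroup *-commutativeSemigroup using (x∙yz≈y∙xz)
    open import Relation.Binary.Reasoning.Setoid setoid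

    Row : ℕ → Set
    Row n = Fin n → Carrier

    Mat : ℕ → ℕ → Set
    Mat m n = Fin m → Row n

    infix 4 _≋_
    _≋_ : ∀ {m n} → Mat m n → Mat m n → Set
    A ≋ B = ∀ i j → A i j ≈ B i j

    -- Opaque so that unification can read f off ∑ f.
    opaque
      ∑ : ∀ {n} → Row n → Carrier
      ∑ = Sum.sum

      ∑-zero : {t : Row 0} → ∑ t ≈ 0#
      ∑-zero = refl

      ∑-suc : ∀ {n} (t : Row (suc n)) → ∑ t ≈ t zero + ∑ (tail t)
      ∑-suc t = refl

      ∑-cong : ∀ {n} {s t : Row n} → (∀ i → s i ≈ t i) → ∑ s ≈ ∑ t
      ∑-cong = Sum.sum-cong-≋

      ∑-+ : ∀ {n} (s t : Row n) → ∑ (λ i → s i + t i) ≈ ∑ s + ∑ t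
      ∑-+ = Sum.∑-distrib-+

      ∑-comm : ∀ {m n} (f : Mat m n) → ∑ (λ i → ∑ (f i)) ≈ ∑ (λ j → ∑ λ i → f i j)
      ∑-comm = Sum.∑-comm

      *-∑ : ∀ {n} a (t : Row n) → a * ∑ t ≈ ∑ (λ i → a * t i)
      *-∑ = Sum.*-distribˡ-sum

      ∑-* : ∀ {n} a (t : Row n) → ∑ t * a ≈ ∑ (λ i → t i * a)
      ∑-* = Sum.*-distribʳ-sum

      ∑-remove : ∀ {n} i (t : Row (suc n)) → ∑ t ≈ t i + ∑ (removeAt t i)
      ∑-remove i = Sum.sum-remove {i = i}

    ∑-zeros : ∀ {n} {t : Row n} → (∀ i → t i ≈ 0#) → ∑ t ≈ 0#
    ∑-zeros {zero} h = ∑-zero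
    ∑-zeros {suc n} h = trans (∑-suc _) (trans (+-cong (h zero) (∑-zeros (λ i → h (suc i)))) (+-identityˡ 0#))

    sgn : ℕ → Carrier
    sgn zero = 1#
    sgn (suc k) = - sgn k

    minor : ∀ {m n} → Mat (suc m) (suc n) → Fin (suc n) → Mat m n
    minor M j r c = M (suc r) (punchIn j c)

    det : ∀ {n} → Mat n n → Carrier
    det {zero} M = 1#
    det {suc n} M = ∑ λ j → sgn (toℕ j) * M zero j * det (minor M j)

    Off : ∀ {m n} → Fin m → Mat m n → Mat m n → Set
    Off i M M′ = ∀ k → k ≢ i → ∀ j → M k j ≈ M′ k j

    -- The row length `N` is independent of the number `n` of rows, so that freezing the first row
    -- (`fix-head`) leaves an alternating function of the others. The induction in `alternating-·`
    -- relies on this.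
    record Alternating {n N} (g : Mat n N → Carrier) : Set where
      field
        g-cong : ∀ {M M′} → M ≋ M′ → g M ≈ g M′
        linear : ∀ i a {M M′ M″} → Off i M M′ → Off i M M″ →
                 (∀ j → M i j ≈ a * M′ i j + M″ i j) → g M ≈ a * g M′ + g M″
        altern : ∀ i k → i ≢ k → ∀ {M} → (∀ j → M i j ≈ M k j) → g M ≈ 0#

    ∷-η : ∀ {m n} (M : Mat (suc m) n) → M ≋ (M zero ∷ tail M)
    ∷-η M zero j = refl
    ∷-η M (suc i) j = refl

    ∷-cong : ∀ {m n} {v w : Row n} {M M′ : Mat m n} → (∀ j → v j ≈ w j) → M ≋ M′ → (v ∷ M) ≋ (w ∷ M′)
    ∷-cong p q zero j = p j
    ∷-cong p q (suc i) j = q i j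

    set : ∀ {m n} → Mat m n → Fin m → Row n → Mat m n
    set M i v k with k ≟ i
    ... | yes _ = v
    ... | no _ = M k

    set-same : ∀ {m n} (M : Mat m n) i v j → set M i v i j ≈ v j
    set-same M i v j with i ≟ i
    ... | yes _ = refl
    ... | no ¬p = contradiction ≡.refl ¬p

    set-other : ∀ {m n} (M : Mat m n) i v k → k ≢ i → ∀ j → set M i v k j ≈ M k j
    set-other M i v k k≢i j with k ≟ i
    ... | yes p = contradiction p k≢i
    ... | no _ = refl

    module _ {n N} {g : Mat n N → Carrier} (G : Alternating g) where
      open Alternating G

      add-row : ∀ i {M M′ M″} → Off i M M′ → Off i M M″ →
                (∀ j → M i j ≈ M′ i j + M″ i j) → g M ≈ g M′ + g M″
      add-row i o o′ h = trans (linear i 1# o o′ λ j → trans (h j) (+-congʳ (sym (*-identityˡ _))))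
                               (+-congʳ (*-identityˡ _))

      zero-row : ∀ i {M} → (∀ j → M i j ≈ 0#) → g M ≈ 0#
      zero-row i {M} h = sym (trans (sym (-‿inverseʳ (g M))) (trans (+-congʳ gM) (trans (+-assoc _ _ _) (trans (+-congˡ (-‿inverseʳ _)) (+-identityʳ _)))))
        where
        gM : g M ≈ g M + g M
        gM = add-row i (λ _ _ _ → refl) (λ _ _ _ → refl) λ j →
               trans (h j) (sym (trans (+-cong (h j) (h j)) (+-identityˡ 0#)))

      -- Polarization: with the row `s` = b + a in both places `i` and `k`, the expansion of `g`
      -- leaves only the two mixed terms, whose sum must vanish.
      swap-rows : ∀ i k → i ≢ k → ∀ {M M′} → (∀ l → l ≢ i → l ≢ k → ∀ j → M l j ≈ M′ l j) →
                  (∀ j → M i j ≈ M′ k j) → (∀ j → M k j ≈ M′ i j) → g M ≈ - g M′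
      swap-rows i k i≢k {M} {M′} off ik ki = trans (g-cong M≋) (trans (+-inverseˡ-unique _ _ total) (-‿cong (g-cong M′≋)))
        where
        B : Row N → Row N → Mat n N
        B u v = set (set M i u) k v

        at-k : ∀ u v j → B u v k j ≈ v j
        at-k u v = set-same (set M i u) k v
        at-i : ∀ u v j → B u v i j ≈ u j
        at-i u v j = trans (set-other (set M i u) k v i i≢k j) (set-same M i u j)
        at-l : ∀ u v l → l ≢ i → l ≢ k → ∀ j → B u v l j ≈ M l j
        at-l u v l l≢i l≢k j = trans (set-other (set M i u) k v l l≢k j) (set-other M i u l l≢i j)

        row-cases : ∀ {X Y : Mat n N} → (∀ j → X i j ≈ Y i j) → (∀ j → X k j ≈ Y k j) →
                    (∀ l → l ≢ i → l ≢ k → ∀ j → X l j ≈ Y l j) → X ≋ Y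
        row-cases p q r l j with l ≟ i | l ≟ k
        ... | yes ≡.refl | _ = p j
        ... | no _ | yes ≡.refl = q j
        ... | no a | no b = r l a b j

        a b s : Row N
        a = M k
        b = M i
        s j = b j + a j

        off-k : ∀ u v w → Off k (B u v) (B u w)
        off-k u v w l l≢k j = trans (set-other (set M i u) k v l l≢k j) (sym (set-other (set M i u) k w l l≢k j))

        off-i : ∀ u w v → Off i (B u v) (B w v)
        off-i u w v l l≢i j with l ≟ k
        ... | yes ≡.refl = refl
        ... | no _ = trans (set-other M i u l l≢i j) (sym (set-other M i w l l≢i j))

        add-i : ∀ v → g (B s v) ≈ g (B b v) + g (B a v)
        add-i v = add-row i (off-i s b v) (off-i s a v) λ j →
          trans (at-i s v j) (sym (+-cong (at-i b v j) (at-i a v j)))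
        add-k : ∀ u → g (B u s) ≈ g (B u b) + g (B u a)
        add-k u = add-row k (off-k u s b) (off-k u s a) λ j →
          trans (at-k u s j) (sym (+-cong (at-k u b j) (at-k u a j)))
        same : ∀ u → g (B u u) ≈ 0#
        same u = altern i k i≢k λ j → trans (at-i u u j) (sym (at-k u u j))

        total : g (B b a) + g (B a b) ≈ 0#
        total = begin
          g (B b a) + g (B a b) ≈⟨ +-cong (sym (+-identityˡ _)) (sym (+-identityʳ _)) ⟩
          (0# + g (B b a)) + (g (B a b) + 0#) ≈⟨ sym (+-cong (+-congʳ (same b)) (+-congˡ (same a))) ⟩
          (g (B b b) + g (B b a)) + (g (B a b) + g (B a a)) ≈⟨ sym (+-cong (add-k b) (add-k a)) ⟩
          g (B b s) + g (B a s) ≈⟨ sym (add-i s) ⟩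
          g (B s s) ≈⟨ same s ⟩
          0# ∎

        M≋ : M ≋ B b a
        M≋ = row-cases (λ j → sym (at-i b a j)) (λ j → sym (at-k b a j)) (λ l p q j → sym (at-l b a l p q j))
        M′≋ : B a b ≋ M′
        M′≋ = row-cases (λ j → trans (at-i a b j) (ki j)) (λ j → trans (at-k a b j) (ik j))
                (λ l p q j → trans (at-l a b l p q j) (off l p q j))

    module _ {n N} {g : Mat (suc n) N → Carrier} (G : Alternating g) where
      open Alternating G

      suc≢ : ∀ {m} {i k : Fin m} → i ≢ k → suc i ≢ suc k
      suc≢ p ≡.refl = p ≡.refl

      off-suc : ∀ {v : Row N} {i} {M M′ : Mat n N} → Off i M M′ → Off (suc i) (v ∷ M) (v ∷ M′)
      off-suc o zero p j = refl
      off-suc o (suc k) p j = o k (λ q → p (≡.cong suc q)) j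

      off-zero : ∀ {v w : Row N} {M : Mat n N} → Off zero (v ∷ M) (w ∷ M)
      off-zero zero p j = contradiction ≡.refl p
      off-zero (suc k) p j = refl

      fix-head : ∀ v → Alternating (λ M → g (v ∷ M))
      fix-head v = record
        { g-cong = λ p → g-cong (∷-cong (λ _ → refl) p)
        ; linear = λ i a o o′ h → linear (suc i) a (off-suc o) (off-suc o′) h
        ; altern = λ i k i≢k h → altern (suc i) (suc k) (suc≢ i≢k) h
        }

      head-∑ : ∀ {k} (a : Row k) (u : Mat k N) M →
                 g ((λ j → ∑ λ i → a i * u i j) ∷ M) ≈ ∑ λ i → a i * g (u i ∷ M)
      head-∑ {zero} a u M = trans (zero-row G zero λ _ → ∑-zero) (sym ∑-zero)
      head-∑ {suc k} a u M =
        trans (linear zero (a zero) off-zero off-zero λ j → ∑-suc _) (trans (+-congˡ (head-∑ (tail a) (tail u) M)) (sym (∑-suc _)))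

      clear-head : ∀ w (c : Row n) M → g (w ∷ (λ i j → c i * w j + M i j)) ≈ g (w ∷ M)
      clear-head w = go (λ p → g-cong (∷-cong (λ _ → refl) p)) step
        where
        -- The induction over the rows passes to functions of fewer rows. What survives the fixing
        -- of a row is invariance under adding a multiple of `w` to any single row.
        Invariant : ∀ {m} → (Mat m N → Carrier) → Set
        Invariant h = ∀ i c {M M′} → Off i M M′ → (∀ j → M i j ≈ c * w j + M′ i j) → h M ≈ h M′

        go : ∀ {m} {h : Mat m N → Carrier} → (∀ {M M′} → M ≋ M′ → h M ≈ h M′) → Invariant h →
             ∀ (c : Row m) M → h (λ i j → c i * w j + M i j) ≈ h M
        go {zero} h-cong inv c M = h-cong λ ()
        go {suc m} {h} h-cong inv c M = begin
          h (λ i j → c i * w j + M i j) ≈⟨ inv zero (c zero) (λ { zero p j → contradiction ≡.refl p ; (suc k) p j → refl }) (λ _ → refl) ⟩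
          h (M zero ∷ (λ i j → c (suc i) * w j + M (suc i) j))
            ≈⟨ go {h = λ X → h (M zero ∷ X)} (λ p → h-cong (∷-cong (λ _ → refl) p))
                 (λ i c′ o q → inv (suc i) c′ (λ { zero p j → refl ; (suc k) p j → o k (λ q → p (≡.cong suc q)) j }) q) (tail c) (tail M) ⟩
          h (M zero ∷ tail M) ≈⟨ h-cong (λ i j → sym (∷-η M i j)) ⟩
          h M ∎

        step : Invariant (λ M → g (w ∷ M))
        step i c {M} {M′} o h = trans (linear (suc i) c {M′ = w ∷ M‴} (off-suc o‴) (off-suc o) h‴)
                                (trans (+-congʳ (trans (*-congˡ (altern zero (suc i) (λ ()) λ j → sym (set-same M i w j))) (zeroʳ c))) (+-identityˡ _))
          where
          M‴ : Mat n N
          M‴ = set M i w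
          o‴ : Off i M M‴
          o‴ k p j = sym (set-other M i w k p j)
          h‴ : ∀ j → M i j ≈ c * M‴ i j + M′ i j
          h‴ j = trans (h j) (+-congʳ (*-congˡ (sym (set-same M i w j))))

    -- Row `j` reaches the top by `j` exchanges of neighbouring rows, each contributing a sign.
    pull-row : ∀ {n N} {g : Mat (suc n) N → Carrier} → Alternating g → ∀ j (B : Mat (suc n) N) →
               g (B j ∷ (B ∘ punchIn j)) ≈ sgn (toℕ j) * g B
    pull-row G zero B = trans (g-cong (λ i j → sym (∷-η B i j))) (sym (*-identityˡ _))
      where open Alternating G
    pull-row {suc n} {N} {g} G (suc j) B = begin
      g (B (suc j) ∷ (B ∘ punchIn (suc j))) ≈⟨ swap-rows G zero (suc zero) (λ ())
          {M′ = B zero ∷ (B (suc j) ∷ (tail B ∘ punchIn j))}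
          (λ { zero p q → contradiction ≡.refl p ; (suc zero) p q → contradiction ≡.refl q ; (suc (suc l)) p q j → refl }) (λ _ → refl) (λ _ → refl) ⟩
      - g (B zero ∷ (tail B j ∷ (tail B ∘ punchIn j))) ≈⟨ -‿cong (pull-row (fix-head G (B zero)) j (tail B)) ⟩
      - (sgn (toℕ j) * g (B zero ∷ tail B)) ≈⟨ -‿cong (*-congˡ (g-cong (λ i j → sym (∷-η B i j)))) ⟩
      - (sgn (toℕ j) * g B) ≈⟨ -‿distribˡ-* _ _ ⟩
      - sgn (toℕ j) * g B ∎
      where open Alternating G

    -- The pairs (j , punchIn j k) run over all ordered pairs of distinct indices; exchanging the two
    -- entries of a pair flips the sign.
    ∑-antisym : ∀ {n} (F : Fin (suc n) → Fin n → Carrier) →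
      (∀ j k j′ k′ → punchIn j k ≡ j′ → punchIn j′ k′ ≡ j → F j k ≈ F j′ k′) →
      (∑ λ j → ∑ λ k → sgn (toℕ j) * (sgn (toℕ k) * F j k)) ≈ 0#
    ∑-antisym {zero} F sym-F = ∑-zeros λ j → ∑-zero
    ∑-antisym {suc n} F sym-F = begin
      (∑ λ j → ∑ λ k → sgn (toℕ j) * (sgn (toℕ k) * F j k)) ≈⟨ ∑-suc _ ⟩
      (∑ λ k → 1# * (sgn (toℕ k) * F zero k)) + (∑ λ j → ∑ λ k → - sgn (toℕ j) * (sgn (toℕ k) * F (suc j) k)) ≈⟨ +-congˡ (∑-cong λ j → ∑-suc _) ⟩
      (∑ λ k → 1# * (sgn (toℕ k) * F zero k)) + (∑ λ j → - sgn (toℕ j) * (1# * F (suc j) zero) + (∑ λ k → - sgn (toℕ j) * (- sgn (toℕ k) * F (suc j) (suc k))))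
        ≈⟨ +-congˡ (∑-+ (λ j → - sgn (toℕ j) * (1# * F (suc j) zero)) _) ⟩
      (∑ λ k → 1# * (sgn (toℕ k) * F zero k)) + ((∑ λ j → - sgn (toℕ j) * (1# * F (suc j) zero)) + (∑ λ j → ∑ λ k → - sgn (toℕ j) * (- sgn (toℕ k) * F (suc j) (suc k))))
        ≈⟨ +-assoc _ _ _ ⟨
      ((∑ λ k → 1# * (sgn (toℕ k) * F zero k)) + (∑ λ j → - sgn (toℕ j) * (1# * F (suc j) zero))) + (∑ λ j → ∑ λ k → - sgn (toℕ j) * (- sgn (toℕ k) * F (suc j) (suc k)))
        ≈⟨ +-cong cancel rest ⟩
      0# + 0# ≈⟨ +-identityˡ 0# ⟩
      0# ∎
      where
      cancel : (∑ λ k → 1# * (sgn (toℕ k) * F zero k)) + (∑ λ j → - sgn (toℕ j) * (1# * F (suc j) zero)) ≈ 0#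
      cancel = trans (sym (∑-+ (λ k → 1# * (sgn (toℕ k) * F zero k)) _)) (∑-zeros λ k → begin
        1# * (sgn (toℕ k) * F zero k) + - sgn (toℕ k) * (1# * F (suc k) zero)
          ≈⟨ +-cong (*-identityˡ _) (trans (*-congˡ (*-identityˡ _)) (sym (-‿distribˡ-* _ _))) ⟩
        sgn (toℕ k) * F zero k + - (sgn (toℕ k) * F (suc k) zero)
          ≈⟨ +-congˡ (-‿cong (*-congˡ (sym-F (suc k) zero zero k ≡.refl ≡.refl))) ⟩
        sgn (toℕ k) * F zero k + - (sgn (toℕ k) * F zero k) ≈⟨ -‿inverseʳ _ ⟩
        0# ∎)
      rest : (∑ λ j → ∑ λ k → - sgn (toℕ j) * (- sgn (toℕ k) * F (suc j) (suc k))) ≈ 0#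
      rest = trans (∑-cong λ j → ∑-cong λ k → begin
        - sgn (toℕ j) * (- sgn (toℕ k) * F (suc j) (suc k)) ≈⟨ *-congˡ (-‿distribˡ-* _ _) ⟨
        - sgn (toℕ j) * - (sgn (toℕ k) * F (suc j) (suc k)) ≈⟨ -‿distribˡ-* _ _ ⟨
        - (sgn (toℕ j) * - (sgn (toℕ k) * F (suc j) (suc k))) ≈⟨ -‿cong (-‿distribʳ-* _ _) ⟨
        - - (sgn (toℕ j) * (sgn (toℕ k) * F (suc j) (suc k))) ≈⟨ -‿involutive _ ⟩
        sgn (toℕ j) * (sgn (toℕ k) * F (suc j) (suc k)) ∎)
        (∑-antisym (λ j k → F (suc j) (suc k)) λ j k j′ k′ p q → sym-F _ _ _ _ (≡.cong suc p) (≡.cong suc q))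

    -- Two columns can be deleted in either order. This makes the double minors in `det-equal₀₁`
    -- symmetric in the pair of deleted columns.
    punchIn-swap : ∀ {n} (j j′ : Fin (suc (suc n))) k k′ → punchIn j k ≡ j′ → punchIn j′ k′ ≡ j →
                   ∀ (x : Fin n) → punchIn j (punchIn k x) ≡ punchIn j′ (punchIn k′ x)
    punchIn-swap zero zero k k′ () q x
    punchIn-swap zero (suc j′) k zero ≡.refl q x = ≡.refl
    punchIn-swap (suc j) zero zero k′ p ≡.refl x = ≡.refl
    punchIn-swap (suc j) (suc j′) (suc k) (suc k′) p q zero = ≡.refl
    punchIn-swap {suc n} (suc j) (suc j′) (suc k) (suc k′) p q (suc x) = ≡.cong suc (punchIn-swap j j′ k k′ (suc-inj p) (suc-inj q) x)
      where
      suc-inj : ∀ {m} {a b : Fin m} → Data.Fin.Base.suc a ≡ suc b → a ≡ b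
      suc-inj ≡.refl = ≡.refl

    det-cong : ∀ {n} {M M′ : Mat n n} → M ≋ M′ → det M ≈ det M′
    det-cong {zero} p = refl
    det-cong {suc n} p = ∑-cong λ j → *-cong (*-congˡ (p zero j)) (det-cong λ r c → p (suc r) (punchIn j c))

    private
      term-lin₀ : ∀ s a x y d → s * (a * x + y) * d ≈ a * (s * x * d) + s * y * d
      term-lin₀ s a x y d = begin
        s * (a * x + y) * d ≈⟨ *-congʳ (distribˡ s _ _) ⟩
        (s * (a * x) + s * y) * d ≈⟨ distribʳ d _ _ ⟩
        s * (a * x) * d + s * y * d ≈⟨ +-congʳ (*-congʳ (x∙yz≈y∙xz s a x)) ⟩
        a * (s * x) * d + s * y * d ≈⟨ +-congʳ (*-assoc a _ _) ⟩
        a * (s * x * d) + s * y * d ∎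
      term-lin₁ : ∀ u a x y → u * (a * x + y) ≈ a * (u * x) + u * y
      term-lin₁ u a x y = trans (distribˡ u _ _) (+-congʳ (x∙yz≈y∙xz u a x))

      ∑-lin : ∀ {n} a (x y : Row n) → (∑ λ j → a * x j + y j) ≈ a * ∑ x + ∑ y
      ∑-lin a x y = trans (∑-+ (λ j → a * x j) y) (+-congʳ (sym (*-∑ a x)))

      det-linear : ∀ {n} i a {M M′ M″ : Mat n n} → Off i M M′ → Off i M M″ →
                   (∀ j → M i j ≈ a * M′ i j + M″ i j) → det M ≈ a * det M′ + det M″
      det-linear {suc n} zero a {M} {M′} {M″} o o′ h = trans (∑-cong λ j → begin
          sgn (toℕ j) * M zero j * det (minor M j) ≈⟨ *-congʳ (*-congˡ (h j)) ⟩
          sgn (toℕ j) * (a * M′ zero j + M″ zero j) * det (minor M j) ≈⟨ term-lin₀ _ _ _ _ _ ⟩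
          a * (sgn (toℕ j) * M′ zero j * det (minor M j)) + sgn (toℕ j) * M″ zero j * det (minor M j)
            ≈⟨ +-cong (*-congˡ (*-congˡ (det-cong λ r c → o (suc r) (λ ()) _))) (*-congˡ (det-cong λ r c → o′ (suc r) (λ ()) _)) ⟩
          a * (sgn (toℕ j) * M′ zero j * det (minor M′ j)) + sgn (toℕ j) * M″ zero j * det (minor M″ j) ∎)
        (∑-lin a _ _)
      det-linear {suc n} (suc i) a {M} {M′} {M″} o o′ h = trans (∑-cong λ j → begin
          sgn (toℕ j) * M zero j * det (minor M j)
            ≈⟨ *-congˡ (det-linear i a (λ k p c → o (suc k) (λ { ≡.refl → p ≡.refl }) _) (λ k p c → o′ (suc k) (λ { ≡.refl → p ≡.refl }) _) λ c → h _) ⟩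
          sgn (toℕ j) * M zero j * (a * det (minor M′ j) + det (minor M″ j)) ≈⟨ term-lin₁ _ _ _ _ ⟩
          a * (sgn (toℕ j) * M zero j * det (minor M′ j)) + sgn (toℕ j) * M zero j * det (minor M″ j)
            ≈⟨ +-cong (*-congˡ (*-congʳ (*-congˡ (o zero (λ ()) j)))) (*-congʳ (*-congˡ (o′ zero (λ ()) j))) ⟩
          a * (sgn (toℕ j) * M′ zero j * det (minor M′ j)) + sgn (toℕ j) * M″ zero j * det (minor M″ j) ∎)
        (∑-lin a _ _)

      -- Expanding along the first two rows gives a sum over ordered pairs of distinct columns. When
      -- the two rows agree, the summand without its sign is symmetric in the pair, and `∑-antisym`
      -- applies.
      det-equal₀₁ : ∀ {n} {M : Mat (suc (suc n)) (suc (suc n))} → (∀ j → M zero j ≈ M (suc zero) j) → det M ≈ 0#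
      det-equal₀₁ {n} {M} h = trans (∑-cong λ j → begin
          sgn (toℕ j) * M zero j * (∑ λ k → sgn (toℕ k) * M (suc zero) (punchIn j k) * D j k)
            ≈⟨ *-∑ _ (λ k → sgn (toℕ k) * M (suc zero) (punchIn j k) * D j k) ⟩
          (∑ λ k → sgn (toℕ j) * M zero j * (sgn (toℕ k) * M (suc zero) (punchIn j k) * D j k))
            ≈⟨ ∑-cong (λ k → reorder (sgn (toℕ j)) (M zero j) (sgn (toℕ k)) (M (suc zero) (punchIn j k)) (D j k)) ⟩
          (∑ λ k → sgn (toℕ j) * (sgn (toℕ k) * (M zero j * M (suc zero) (punchIn j k) * D j k))) ∎)
        (∑-antisym (λ j k → M zero j * M (suc zero) (punchIn j k) * D j k) λ
          { j k j′ k′ ≡.refl q → *-cong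
              (trans (*-comm _ _) (*-cong (sym (h j′)) (trans (h j) (reflexive (≡.cong (M (suc zero)) (≡.sym q))))))
              (det-cong λ r c → reflexive (≡.cong (M (suc (suc r))) (punchIn-swap j j′ k k′ ≡.refl q c))) })
        where
        D : Fin (suc (suc n)) → Fin (suc n) → Carrier
        D j k = det (minor (minor M j) k)
        reorder : ∀ s x t y d → s * x * (t * y * d) ≈ s * (t * (x * y * d))
        reorder s x t y d = begin
          s * x * (t * y * d) ≈⟨ *-assoc s x _ ⟩
          s * (x * (t * y * d)) ≈⟨ *-congˡ (*-congˡ (*-assoc t y d)) ⟩
          s * (x * (t * (y * d))) ≈⟨ *-congˡ (x∙yz≈y∙xz x t _) ⟩
          s * (t * (x * (y * d))) ≈⟨ *-congˡ (*-congˡ (*-assoc x y d)) ⟨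
          s * (t * (x * y * d)) ∎

    det-alternating : ∀ {n} → Alternating (det {n})
    det-alternating {zero} = record { g-cong = det-cong ; linear = λ () ; altern = λ () }
    det-alternating {suc n} = record { g-cong = det-cong ; linear = det-linear ; altern = equal }
      where
      minor-zero : ∀ {M : Mat (suc n) (suc n)} → (∀ j → det (minor M j) ≈ 0#) → det M ≈ 0#
      minor-zero h = ∑-zeros λ j → trans (*-congˡ (h j)) (zeroʳ _)

      -- An equal row further down is first exchanged with row 1. That exchange takes place inside
      -- every minor along row 0, where the smaller determinant is already known to be alternating.
      equal₀ : ∀ {n} → Alternating (det {n}) → ∀ k {M : Mat (suc n) (suc n)} → (∀ j → M zero j ≈ M (suc k) j) → det M ≈ 0#
      equal₀ IH zero {M} h = det-equal₀₁ {M = M} h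
      equal₀ {suc n} IH (suc k) {M} h = begin
        det M ≈⟨ ∑-cong (λ j → trans (*-congˡ {sgn (toℕ j) * M zero j} (swap-rows IH zero (suc k) (λ ()) {minor M j} {M′ = minor M′ j}
                   (λ { zero p q → contradiction ≡.refl p ; (suc l) p q c → sym (set-other M₁ (suc (suc k)) (M (suc zero)) (suc (suc l)) (λ { ≡.refl → q ≡.refl }) (punchIn j c)) })
                   (λ c → sym (set-same M₁ (suc (suc k)) (M (suc zero)) (punchIn j c))) (λ c → refl)))
                   (sym (-‿distribʳ-* _ _))) ⟩
        (∑ λ j → - (sgn (toℕ j) * M zero j * det (minor M′ j))) ≈⟨ ∑-cong (λ j → trans (-‿cong (sym (*-identityˡ _))) (-‿distribˡ-* _ _)) ⟩
        (∑ λ j → - 1# * (sgn (toℕ j) * M zero j * det (minor M′ j))) ≈⟨ *-∑ (- 1#) (λ j → sgn (toℕ j) * M zero j * det (minor M′ j)) ⟨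
        - 1# * det M′ ≈⟨ *-congˡ (det-equal₀₁ {M = M′} h) ⟩
        - 1# * 0# ≈⟨ zeroʳ _ ⟩
        0# ∎
        where
        M₁ M′ : Mat (suc (suc n)) (suc (suc n))
        M₁ = M zero ∷ (M (suc (suc k)) ∷ (λ l → M (suc (suc l))))
        M′ = set M₁ (suc (suc k)) (M (suc zero))

      equal : ∀ i k → i ≢ k → ∀ {M : Mat (suc n) (suc n)} → (∀ j → M i j ≈ M k j) → det M ≈ 0#
      equal zero zero p h = contradiction ≡.refl p
      equal zero (suc k) p {M} h = equal₀ det-alternating k {M} h
      equal (suc i) zero p {M} h = equal₀ det-alternating i {M} (λ j → sym (h j))
      equal (suc i) (suc k) p {M} h = minor-zero {M} λ j →
        Alternating.altern det-alternating i k (λ { ≡.refl → p ≡.refl }) λ c → h (punchIn j c)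

    infixl 7 _·_
    _·_ : ∀ {l m n} → Mat l m → Mat m n → Mat l n
    (A · B) i j = ∑ λ k → A i k * B k j

    -- Expand the first row of `A · B` in the rows of `B`; in the term of `B j`, the multiples of
    -- `B j` in the other rows can be cleared, and what remains is a product with one row fewer.
    -- Multiplicativity of `det` and the determinant of a block triangular matrix are both
    -- instances.
    alternating-· : ∀ {n N} {g : Mat n N → Carrier} → Alternating g → ∀ A B → g (A · B) ≈ det A * g B
    alternating-· {zero} G A B = trans (g-cong λ ()) (sym (*-identityˡ _))
      where open Alternating G
    alternating-· {suc n} {N} {g} G A B = begin
      g (A · B) ≈⟨ g-cong (∷-η (A · B)) ⟩
      g ((A · B) zero ∷ tail (A · B)) ≈⟨ head-∑ G (A zero) B (tail (A · B)) ⟩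
      (∑ λ j → A zero j * g (B j ∷ tail (A · B))) ≈⟨ ∑-cong (λ j → *-congˡ {A zero j} (expand j)) ⟩
      (∑ λ j → A zero j * (det (minor A j) * (sgn (toℕ j) * g B))) ≈⟨ ∑-cong (λ j → reorder (A zero j) (det (minor A j)) (sgn (toℕ j)) (g B)) ⟩
      (∑ λ j → sgn (toℕ j) * A zero j * det (minor A j) * g B) ≈⟨ ∑-* (g B) (λ j → sgn (toℕ j) * A zero j * det (minor A j)) ⟨
      det A * g B ∎
      where
      open Alternating G
      reorder : ∀ a d s b → a * (d * (s * b)) ≈ s * a * d * b
      reorder a d s b = begin
        a * (d * (s * b)) ≈⟨ *-congˡ (x∙yz≈y∙xz d s b) ⟩
        a * (s * (d * b)) ≈⟨ *-assoc a s _ ⟨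
        a * s * (d * b) ≈⟨ *-congʳ (*-comm a s) ⟩
        s * a * (d * b) ≈⟨ *-assoc _ d b ⟨
        s * a * d * b ∎
      expand : ∀ j → g (B j ∷ tail (A · B)) ≈ det (minor A j) * (sgn (toℕ j) * g B)
      expand j = begin
        g (B j ∷ tail (A · B)) ≈⟨ g-cong (∷-cong (λ _ → refl) λ i c → ∑-remove j (λ k → A (suc i) k * B k c)) ⟩
        g (B j ∷ (λ i c → A (suc i) j * B j c + (minor A j · (B ∘ punchIn j)) i c)) ≈⟨ clear-head G (B j) (λ i → A (suc i) j) _ ⟩
        g (B j ∷ (minor A j · (B ∘ punchIn j))) ≈⟨ alternating-· (fix-head G (B j)) (minor A j) (B ∘ punchIn j) ⟩
        det (minor A j) * g (B j ∷ (B ∘ punchIn j)) ≈⟨ *-congˡ (pull-row G j B) ⟩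
        det (minor A j) * (sgn (toℕ j) * g B) ∎

    det-· : ∀ {n} (A B : Mat n n) → det (A · B) ≈ det A * det B
    det-· = alternating-· det-alternating

  split-elim : ∀ k {n} (P : Fin (k ℕ.+ n) → Set) → (∀ i → P (i ↑ˡ n)) → (∀ j → P (k ↑ʳ j)) → ∀ r → P r
  split-elim zero P f g r = g r
  split-elim (suc k) P f g zero = f zero
  split-elim (suc k) P f g (suc r) = split-elim k (P ∘ suc) (f ∘ suc) g r

  ↑ˡ≢↑ʳ : ∀ k {n} {i : Fin k} {j : Fin n} → i ↑ˡ n ≢ k ↑ʳ j
  ↑ˡ≢↑ʳ (suc k) {i = suc i} p = ↑ˡ≢↑ʳ k {i = i} (suc-inj p)
    where
    suc-inj : ∀ {m} {a b : Fin m} → Fin.suc a ≡ suc b → a ≡ b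
    suc-inj ≡.refl = ≡.refl

  -- The ring of square matrices, and block matrices.

  module BlockMatrices (R : CommutativeRing 0ℓ 0ℓ) where
    open CommutativeRing R hiding (zero)
    open LinAlg R
    open import Relation.Binary.Reasoning.Setoid setoid

    ≋-refl : ∀ {m n} {A : Mat m n} → A ≋ A
    ≋-refl i j = refl
    ≋-sym : ∀ {m n} {A B : Mat m n} → A ≋ B → B ≋ A
    ≋-sym p i j = sym (p i j)
    ≋-trans : ∀ {m n} {A B C : Mat m n} → A ≋ B → B ≋ C → A ≋ C
    ≋-trans p q i j = trans (p i j) (q i j)

    I : ∀ {n} → Mat n n
    I zero zero = 1#
    I zero (suc j) = 0#
    I (suc i) zero = 0#
    I (suc i) (suc j) = I i j

    O : ∀ {m n} → Mat m n
    O i j = 0#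

    infixl 6 _⊞_
    _⊞_ : ∀ {m n} → Mat m n → Mat m n → Mat m n
    (A ⊞ B) i j = A i j + B i j

    ⊟_ : ∀ {m n} → Mat m n → Mat m n
    (⊟ A) i j = - A i j

    I-diag : ∀ {n} (i : Fin n) → I i i ≈ 1#
    I-diag zero = refl
    I-diag (suc i) = I-diag i

    I-off : ∀ {n} (i j : Fin n) → i ≢ j → I i j ≈ 0#
    I-off zero zero p = contradiction ≡.refl p
    I-off zero (suc j) p = refl
    I-off (suc i) zero p = refl
    I-off (suc i) (suc j) p = I-off i j λ { ≡.refl → p ≡.refl }

    ∑-I : ∀ {n} i (t : Row n) → ∑ (λ j → I i j * t j) ≈ t i
    ∑-I zero t = trans (∑-suc _) (trans (+-cong (*-identityˡ _) (∑-zeros λ j → zeroˡ _)) (+-identityʳ _))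
    ∑-I (suc i) t = trans (∑-suc _) (trans (+-cong (zeroˡ _) (∑-I i (tail t))) (+-identityˡ _))

    I-sym : ∀ {n} (i j : Fin n) → I i j ≈ I j i
    I-sym zero zero = refl
    I-sym zero (suc j) = refl
    I-sym (suc i) zero = refl
    I-sym (suc i) (suc j) = I-sym i j

    ·-cong : ∀ {l m n} {A A′ : Mat l m} {B B′ : Mat m n} → A ≋ A′ → B ≋ B′ → A · B ≋ A′ · B′
    ·-cong p q i j = ∑-cong λ k → *-cong (p i k) (q k j)

    ·-identityˡ : ∀ {m n} (A : Mat m n) → I · A ≋ A
    ·-identityˡ A i j = ∑-I i (λ k → A k j)

    ·-identityʳ : ∀ {m n} (A : Mat m n) → A · I ≋ A
    ·-identityʳ A i j = trans (∑-cong λ k → trans (*-comm _ _) (*-congʳ (I-sym k j))) (∑-I j (A i))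

    ·-assoc : ∀ {l m n o} (A : Mat l m) (B : Mat m n) (C : Mat n o) → A · B · C ≋ A · (B · C)
    ·-assoc A B C i j = begin
      (∑ λ k → (∑ λ l → A i l * B l k) * C k j) ≈⟨ ∑-cong (λ k → ∑-* (C k j) (λ l → A i l * B l k)) ⟩
      (∑ λ k → ∑ λ l → A i l * B l k * C k j) ≈⟨ ∑-comm (λ k l → A i l * B l k * C k j) ⟩
      (∑ λ l → ∑ λ k → A i l * B l k * C k j) ≈⟨ ∑-cong (λ l → ∑-cong λ k → *-assoc _ _ _) ⟩
      (∑ λ l → ∑ λ k → A i l * (B l k * C k j)) ≈⟨ ∑-cong (λ l → *-∑ (A i l) (λ k → B l k * C k j)) ⟨
      (∑ λ l → A i l * (∑ λ k → B l k * C k j)) ∎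

    ·-distribˡ : ∀ {l m n} (A : Mat l m) (B C : Mat m n) → A · (B ⊞ C) ≋ A · B ⊞ A · C
    ·-distribˡ A B C i j = trans (∑-cong λ k → distribˡ _ _ _) (∑-+ _ _)

    ·-distribʳ : ∀ {l m n} (A : Mat m n) (B C : Mat l m) → (B ⊞ C) · A ≋ B · A ⊞ C · A
    ·-distribʳ A B C i j = trans (∑-cong λ k → distribʳ _ _ _) (∑-+ _ _)

    matRing : ℕ → Ring 0ℓ 0ℓ
    matRing n = record
      { Carrier = Mat n n ; _≈_ = _≋_ ; _+_ = _⊞_ ; _*_ = _·_ ; -_ = ⊟_ ; 0# = O ; 1# = I
      ; isRing = record
        { +-isAbelianGroup = record
          { isGroup = record
            { isMonoid = record
              { isSemigroup = record
                { isMagma = record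
                  { isEquivalence = record { refl = ≋-refl ; sym = ≋-sym ; trans = ≋-trans }
                  ; ∙-cong = λ p q i j → +-cong (p i j) (q i j) }
                ; assoc = λ A B C i j → +-assoc _ _ _ }
              ; identity = (λ A i j → +-identityˡ _) , (λ A i j → +-identityʳ _) }
            ; inverse = (λ A i j → -‿inverseˡ _) , (λ A i j → -‿inverseʳ _)
            ; ⁻¹-cong = λ p i j → -‿cong (p i j) }
          ; comm = λ A B i j → +-comm _ _ }
        ; *-cong = ·-cong
        ; *-assoc = ·-assoc
        ; *-identity = ·-identityˡ , ·-identityʳ
        ; distrib = ·-distribˡ , ·-distribʳ } }

    blk : ∀ {k l m n} → Mat k m → Mat k n → Mat l m → Mat l n → Mat (k ℕ.+ l) (m ℕ.+ n)
    blk A B C D = (λ i → A i ++ B i) ++ (λ i → C i ++ D i)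

    module _ {k l m n} (A : Mat k m) (B : Mat k n) (C : Mat l m) (D : Mat l n) where
      blk-A : ∀ i j → blk A B C D (i ↑ˡ l) (j ↑ˡ n) ≡ A i j
      blk-A i j = ≡.trans (≡.cong-app (lookup-++ˡ _ _ i) _) (lookup-++ˡ (A i) (B i) j)
      blk-B : ∀ i j → blk A B C D (i ↑ˡ l) (m ↑ʳ j) ≡ B i j
      blk-B i j = ≡.trans (≡.cong-app (lookup-++ˡ _ _ i) _) (lookup-++ʳ (A i) (B i) j)
      blk-C : ∀ i j → blk A B C D (k ↑ʳ i) (j ↑ˡ n) ≡ C i j
      blk-C i j = ≡.trans (≡.cong-app (lookup-++ʳ {m = k} _ _ i) _) (lookup-++ˡ (C i) (D i) j)
      blk-D : ∀ i j → blk A B C D (k ↑ʳ i) (m ↑ʳ j) ≡ D i j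
      blk-D i j = ≡.trans (≡.cong-app (lookup-++ʳ {m = k} _ _ i) _) (lookup-++ʳ (C i) (D i) j)

      ≋-blk : {X : Mat (k ℕ.+ l) (m ℕ.+ n)} →
              (∀ i j → X (i ↑ˡ l) (j ↑ˡ n) ≈ A i j) → (∀ i j → X (i ↑ˡ l) (m ↑ʳ j) ≈ B i j) →
              (∀ i j → X (k ↑ʳ i) (j ↑ˡ n) ≈ C i j) → (∀ i j → X (k ↑ʳ i) (m ↑ʳ j) ≈ D i j) → X ≋ blk A B C D
      ≋-blk {X} a b c d = split-elim k _
        (λ i → split-elim m _ (λ j → trans (a i j) (reflexive (≡.sym (blk-A i j)))) (λ j → trans (b i j) (reflexive (≡.sym (blk-B i j)))))
        (λ i → split-elim m _ (λ j → trans (c i j) (reflexive (≡.sym (blk-C i j)))) (λ j → trans (d i j) (reflexive (≡.sym (blk-D i j)))))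

    blk-cong : ∀ {k l m n} {A A′ : Mat k m} {B B′ : Mat k n} {C C′ : Mat l m} {D D′ : Mat l n} →
               A ≋ A′ → B ≋ B′ → C ≋ C′ → D ≋ D′ → blk A B C D ≋ blk A′ B′ C′ D′
    blk-cong {A = A} {A′} {B} {B′} {C} {C′} {D} {D′} a b c d = ≋-blk A′ B′ C′ D′
      (λ i j → trans (reflexive (blk-A A B C D i j)) (a i j)) (λ i j → trans (reflexive (blk-B A B C D i j)) (b i j))
      (λ i j → trans (reflexive (blk-C A B C D i j)) (c i j)) (λ i j → trans (reflexive (blk-D A B C D i j)) (d i j))

    ∑-split : ∀ k {n} (t : Row (k ℕ.+ n)) → ∑ t ≈ ∑ (λ i → t (i ↑ˡ n)) + ∑ (λ j → t (k ↑ʳ j))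
    ∑-split zero t = sym (trans (+-congʳ ∑-zero) (+-identityˡ _))
    ∑-split (suc k) t = trans (∑-suc t) (trans (+-congˡ (∑-split k (tail t)))
      (trans (sym (+-assoc _ _ _)) (+-congʳ (sym (∑-suc _)))))

    blk-· : ∀ {k l m n o r} (A : Mat k m) (B : Mat k n) (C : Mat l m) (D : Mat l n)
            (A′ : Mat m o) (B′ : Mat m r) (C′ : Mat n o) (D′ : Mat n r) →
            blk A B C D · blk A′ B′ C′ D′ ≋ blk (A · A′ ⊞ B · C′) (A · B′ ⊞ B · D′) (C · A′ ⊞ D · C′) (C · B′ ⊞ D · D′)
    blk-· {k} {l} {m} {n} {o} {r} A B C D A′ B′ C′ D′ = ≋-blk _ _ _ _
      (λ i j → trans (∑-split m _) (+-cong (∑-cong λ s → eq (blk-A A B C D i s) (blk-A A′ B′ C′ D′ s j)) (∑-cong λ s → eq (blk-B A B C D i s) (blk-C A′ B′ C′ D′ s j))))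
      (λ i j → trans (∑-split m _) (+-cong (∑-cong λ s → eq (blk-A A B C D i s) (blk-B A′ B′ C′ D′ s j)) (∑-cong λ s → eq (blk-B A B C D i s) (blk-D A′ B′ C′ D′ s j))))
      (λ i j → trans (∑-split m _) (+-cong (∑-cong λ s → eq (blk-C A B C D i s) (blk-A A′ B′ C′ D′ s j)) (∑-cong λ s → eq (blk-D A B C D i s) (blk-C A′ B′ C′ D′ s j))))
      (λ i j → trans (∑-split m _) (+-cong (∑-cong λ s → eq (blk-C A B C D i s) (blk-B A′ B′ C′ D′ s j)) (∑-cong λ s → eq (blk-D A B C D i s) (blk-D A′ B′ C′ D′ s j))))
      where
      eq : ∀ {a b c d} → a ≡ b → c ≡ d → a * c ≈ b * d
      eq p q = reflexive (≡.cong₂ _*_ p q)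

    det-row₀ : ∀ {n} (M : Mat (suc n) (suc n)) → (∀ j → M zero (suc j) ≈ 0#) → det M ≈ M zero zero * det (minor M zero)
    det-row₀ M h = trans (∑-suc _) (trans (+-cong (*-congʳ (*-identityˡ _))
      (∑-zeros λ j → trans (*-congʳ (trans (*-congˡ (h j)) (zeroʳ _))) (zeroˡ _))) (+-identityʳ _))

    det-col-zero : ∀ {n} (M : Mat (suc n) (suc n)) → (∀ i → M i zero ≈ 0#) → det M ≈ 0#
    det-col-zero {zero} M h = trans (det-row₀ M λ ()) (trans (*-congʳ (h zero)) (zeroˡ _))
    det-col-zero {suc n} M h = trans (∑-suc _) (trans (+-cong
      (trans (*-congʳ (trans (*-congˡ (h zero)) (zeroʳ _))) (zeroˡ _))
      (∑-zeros λ j → trans (*-congˡ (det-col-zero (minor M (suc j)) (λ i → h (suc i)))) (zeroʳ _))) (+-identityˡ _))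

    det-col₀ : ∀ {n} (M : Mat (suc n) (suc n)) → (∀ i → M (suc i) zero ≈ 0#) → det M ≈ M zero zero * det (minor M zero)
    det-col₀ {zero} M h = det-row₀ M λ ()
    det-col₀ {suc n} M h = trans (∑-suc _) (trans (+-cong (*-congʳ (*-identityˡ _))
      (∑-zeros λ j → trans (*-congˡ (det-col-zero (minor M (suc j)) h)) (zeroʳ _))) (+-identityʳ _))

    det-unitriangular : ∀ {n} (M : Mat n n) → (∀ i → M i i ≈ 1#) → (∀ i j → toℕ j ℕ.< toℕ i → M i j ≈ 0#) → det M ≈ 1#
    det-unitriangular {zero} M d u = refl
    det-unitriangular {suc n} M d u = trans (det-col₀ M λ i → u (suc i) zero (s≤s z≤n))
      (trans (*-cong (d zero) (det-unitriangular (minor M zero) (λ i → d (suc i)) λ i j p → u (suc i) (suc j) (s≤s p))) (*-identityˡ _))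

    det-I : ∀ {n} → det (I {n}) ≈ 1#
    det-I {n} = det-unitriangular {n} I I-diag λ i j p → I-off i j λ { ≡.refl → ℕ-irrefl p }
      where
      ℕ-irrefl : ∀ {a} → ¬ (a ℕ.< a)
      ℕ-irrefl (s≤s p) = ℕ-irrefl p

    ∏ : ∀ {n} → Row n → Carrier
    ∏ {zero} t = 1#
    ∏ {suc n} t = t zero * ∏ (tail t)

    det-diagonal : ∀ {n} (M : Mat n n) → (∀ i j → i ≢ j → M i j ≈ 0#) → det M ≈ ∏ λ i → M i i
    det-diagonal {zero} M h = refl
    det-diagonal {suc n} M h = trans (det-row₀ M λ j → h zero (suc j) λ ())
      (*-congˡ (det-diagonal (minor M zero) λ i j p → h (suc i) (suc j) λ { ≡.refl → p ≡.refl }))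

    det-blk-I-lower : ∀ k {n} (C : Mat n k) (D : Mat n n) → det (blk I O C D) ≈ det D
    det-blk-I-lower zero {n} C D = det-cong {n} λ i j → refl
    det-blk-I-lower (suc k) {n} C D = trans (det-row₀ (blk I O C D) (split-elim k _ (λ j → reflexive (blk-A I O C D zero (suc j))) (λ j → reflexive (blk-B I O C D zero j))))
      (trans (*-identityˡ _) (trans (det-cong {M = minor (blk I O C D) zero} (≋-blk I O (λ i j → C i (suc j)) D
         (λ i j → reflexive (blk-A I O C D (suc i) (suc j))) (λ i j → reflexive (blk-B I O C D (suc i) j))
         (λ i j → reflexive (blk-C I O C D i (suc j))) (λ i j → reflexive (blk-D I O C D i j))))
       (det-blk-I-lower k (λ i j → C i (suc j)) D)))

    det-blk-I-upper : ∀ k {n} (B : Mat k n) (D : Mat n n) → det (blk I B O D) ≈ det D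
    det-blk-I-upper zero {n} B D = det-cong {n} λ i j → refl
    det-blk-I-upper (suc k) {n} B D = trans (det-col₀ (blk I B O D) (split-elim k _ (λ i → reflexive (blk-A I B O D (suc i) zero)) (λ i → reflexive (blk-C I B O D i zero))))
      (trans (*-identityˡ _) (trans (det-cong {M = minor (blk I B O D) zero} (≋-blk I (tail B) O D
         (λ i j → reflexive (blk-A I B O D (suc i) (suc j))) (λ i j → reflexive (blk-B I B O D (suc i) j))
         (λ i j → reflexive (blk-C I B O D i (suc j))) (λ i j → reflexive (blk-D I B O D i j))))
       (det-blk-I-upper k (tail B) D)))

    -- As a function of its upper left block the determinant is alternating, so its value at `A · I`
    -- is `det A` times its value at `I`.
    det-blk : ∀ {k n} (A : Mat k k) (C : Mat n k) (D : Mat n n) → det (blk A O C D) ≈ det A * det D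
    det-blk {k} {n} A C D = begin
      det (blk A O C D) ≈⟨ det-cong (blk-cong {B = O} {O} {C} {C} {D} {D} (≋-sym (·-identityʳ A)) ≋-refl ≋-refl ≋-refl) ⟩
      det (blk (A · I) O C D) ≈⟨ alternating-· alternating-blk A I ⟩
      det A * det (blk I O C D) ≈⟨ *-congˡ (det-blk-I-lower k C D) ⟩
      det A * det D ∎
      where
      open Alternating (det-alternating {k ℕ.+ n})

      off-blk : ∀ i {M M′ : Mat k k} → Off i M M′ → Off (i ↑ˡ n) (blk M O C D) (blk M′ O C D)
      off-blk i {M} {M′} o = split-elim k _
        (λ i′ p → split-elim k _ (λ j → trans (reflexive (blk-A M O C D i′ j)) (trans (o i′ (λ { ≡.refl → p ≡.refl }) j) (reflexive (≡.sym (blk-A M′ O C D i′ j)))))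
                                  (λ j → reflexive (≡.trans (blk-B M O C D i′ j) (≡.sym (blk-B M′ O C D i′ j)))))
        (λ i′ p → split-elim k _ (λ j → reflexive (≡.trans (blk-C M O C D i′ j) (≡.sym (blk-C M′ O C D i′ j))))
                                  (λ j → reflexive (≡.trans (blk-D M O C D i′ j) (≡.sym (blk-D M′ O C D i′ j)))))

      alternating-blk : Alternating (λ X → det (blk X O C D))
      alternating-blk = record
        { g-cong = λ p → g-cong (blk-cong {B = O} {O} {C} {C} {D} {D} p ≋-refl ≋-refl ≋-refl)
        ; linear = λ i a {M} {M′} {M″} o o′ h → linear (i ↑ˡ n) a (off-blk i o) (off-blk i o′) (split-elim k _
            (λ j → trans (reflexive (blk-A M O C D i j)) (trans (h j) (sym (reflexive (≡.cong₂ (λ x y → a * x + y) (blk-A M′ O C D i j) (blk-A M″ O C D i j))))))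
            (λ j → trans (reflexive (blk-B M O C D i j)) (sym (trans (reflexive (≡.cong₂ (λ x y → a * x + y) (blk-B M′ O C D i j) (blk-B M″ O C D i j))) (trans (+-identityʳ _) (zeroʳ a))))))
        ; altern = λ i i′ i≢i′ {M} h → altern (i ↑ˡ n) (i′ ↑ˡ n) (λ p → i≢i′ (↑ˡ-injective n i i′ p)) (split-elim k _
            (λ j → trans (reflexive (blk-A M O C D i j)) (trans (h j) (reflexive (≡.sym (blk-A M O C D i′ j)))))
            (λ j → reflexive (≡.trans (blk-B M O C D i j) (≡.sym (blk-B M O C D i′ j))))) }

-- Polynomials evaluated at square matrices.

module Polynomials where
  open Determinants
  open import Algebra.Bundles using (CommutativeRing; Ring)
  open import Level using (0ℓ)
  open import Data.Nat.Base using (zero; suc)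
  open import Data.Fin.Base using (Fin; zero; suc; _↑ˡ_; _↑ʳ_)
  open import Data.List.Base using (List; []; _∷_; map; foldr)
  open import Data.Product using (_,_; ∃)
  open import Relation.Binary.PropositionalEquality as ≡ using (_≡_)

  module MatrixPolynomials (R : CommutativeRing 0ℓ 0ℓ) where
    open CommutativeRing R hiding (zero)
    open LinAlg R
    open BlockMatrices R
    open import Algebra.Properties.CommutativeSemigroup *-commutativeSemigroup using (x∙yz≈y∙xz)
    open import Algebra.Properties.Ring ring using (-‿distribˡ-*)

    infixl 8 _⊙_
    _⊙_ : ∀ {m n} → Carrier → Mat m n → Mat m n
    (a ⊙ A) i j = a * A i j

    ⊙-· : ∀ {l m n} a (A : Mat l m) (B : Mat m n) → a ⊙ A · B ≋ a ⊙ (A · B)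
    ⊙-· a A B i j = trans (∑-cong λ k → *-assoc _ _ _) (sym (*-∑ a _))

    ·-⊙ : ∀ {l m n} a (A : Mat l m) (B : Mat m n) → A · (a ⊙ B) ≋ a ⊙ (A · B)
    ·-⊙ a A B i j = trans (∑-cong λ k → x∙yz≈y∙xz _ _ _) (sym (*-∑ a _))

    ⊙-cong : ∀ {m n} {a b} {A B : Mat m n} → a ≈ b → A ≋ B → a ⊙ A ≋ b ⊙ B
    ⊙-cong p q i j = *-cong p (q i j)

    eval : ∀ {n} → Mat n n → List Carrier → Mat n n
    eval Z [] = O
    eval Z (a ∷ as) = a ⊙ I ⊞ Z · eval Z as

    value₁ : List Carrier → Carrier
    value₁ = foldr _+_ 0#

    infixl 6 _⊕_
    _⊕_ : List Carrier → List Carrier → List Carrier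
    [] ⊕ bs = bs
    as@(_ ∷ _) ⊕ [] = as
    (a ∷ as) ⊕ (b ∷ bs) = (a + b) ∷ (as ⊕ bs)

    -- f = f(1) + (t − 1) · quotient₁ f
    quotient₁ : List Carrier → List Carrier
    quotient₁ [] = []
    quotient₁ (a ∷ as) = value₁ as ∷ quotient₁ as

    module _ {n} (Z : Mat n n) where
      open Ring (matRing n) using () renaming
        (+-cong to ⊞-cong; +-congˡ to ⊞-congˡ; +-congʳ to ⊞-congʳ; *-congˡ to ·-congˡ; *-congʳ to ·-congʳ;
         +-identityˡ to ⊞-identityˡ; +-identityʳ to ⊞-identityʳ; +-assoc to ⊞-assoc; +-commutativeSemigroup to ⊞-csg; setoid to matSetoid)
      open import Relation.Binary.Reasoning.Setoid matSetoid
      open import Algebra.Properties.CommutativeSemigroup ⊞-csg using (interchange)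

      eval-⊕ : ∀ as bs → eval Z (as ⊕ bs) ≋ eval Z as ⊞ eval Z bs
      eval-⊕ [] bs = ≋-sym (⊞-identityˡ _)
      eval-⊕ (a ∷ as) [] = ≋-sym (⊞-identityʳ _)
      eval-⊕ (a ∷ as) (b ∷ bs) = begin
        (a + b) ⊙ I ⊞ Z · eval Z (as ⊕ bs) ≈⟨ ⊞-cong (λ i j → distribʳ _ _ _) (≋-trans (·-congˡ (eval-⊕ as bs)) (·-distribˡ _ _ _)) ⟩
        (a ⊙ I ⊞ b ⊙ I) ⊞ (Z · eval Z as ⊞ Z · eval Z bs) ≈⟨ interchange _ _ _ _ ⟩
        (a ⊙ I ⊞ Z · eval Z as) ⊞ (b ⊙ I ⊞ Z · eval Z bs) ∎

      eval-map : ∀ c as → eval Z (map (c *_) as) ≋ c ⊙ eval Z as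
      eval-map c [] i j = sym (zeroʳ c)
      eval-map c (a ∷ as) = begin
        (c * a) ⊙ I ⊞ Z · eval Z (map (c *_) as) ≈⟨ ⊞-cong (λ i j → *-assoc _ _ _) (≋-trans (·-congˡ (eval-map c as)) (·-⊙ c Z _)) ⟩
        c ⊙ (a ⊙ I) ⊞ c ⊙ (Z · eval Z as) ≈⟨ (λ i j → sym (distribˡ c _ _)) ⟩
        c ⊙ (a ⊙ I ⊞ Z · eval Z as) ∎

      -- One statement for several uses: with `S` a power of `Z` it gives commutation, and with `S`
      -- a base change it transports polynomials to the new basis.
      eval-intertwine : ∀ {m} (T : Mat m m) (S : Mat m n) → S · Z ≋ T · S → ∀ as → S · eval Z as ≋ eval T as · S
      eval-intertwine T S h [] i j = trans (∑-zeros λ k → zeroʳ _) (sym (∑-zeros λ k → zeroˡ _))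
      eval-intertwine T S h (a ∷ as) = ≋-trans (·-distribˡ S _ _) (≋-trans
        (λ i j → +-cong (trans (·-⊙ a S I i j) (trans (*-congˡ (trans (·-identityʳ S i j) (sym (·-identityˡ S i j)))) (sym (⊙-· a I S i j))))
          (trans (sym (·-assoc S Z (eval Z as) i j)) (trans (·-cong {B = eval Z as} {eval Z as} h ≋-refl i j) (trans (·-assoc T S (eval Z as) i j)
            (trans (·-cong {A = T} ≋-refl (eval-intertwine T S h as) i j) (sym (·-assoc T (eval T as) S i j)))))))
        (≋-sym (·-distribʳ S _ _)))

      eval-comm : ∀ as → Z · eval Z as ≋ eval Z as · Z
      eval-comm = eval-intertwine Z Z ≋-refl

      ∸I : Mat n n
      ∸I = Z ⊞ (- 1#) ⊙ I

      eval-quotient₁ : ∀ as → eval Z as ≋ value₁ as ⊙ I ⊞ ∸I · eval Z (quotient₁ as)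
      eval-quotient₁ [] i j = sym (trans (+-cong (zeroˡ _) (∑-zeros λ k → zeroʳ _)) (+-identityʳ _))
      eval-quotient₁ (a ∷ as) = ≋-sym (begin
        (a + v) ⊙ I ⊞ ∸I · (v ⊙ I ⊞ Z · Q) ≈⟨ ⊞-cong (λ i j → distribʳ _ _ _) (·-distribˡ ∸I _ _) ⟩
        (a ⊙ I ⊞ v ⊙ I) ⊞ (∸I · (v ⊙ I) ⊞ ∸I · (Z · Q)) ≈⟨ interchange _ _ _ _ ⟩
        (a ⊙ I ⊞ ∸I · (v ⊙ I)) ⊞ (v ⊙ I ⊞ ∸I · (Z · Q)) ≈⟨ ⊞-cong (⊞-congˡ {a ⊙ I} (≋-trans (·-⊙ v ∸I I) (⊙-cong refl (·-identityʳ ∸I)))) (⊞-congˡ {v ⊙ I} ∸I-Z) ⟩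
        (a ⊙ I ⊞ v ⊙ ∸I) ⊞ (v ⊙ I ⊞ Z · (∸I · Q)) ≈⟨ ⊞-assoc _ _ _ ⟩
        a ⊙ I ⊞ (v ⊙ ∸I ⊞ (v ⊙ I ⊞ Z · (∸I · Q))) ≈⟨ ⊞-congˡ {a ⊙ I} (≋-trans (≋-sym (⊞-assoc _ _ _)) (⊞-congʳ v-Z)) ⟩
        a ⊙ I ⊞ (Z · (v ⊙ I) ⊞ Z · (∸I · Q)) ≈⟨ ⊞-congˡ {a ⊙ I} (≋-sym (·-distribˡ Z _ _)) ⟩
        a ⊙ I ⊞ Z · (v ⊙ I ⊞ ∸I · Q) ≈⟨ ⊞-congˡ {a ⊙ I} (·-congˡ (≋-sym (eval-quotient₁ as))) ⟩
        a ⊙ I ⊞ Z · eval Z as ∎)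
        where
        v = value₁ as
        Q = eval Z (quotient₁ as)
        ∸I-Z : ∸I · (Z · Q) ≋ Z · (∸I · Q)
        ∸I-Z = ≋-trans (≋-sym (·-assoc ∸I Z Q)) (≋-trans (·-congʳ (≋-trans (·-distribʳ Z _ _) (≋-trans
                 (⊞-congˡ {Z · Z} (λ i j → trans (⊙-· (- 1#) I Z i j) (trans (*-congˡ (trans (·-identityˡ Z i j) (sym (·-identityʳ Z i j)))) (sym (·-⊙ (- 1#) Z I i j)))))
                 (≋-sym (·-distribˡ Z _ _))))) (·-assoc Z ∸I Q))
        v-Z : v ⊙ ∸I ⊞ v ⊙ I ≋ Z · (v ⊙ I)
        v-Z i j = trans (sym (distribˡ v _ _)) (trans (*-congˡ (trans (+-assoc _ _ _) (trans (+-congˡ (trans (+-congʳ (trans (sym (-‿distribˡ-* _ _)) (-‿cong (*-identityˡ _)))) (-‿inverseˡ _))) (+-identityʳ _))))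
                   (sym (trans (·-⊙ v Z I i j) (*-congˡ (·-identityʳ Z i j)))))

    I-↑ˡ : ∀ {k n} (i j : Fin k) → I (i ↑ˡ n) (j ↑ˡ n) ≈ I i j
    I-↑ˡ zero zero = refl
    I-↑ˡ zero (suc j) = refl
    I-↑ˡ (suc i) zero = refl
    I-↑ˡ (suc i) (suc j) = I-↑ˡ i j

    I-↑ʳ : ∀ k {n} (i j : Fin n) → I (k ↑ʳ i) (k ↑ʳ j) ≈ I i j
    I-↑ʳ zero i j = refl
    I-↑ʳ (suc k) i j = I-↑ʳ k i j

    -- The lower left block `E` is left unspecified, because the determinant of the result sees the
    -- diagonal blocks only.
    eval-blk : ∀ {k n} (A : Mat k k) (C : Mat n k) (D : Mat n n) as →
               ∃ λ E → eval (blk A O C D) as ≋ blk (eval A as) O E (eval D as)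
    eval-blk {k} {n} A C D [] = O , ≋-blk {k} {n} {k} {n} O O O O (λ _ _ → refl) (λ _ _ → refl) (λ _ _ → refl) (λ _ _ → refl)
    eval-blk {k} {n} A C D (a ∷ as) with eval-blk A C D as
    ... | E , h = P₃ , ≋-blk _ _ _ _
            (λ i j → +-cong (*-congˡ (I-↑ˡ i j)) (trans (step _ _) (trans (reflexive (blk-A P₁ P₂ P₃ P₄ i j)) (trans (+-congˡ (∑-zeros λ l → zeroˡ _)) (+-identityʳ _)))))
            (λ i j → trans (+-cong (trans (*-congˡ (I-off (i ↑ˡ n) (k ↑ʳ j) (↑ˡ≢↑ʳ k))) (zeroʳ a)) (trans (step _ _) (trans (reflexive (blk-B P₁ P₂ P₃ P₄ i j)) (trans (+-cong (∑-zeros λ l → zeroʳ _) (∑-zeros λ l → zeroˡ _)) (+-identityʳ _))))) (+-identityʳ _))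
            (λ i j → trans (+-cong (trans (*-congˡ (I-off (k ↑ʳ i) (j ↑ˡ n) (λ p → ↑ˡ≢↑ʳ k (≡.sym p)))) (zeroʳ a)) (trans (step _ _) (reflexive (blk-C P₁ P₂ P₃ P₄ i j)))) (+-identityˡ _))
            (λ i j → +-cong (*-congˡ (I-↑ʳ k i j)) (trans (step _ _) (trans (reflexive (blk-D P₁ P₂ P₃ P₄ i j)) (trans (+-congʳ (∑-zeros λ l → zeroʳ _)) (+-identityˡ _)))))
      where
      P₁ = A · eval A as ⊞ O · E
      P₂ = A · O ⊞ O · eval D as
      P₃ = C · eval A as ⊞ D · E
      P₄ = C · O ⊞ D · eval D as
      step : blk A O C D · eval (blk A O C D) as ≋ blk P₁ P₂ P₃ P₄
      step = ≋-trans (·-cong {A = blk A O C D} {blk A O C D} ≋-refl h) (blk-· A O C D (eval A as) O E (eval D as))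

-- Ring homomorphisms and the Frobenius map in characteristic p.

module FrobeniusMap where
  open Determinants
  open Polynomials
  open import Algebra.Bundles using (CommutativeRing; Semiring)
  open import Level using (0ℓ)
  open import Data.Nat.Base as ℕ using (ℕ; zero; suc; _<_; _∸_; _!; s≤s; z≤n)
  import Data.Nat.Properties as ℕ
  import Data.Nat.Divisibility as ℕ
  open import Data.Nat.DivMod using (m/n*n≡m)
  open import Data.Nat.Combinatorics using (_C_; nCn≡1; nCk≡n!/k![n-k]!; k![n∸k]!∣n!)
  open import Data.Nat.Primality using (Prime; euclidsLemma; ¬prime[0]; prime⇒nonTrivial)
  open import Data.Fin.Base as Fin using (Fin; zero; suc; toℕ)
  import Data.Fin.Properties as Fin
  open import Data.List.Base as List using (List; []; _∷_)
  open import Data.Sum using (inj₁; inj₂)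
  open import Relation.Nullary using (¬_; contradiction)
  open import Relation.Binary.PropositionalEquality as ≡ using (_≡_; refl; sym; trans; cong; cong₂; subst)

  module Homomorphism (R S : CommutativeRing 0ℓ 0ℓ) where
    private
      module R = CommutativeRing R
      module S = CommutativeRing S
      module RL = LinAlg R
      module SL = LinAlg S
      module RB = BlockMatrices R
      module SB = BlockMatrices S
      module RP = MatrixPolynomials R
      module SP = MatrixPolynomials S

    record IsHom (φ : R.Carrier → S.Carrier) : Set where
      field
        +-homo : ∀ a b → φ (a R.+ b) S.≈ φ a S.+ φ b
        *-homo : ∀ a b → φ (a R.* b) S.≈ φ a S.* φ b
        -‿homo : ∀ a → φ (R.- a) S.≈ S.- φ a
        0-homo : φ R.0# S.≈ S.0#
        1-homo : φ R.1# S.≈ S.1#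
        φ-cong : ∀ {a b} → a R.≈ b → φ a S.≈ φ b

      ∑-homo : ∀ {n} (t : RL.Row n) → φ (RL.∑ t) S.≈ SL.∑ (λ i → φ (t i))
      ∑-homo {zero} t = S.trans (φ-cong RL.∑-zero) (S.trans 0-homo (S.sym SL.∑-zero))
      ∑-homo {suc n} t = S.trans (φ-cong (RL.∑-suc t)) (S.trans (+-homo _ _) (S.trans (S.+-congˡ (∑-homo _)) (S.sym (SL.∑-suc _))))

      sgn-homo : ∀ k → φ (RL.sgn k) S.≈ SL.sgn k
      sgn-homo zero = 1-homo
      sgn-homo (suc k) = S.trans (-‿homo _) (S.-‿cong (sgn-homo k))

      det-homo : ∀ {n} (M : RL.Mat n n) → φ (RL.det M) S.≈ SL.det (λ i j → φ (M i j))
      det-homo {zero} M = 1-homo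
      det-homo {suc n} M = S.trans (∑-homo _) (SL.∑-cong λ j → S.trans (*-homo _ _) (S.*-cong (S.trans (*-homo _ _) (S.*-congʳ (sgn-homo (toℕ j)))) (det-homo (RL.minor M j))))

      I-homo : ∀ {n} (i j : Fin n) → φ (RB.I i j) S.≈ SB.I i j
      I-homo zero zero = 1-homo
      I-homo zero (suc j) = 0-homo
      I-homo (suc i) zero = 0-homo
      I-homo (suc i) (suc j) = I-homo i j

      ·-homo : ∀ {l m n} (A : RL.Mat l m) (B : RL.Mat m n) i j → φ ((A RL.· B) i j) S.≈ ((λ i k → φ (A i k)) SL.· (λ k j → φ (B k j))) i j
      ·-homo A B i j = S.trans (∑-homo _) (SL.∑-cong λ k → *-homo _ _)

      eval-homo : ∀ {n} (Z : RL.Mat n n) as i j → φ (RP.eval Z as i j) S.≈ SP.eval (λ i j → φ (Z i j)) (List.map φ as) i j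
      eval-homo Z [] i j = 0-homo
      eval-homo Z (a ∷ as) i j = S.trans (+-homo _ _) (S.+-cong (S.trans (*-homo _ _) (S.*-congˡ (I-homo i j)))
        (S.trans (·-homo Z (RP.eval Z as) i j) (SL.∑-cong λ k → S.*-congˡ (eval-homo Z as k j))))

  prime∤! : ∀ {p} → Prime p → ∀ k → k < p → ¬ (p ℕ.∣ k !)
  prime∤! {p} pr zero k<p d = ℕ.<⇒≱ (ℕ.nonTrivial⇒n>1 p {{prime⇒nonTrivial pr}}) (ℕ.∣⇒≤ d)
  prime∤! pr (suc k) k<p d with euclidsLemma (suc k) (k !) pr d
  ... | inj₁ e = ℕ.<⇒≱ k<p (ℕ.∣⇒≤ e)
  ... | inj₂ e = prime∤! pr k (ℕ.<⇒≤ k<p) e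

  prime∣C : ∀ {p} → Prime p → ∀ k → 0 < k → k < p → p ℕ.∣ p C k
  prime∣C {p} pr k 0<k k<p with euclidsLemma (p C k) (k ! ℕ.* (p ∸ k) !) pr (subst (p ℕ.∣_) (sym factorials) (p∣p! pr))
    where
    factorials : (p C k) ℕ.* (k ! ℕ.* (p ∸ k) !) ≡ p !
    factorials = trans (cong (ℕ._* (k ! ℕ.* (p ∸ k) !)) (nCk≡n!/k![n-k]! (ℕ.<⇒≤ k<p))) (m/n*n≡m {{k ℕ.!* (p ∸ k) !≢0}} (k![n∸k]!∣n! (ℕ.<⇒≤ k<p)))
    p∣p! : ∀ {p} → Prime p → p ℕ.∣ p !
    p∣p! {suc p} pr = ℕ.m∣m*n (p !)
  ... | inj₁ d = d
  ... | inj₂ d with euclidsLemma (k !) ((p ∸ k) !) pr d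
  ...   | inj₁ e = contradiction e (prime∤! pr k k<p)
  ...   | inj₂ e = contradiction e (prime∤! pr (p ∸ k) (ℕ.∸-monoʳ-< 0<k (ℕ.<⇒≤ k<p)))

  module Frobenius (S : Semiring 0ℓ 0ℓ) {p : ℕ} (pr : Prime p) where
    open Semiring S hiding (zero) renaming (refl to ≈-refl; sym to ≈-sym; trans to ≈-trans)
    open import Algebra.Properties.Semiring.Mult S using (_×_; ×-assocˡ; ×-congˡ; ×-homo-1)
    open import Algebra.Properties.Semiring.Exp S public using (_^_; ^-assocʳ; ^-congˡ)
    open import Algebra.Properties.Semiring.Sum S using (sum; sum-cong-≋; sum-init-last; sum-replicate-zero)
    open import Relation.Binary.Reasoning.Setoid setoid

    module _ (char : ∀ x → p × x ≈ 0#) where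
      multiple-zero : ∀ {k} → p ℕ.∣ k → ∀ x → k × x ≈ 0#
      multiple-zero (ℕ.divides q refl) x = ≈-trans (×-congˡ (ℕ.*-comm q p)) (≈-trans (≈-sym (×-assocˡ x p q)) (char _))

      -- Stated for commuting elements of a semiring because it is applied to matrices modulo p,
      -- where `x` is a scalar matrix. All binomial coefficients except the outer two are multiples
      -- of p.
      frobenius : ∀ x y → x * y ≈ y * x → (x + y) ^ p ≈ x ^ p + y ^ p
      frobenius x y xy = go p pr multiple-zero
        where
        open import Algebra.Properties.Semiring.Binomial S x y using (theorem; binomialTerm)
        -- Matching on the exponent as a successor exposes the first and the last binomial term; the
        -- vanishing of its multiples is passed along in terms of the same variable.
        go : ∀ m → Prime m → (∀ {k} → m ℕ.∣ k → ∀ x → k × x ≈ 0#) → (x + y) ^ m ≈ x ^ m + y ^ m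
        go zero pr _ = contradiction pr ¬prime[0]
        go (suc p-1) pr multiple-zero = begin
          (x + y) ^ suc p-1 ≈⟨ theorem xy (suc p-1) ⟩
          t zero + sum (λ k → t (suc k)) ≈⟨ +-congˡ (sum-init-last (λ k → t (suc k))) ⟩
          t zero + (sum (λ k → t (suc (Fin.inject₁ k))) + t (suc (Fin.fromℕ p-1))) ≈⟨ +-cong first (+-cong middle last) ⟩
          y ^ suc p-1 + (0# + x ^ suc p-1) ≈⟨ ≈-trans (+-congˡ (+-identityˡ _)) (+-comm _ _) ⟩
          x ^ suc p-1 + y ^ suc p-1 ∎
          where
          t = binomialTerm (suc p-1)
          first : t zero ≈ y ^ suc p-1
          first = ≈-trans (×-homo-1 _) (*-identityˡ _)
          last : t (suc (Fin.fromℕ p-1)) ≈ x ^ suc p-1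
          last = begin
            (suc p-1 C suc (toℕ (Fin.fromℕ p-1))) × (x ^ suc (toℕ (Fin.fromℕ p-1)) * y ^ (p-1 ∸ toℕ (Fin.fromℕ p-1)))
              ≡⟨ cong (λ k → (suc p-1 C suc k) × (x ^ suc k * y ^ (p-1 ∸ k))) (Fin.toℕ-fromℕ p-1) ⟩
            (suc p-1 C suc p-1) × (x ^ suc p-1 * y ^ (p-1 ∸ p-1)) ≡⟨ ≡.cong₂ (λ c k → c × (x ^ suc p-1 * y ^ k)) (nCn≡1 (suc p-1)) (ℕ.n∸n≡0 p-1) ⟩
            1 × (x ^ suc p-1 * 1#) ≈⟨ ≈-trans (×-homo-1 _) (*-identityʳ _) ⟩
            x ^ suc p-1 ∎
          middle : sum (λ k → t (suc (Fin.inject₁ k))) ≈ 0#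
          middle = ≈-trans (sum-cong-≋ λ k → multiple-zero (prime∣C pr (suc (toℕ (Fin.inject₁ k))) (s≤s z≤n) (s≤s (Fin.inject₁ℕ< k))) _) (sum-replicate-zero p-1)

    ^-comm : ∀ x y → x * y ≈ y * x → ∀ n → x * y ^ n ≈ y ^ n * x
    ^-comm x y h zero = ≈-trans (*-identityʳ x) (≈-sym (*-identityˡ x))
    ^-comm x y h (suc n) = begin
      x * (y * y ^ n) ≈⟨ ≈-trans (≈-sym (*-assoc x y _)) (≈-trans (*-congʳ h) (*-assoc y x _)) ⟩
      y * (x * y ^ n) ≈⟨ ≈-trans (*-congˡ (^-comm x y h n)) (≈-sym (*-assoc y _ x)) ⟩
      y * y ^ n * x ∎

    ^-distrib : ∀ x y → x * y ≈ y * x → ∀ n → (x * y) ^ n ≈ x ^ n * y ^ n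
    ^-distrib x y h zero = ≈-sym (*-identityˡ 1#)
    ^-distrib x y h (suc n) = begin
      x * y * (x * y) ^ n ≈⟨ *-congˡ (^-distrib x y h n) ⟩
      x * y * (x ^ n * y ^ n) ≈⟨ ≈-trans (*-assoc x y _) (*-congˡ (≈-sym (*-assoc y _ _))) ⟩
      x * (y * x ^ n * y ^ n) ≈⟨ *-congˡ (*-congʳ (^-comm y x (≈-sym h) n)) ⟩
      x * (x ^ n * y * y ^ n) ≈⟨ ≈-trans (*-congˡ (*-assoc _ y _)) (≈-sym (*-assoc x _ _)) ⟩
      x * x ^ n * (y * y ^ n) ∎

-- Orbits of a map of prime power order.

module Orbits where
  open import Data.Nat.Base using (ℕ; zero; suc; _+_; _*_; _^_; _∸_; _<_; s≤s; z≤n; NonZero; >-nonZero; ≢-nonZero⁻¹)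
  open import Data.Nat.Properties hiding (_≟_)
  open import Data.Nat.Divisibility
  open import Data.Nat.GCD using (gcd; gcd-GCD; gcd[m,n]∣m; gcd[m,n]∣n; module Bézout)
  open import Data.Nat.Primality using (Prime; euclidsLemma; prime⇒nonZero)
  open import Data.Nat.Induction using (<-wellFounded)
  open import Induction.WellFounded using (Acc; acc)
  open import Data.Fin.Base using (Fin)
  open import Data.List.Base using (List; []; _∷_; _++_; length; filter; applyUpTo; allFin)
  open import Data.List.Properties using (length-++; length-applyUpTo; length-tabulate)
  open import Data.List.Membership.Propositional using (_∈_; _∉_)
  open import Data.List.Membership.Propositional.Properties using (∈-filter⁺; ∈-filter⁻; ∈-applyUpTo⁺; ∈-applyUpTo⁻; ∈-++⁺ˡ; ∈-++⁺ʳ; ∈-++⁻; ∈-allFin)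
  open import Data.List.Membership.Propositional.Properties.WithK using (unique∧set⇒bag)
  open import Data.List.Relation.Binary.BagAndSetEquality using (∼bag⇒↭)
  open import Data.List.Relation.Binary.Permutation.Propositional.Properties using (↭-length)
  open import Data.List.Relation.Unary.Any using (here; there)
  open import Data.List.Relation.Unary.AllPairs using ([]; _∷_)
  open import Data.List.Relation.Unary.Unique.Propositional using (Unique)
  open import Data.List.Relation.Unary.Unique.Propositional.Properties using (++⁺; filter⁺; applyUpTo⁺₁; allFin⁺)
  import Data.List.Membership.DecPropositional as DecMembership
  open import Data.Product using (_,_; _×_; proj₁; proj₂)
  open import Data.Sum using (inj₁; inj₂; [_,_]′)
  open import Function.Base using (_∘_)
  open import Function.Bundles using (mk⇔)
  open import Relation.Nullary using (¬?; contradiction; yes; no)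
  open import Relation.Binary.Definitions using (DecidableEquality)
  open import Relation.Binary.PropositionalEquality

  -- Euclid's lemma for p · p^k = c · d: a factor p of c cancels, and a factor p of d leaves a
  -- proper divisor of p^k for the induction.
  ∣p^⇒∣p^ : ∀ {p} → Prime p → ∀ k {d} → d ∣ p ^ suc k → d ≢ p ^ suc k → d ∣ p ^ k
  ∣p^⇒∣p^ {p} pr k {d} (divides c eq) d≢ with euclidsLemma c d pr (divides (p ^ k) (trans (sym eq) (*-comm p (p ^ k))))
  ... | inj₁ (divides c′ refl) = divides c′ (*-cancelʳ-≡ (p ^ k) (c′ * d) p {{prime⇒nonZero pr}}
          (trans (*-comm (p ^ k) p) (trans eq (trans (*-assoc c′ p d) (trans (cong (c′ *_) (*-comm p d)) (sym (*-assoc c′ d p)))))))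
  ... | inj₂ (divides d′ refl) = below k refl
    where
    p^k≡ : p ^ k ≡ c * d′
    p^k≡ = *-cancelʳ-≡ (p ^ k) (c * d′) p {{prime⇒nonZero pr}} (trans (*-comm (p ^ k) p) (trans eq (sym (*-assoc c d′ p))))
    d′≢ : d′ ≢ p ^ k
    d′≢ e = d≢ (trans (cong (_* p) e) (*-comm (p ^ k) p))
    below : ∀ j → k ≡ j → d′ * p ∣ p ^ k
    below zero refl = contradiction (m*n≡1⇒n≡1 c d′ (sym p^k≡)) d′≢
    below (suc j) refl = subst (d′ * p ∣_) (*-comm (p ^ j) p) (*-monoˡ-∣ p (∣p^⇒∣p^ pr j (divides c p^k≡) d′≢))

  module _ {A : Set} (σ : A → A) where
    iter : ℕ → A → A
    iter zero x = x
    iter (suc n) x = σ (iter n x)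

    iter-+ : ∀ m n x → iter (m + n) x ≡ iter m (iter n x)
    iter-+ zero n x = refl
    iter-+ (suc m) n x = cong σ (iter-+ m n x)

    iter-* : ∀ k {n x} → iter n x ≡ x → iter (k * n) x ≡ x
    iter-* zero h = refl
    iter-* (suc k) {n} {x} h = trans (iter-+ n (k * n) x) (trans (cong (iter n) (iter-* k h)) h)

    iter-∸ : ∀ m {n x} → iter n x ≡ x → iter (m + n) x ≡ x → iter m x ≡ x
    iter-∸ m {n} {x} h h′ = trans (cong (iter m) (sym h)) (trans (sym (iter-+ m n x)) h′)

    -- Bézout in natural numbers: the gcd plus a multiple of one period equals a multiple of the
    -- other, and both multiples fix `x`.
    iter-gcd : ∀ m n {x} → iter m x ≡ x → iter n x ≡ x → iter (gcd m n) x ≡ x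
    iter-gcd m n {x} hm hn with Bézout.identity (gcd-GCD m n)
    ... | Bézout.+- a b eq = iter-∸ (gcd m n) (iter-* b hn) (trans (cong (λ k → iter k x) eq) (iter-* a hm))
    ... | Bézout.-+ a b eq = iter-∸ (gcd m n) (iter-* a hm) (trans (cong (λ k → iter k x) eq) (iter-* b hn))

    -- The gcd of a shorter period `i` with p^(k+1) is a proper divisor of p^(k+1), hence divides
    -- p^k. So testing whether an orbit is short only requires the single period p^k.
    iter-prime-power : ∀ {p} → Prime p → ∀ k {i x} → 0 < i → i < p ^ suc k → iter (p ^ suc k) x ≡ x → iter i x ≡ x → iter (p ^ k) x ≡ x
    iter-prime-power {p} pr k {i} {x} 0<i i<m hm hi with ∣p^⇒∣p^ pr k (gcd[m,n]∣n i (p ^ suc k)) (<⇒≢ (≤-<-trans (∣⇒≤ {{>-nonZero 0<i}} (gcd[m,n]∣m i (p ^ suc k))) i<m))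
    ... | divides c eq = trans (cong (λ k → iter k x) eq) (iter-* c (iter-gcd i (p ^ suc k) hi hm))

    module _ (_≟_ : DecidableEquality A) (m : ℕ) .{{_ : NonZero m}} where
      open DecMembership _≟_ using (_∈?_)

      -- The orbit of the first element consists of `m` distinct members of the list; filtering it
      -- out leaves a shorter list with the same properties.
      free-orbits : ∀ (xs : List A) → Acc _<_ (length xs) → Unique xs → (∀ {x} → x ∈ xs → σ x ∈ xs) →
                    (∀ {x} → x ∈ xs → iter m x ≡ x) → (∀ {x i} → x ∈ xs → 0 < i → i < m → iter i x ≢ x) → m ∣ length xs
      free-orbits [] _ u closed periodic free = m ∣0
      free-orbits xs@(y ∷ _) (acc rs) u closed periodic free =
        subst (m ∣_) (sym size) (∣m∣n⇒∣m+n ∣-refl (free-orbits rest (rs smaller) (filter⁺ (λ x → ¬? (x ∈? orbit)) u) rest-closed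
          (periodic ∘ proj₁ ∘ in-rest) (free ∘ proj₁ ∘ in-rest)))
        where
        orbit rest : List A
        orbit = applyUpTo (λ i → iter i y) m
        rest = filter (λ x → ¬? (x ∈? orbit)) xs

        in-rest : ∀ {x} → x ∈ rest → x ∈ xs × x ∉ orbit
        in-rest = ∈-filter⁻ (λ x → ¬? (x ∈? orbit)) {xs = xs}

        iter-closed : ∀ {x} i → x ∈ xs → iter i x ∈ xs
        iter-closed zero h = h
        iter-closed (suc i) h = closed (iter-closed i h)

        orbit-unique : Unique orbit
        orbit-unique = applyUpTo⁺₁ (λ i → iter i y) m λ {i} {j} i<j j<m e →
          free (here refl) (≤-trans (m<n⇒0<n∸m j<m) (m≤m+n (m ∸ j) i)) (<-≤-trans (+-monoʳ-< (m ∸ j) i<j) (≤-reflexive (m∸n+n≡m (<⇒≤ j<m))))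
            (trans (iter-+ (m ∸ j) i y) (trans (cong (iter (m ∸ j)) e) (trans (sym (iter-+ (m ∸ j) j y))
              (trans (cong (λ k → iter k y) (m∸n+n≡m (<⇒≤ j<m))) (periodic (here refl))))))

        -- On `xs` the iterate of order m - 1 inverts `σ`. Hence an element outside the orbit is
        -- never mapped into it, and the remaining list stays closed.
        orbit-closed⁻ : ∀ {x} → x ∈ xs → σ x ∈ orbit → x ∈ orbit
        orbit-closed⁻ {x} x∈ h with ∈-applyUpTo⁻ (λ i → iter i y) {n = m} h
        ... | zero , i<m , e = subst (_∈ orbit) (trans (cong (iter (m ∸ 1)) (sym e)) (trans (sym (iter-+ (m ∸ 1) 1 x)) (trans (cong (λ k → iter k x) (m∸n+n≡m i<m)) (periodic x∈))))
              (∈-applyUpTo⁺ (λ i → iter i y) (∸-monoʳ-< {o = 0} (s≤s z≤n) i<m))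
        ... | suc i , i<m , e = subst (_∈ orbit) (trans (cycle y (periodic (here refl)) i) (trans (cong (iter (m ∸ 1)) (sym e)) (trans (sym (iter-+ (m ∸ 1) 1 x)) (trans (cong (λ k → iter k x) (m∸n+n≡m (≤-trans (s≤s z≤n) i<m))) (periodic x∈)))))
              (∈-applyUpTo⁺ (λ i → iter i y) (<-trans (n<1+n i) i<m))
          where
          cycle : ∀ y → iter m y ≡ y → ∀ i → iter i y ≡ iter (m ∸ 1) (iter (suc i) y)
          cycle y h i = trans (cong (iter i) (sym h)) (trans (sym (iter-+ i m y)) (trans (cong (λ k → iter k y) (trans (+-comm i m) (trans (cong (_+ i) (sym (m∸n+n≡m (≤-trans (s≤s z≤n) i<m)))) (+-assoc (m ∸ 1) 1 i)))) (iter-+ (m ∸ 1) (suc i) y)))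

        rest-closed : ∀ {x} → x ∈ rest → σ x ∈ rest
        rest-closed h = let x∈ , x∉ = in-rest h in ∈-filter⁺ (λ x → ¬? (x ∈? orbit)) (closed x∈) (x∉ ∘ orbit-closed⁻ x∈)

        size : length xs ≡ m + length rest
        size = trans (↭-length (∼bag⇒↭ (unique∧set⇒bag u (++⁺ orbit-unique (filter⁺ (λ x → ¬? (x ∈? orbit)) u) λ (a , b) → proj₂ (in-rest b) a) (mk⇔ to from))))
          (trans (length-++ orbit) (cong (_+ length rest) (length-applyUpTo (λ i → iter i y) m)))
          where
          to : ∀ {x} → x ∈ xs → x ∈ orbit ++ rest
          to {x} h with x ∈? orbit
          ... | yes p = ∈-++⁺ˡ p
          ... | no ¬p = ∈-++⁺ʳ orbit (∈-filter⁺ (λ x → ¬? (x ∈? orbit)) h ¬p)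
          from : ∀ {x} → x ∈ orbit ++ rest → x ∈ xs
          from h = [ (λ p → let i , _ , e = ∈-applyUpTo⁻ (λ i → iter i y) p in subst (_∈ xs) (sym e) (iter-closed i (here refl))) , proj₁ ∘ in-rest ]′ (∈-++⁻ orbit h)

        smaller : length rest < length xs
        smaller = subst (length rest <_) (sym size) (m<n+m (length rest) (n≢0⇒n>0 (≢-nonZero⁻¹ m)))

  module _ {N : ℕ} (σ : Fin N → Fin N) {p : ℕ} (pr : Prime p) (k : ℕ) (x₀ : Fin N) where
    open import Data.Fin.Properties using (_≟_)

    -- Away from `x₀` every orbit has full length p^(k+1), since by `iter-prime-power` a shorter one
    -- would consist of fixed points of the p^k-th iterate.
    unique-fixed-point : σ x₀ ≡ x₀ → (∀ x → iter σ (p ^ suc k) x ≡ x) → (∀ x → iter σ (p ^ k) x ≡ x → x ≡ x₀) → p ^ suc k ∣ N ∸ 1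
    unique-fixed-point fix periodic fixed = subst (λ n → p ^ suc k ∣ n ∸ 1) size
      (free-orbits σ _≟_ (p ^ suc k) {{m^n≢0 p (suc k) {{prime⇒nonZero pr}}}} others (<-wellFounded _) (filter⁺ (λ x → ¬? (x ≟ x₀)) (allFin⁺ N)) closed (λ _ → periodic _)
        λ x∈ 0<i i<m e → in-others x∈ (fixed _ (iter-prime-power σ pr k 0<i i<m (periodic _) e)))
      where
      others : List (Fin N)
      others = filter (λ x → ¬? (x ≟ x₀)) (allFin N)
      in-others : ∀ {x} → x ∈ others → x ≢ x₀
      in-others = proj₂ ∘ ∈-filter⁻ (λ x → ¬? (x ≟ x₀)) {xs = allFin N}
      others⁺ : ∀ {x} → x ≢ x₀ → x ∈ others
      others⁺ = ∈-filter⁺ (λ x → ¬? (x ≟ x₀)) (∈-allFin _)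
      pred : ℕ
      pred = p ^ suc k ∸ 1
      closed : ∀ {x} → x ∈ others → σ x ∈ others
      closed {x} x∈ = others⁺ λ e → in-others x∈ (trans (sym (periodic x)) (trans (back x) (trans (cong (iter σ pred) e) (iter-fixed pred))))
        where
        iter-fixed : ∀ i → iter σ i x₀ ≡ x₀
        iter-fixed zero = refl
        iter-fixed (suc i) = trans (cong σ (iter-fixed i)) fix
        back : ∀ x → iter σ (p ^ suc k) x ≡ iter σ pred (σ x)
        back x = trans (cong (λ n → iter σ n x) (sym (m∸n+n≡m (m^n>0 p {{prime⇒nonZero pr}} (suc k))))) (iter-+ σ pred 1 x)
      size : suc (length others) ≡ N
      size = trans (↭-length (∼bag⇒↭ (unique∧set⇒bag (fresh ∷ filter⁺ (λ x → ¬? (x ≟ x₀)) (allFin⁺ N)) (allFin⁺ N) (mk⇔ (λ _ → ∈-allFin _) from)))) (length-tabulate _)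
        where
        open import Data.List.Relation.Unary.All using (All; tabulate)
        fresh : All (x₀ ≢_) others
        fresh = tabulate λ x∈ e → in-others x∈ (sym e)
        from : ∀ {x} → x ∈ allFin N → x ∈ x₀ ∷ others
        from {x} _ with x ≟ x₀
        ... | yes e = here e
        ... | no ¬e = there (others⁺ ¬e)

import Defs as D
open D using (band; cycCoeff; coeffN; sylvester; resultant; altSign; sumℤ; evalAt1; resSeq; ℤp; approx; IsZeroℤp; ConvergesTo; IsNonPPart; IsLPart)
open import Algebra.Bundles using (CommutativeRing; Ring)
open import Level using (0ℓ)
open import Data.Bool.Base using (true; false; if_then_else_)
open import Data.Nat.Base as ℕ using (ℕ; zero; suc; s≤s; z≤n; NonZero; _∸_; _≤_; _<_; _≡ᵇ_; _^_)
import Data.Nat.Properties as ℕ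
import Data.Nat.Divisibility as ℕ
open import Data.Nat.Coprimality using (Coprime; coprime-divisor) renaming (sym to coprime-sym)
open import Data.Nat.Induction using (<-wellFounded)
open import Data.Nat.Primality using (Prime; euclidsLemma; ¬prime[0]; prime⇒nonZero; prime⇒nonTrivial; prime⇒irreducible)
open import Data.Integer.Base as ℤ using (ℤ; +_; -[1+_]; _+_; _*_; -_; _-_; 0ℤ; 1ℤ; -1ℤ; ∣_∣)
import Data.Integer.Properties as ℤ
open import Data.Integer.Tactic.RingSolver using (solve-∀)
open import Data.Fin.Base as Fin using (Fin; zero; suc; toℕ; fromℕ; fromℕ<; _↑ˡ_; _↑ʳ_; opposite)
import Data.Fin.Properties as Fin
open import Data.List.Base as List using (List; []; _∷_; map; applyUpTo; tabulate)
open import Data.Product using (Σ; _,_; _×_; ∃; ∃₂; proj₁; proj₂)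
open import Data.Sum using (_⊎_; inj₁; inj₂; [_,_]′)
open import Function.Base using (_∘_; id)
open import Function.Bundles using (_⇔_; mk⇔)
open import Induction.WellFounded using (Acc; acc)
open import Relation.Nullary using (Dec; yes; no; ¬_; ¬?; contradiction; does)
open import Relation.Nullary.Decidable using (dec-true; dec-false; decidable-stable)
open import Relation.Binary.PropositionalEquality hiding (J)

open Determinants
open Polynomials

module Matricesℤ where
  open LinAlg ℤ.+-*-commutativeRing public
  open BlockMatrices ℤ.+-*-commutativeRing public
  open MatrixPolynomials ℤ.+-*-commutativeRing public

-- The resultant with t^m - 1 as a determinant of a polynomial in the cyclic shift.

module Sylvester where
  open import Data.Nat.DivMod using (_mod_; _%_; m<n⇒m%n≡m; [m+n]%n≡m%n; m%n%n≡m%n; %-distribˡ-+)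

  open Matricesℤ

  sumℤ-tabulate : ∀ {n} {A : Set} (t : A → ℤ) (g : Fin n → A) → sumℤ (map t (tabulate g)) ≡ ∑ (t ∘ g)
  sumℤ-tabulate {zero} t g = sym ∑-zero
  sumℤ-tabulate {suc n} t g = trans (cong (_+_ (t (g zero))) (sumℤ-tabulate t (g ∘ suc))) (sym (∑-suc (t ∘ g)))

  altSign≡sgn : ∀ k → altSign k ≡ sgn k
  altSign≡sgn zero = refl
  altSign≡sgn (suc k) = cong -_ (altSign≡sgn k)

  det-frozen : ∀ n (M : Mat n n) → D.det n M ≡ det M
  det-frozen zero M = refl
  det-frozen (suc n) M = trans (sumℤ-tabulate _ id) (∑-cong λ j →
    cong₂ (λ s d → s * M zero j * d) (altSign≡sgn (toℕ j)) (det-frozen n (minor M j)))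

  det-cast : ∀ {m n} (eq : m ≡ n) (s : ℕ → ℕ → ℤ) → det {m} (λ i j → s (toℕ i) (toℕ j)) ≡ det {n} (λ i j → s (toℕ i) (toℕ j))
  det-cast refl s = refl

  -- The image of the polynomial t^e · as under the linear map t^i ↦ g i.
  lin : (ℕ → ℤ) → List ℤ → ℕ → ℤ
  lin g [] e = 0ℤ
  lin g (a ∷ as) e = a * g e + lin g as (suc e)

  lin-snoc : ∀ g b n e → lin g (applyUpTo b (suc n)) e ≡ lin g (applyUpTo b n) e + b n * g (n ℕ.+ e)
  lin-snoc g b zero e = ℤ.+-comm (b 0 * g e) 0ℤ
  lin-snoc g b (suc n) e = trans (cong (_+_ (b 0 * g e)) (trans (lin-snoc g (b ∘ suc) n (suc e)) (cong (λ x → lin g (applyUpTo (b ∘ suc) n) (suc e) + b (suc n) * g x) (ℕ.+-suc n e))))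
    (sym (ℤ.+-assoc (b 0 * g e) (lin g (applyUpTo (b ∘ suc) n) (suc e)) _))

  lin-zero : ∀ g b n e → (∀ k → k < n → b k ≡ 0ℤ) → lin g (applyUpTo b n) e ≡ 0ℤ
  lin-zero g b zero e h = refl
  lin-zero g b (suc n) e h = trans (cong₂ _+_ (cong (_* g e) (h 0 (s≤s z≤n))) (lin-zero g (b ∘ suc) n (suc e) λ k p → h (suc k) (s≤s p))) refl

  private
    ≤?-suc : ∀ a b → does (suc a ℕ.≤? suc b) ≡ does (a ℕ.≤? b)
    ≤?-suc zero b = refl
    ≤?-suc (suc a) b = refl

  ∑ℕ : ℕ → (ℕ → ℤ) → ℤ
  ∑ℕ n f = ∑ {n} (λ j → f (toℕ j))

  band-beyond : ∀ a deg r j → r ℕ.+ deg < j → band a deg r j ≡ 0ℤ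
  band-beyond a deg r j p with does (r ℕ.≤? j) | does (j ℕ.≤? r ℕ.+ deg) | dec-false (j ℕ.≤? r ℕ.+ deg) (ℕ.<⇒≱ p)
  ... | true | _ | refl = refl
  ... | false | _ | refl = refl

  band-before : ∀ a deg r j → j < r → band a deg r j ≡ 0ℤ
  band-before a deg r j p with does (r ℕ.≤? j) | dec-false (r ℕ.≤? j) (ℕ.<⇒≱ p)
  ... | _ | refl = refl

  band-within : ∀ a deg r j → r ≤ j → j ≤ r ℕ.+ deg → band a deg r j ≡ a (deg ℕ.+ r ∸ j)
  band-within a deg r j p q with does (r ℕ.≤? j) | does (j ℕ.≤? r ℕ.+ deg) | dec-true (r ℕ.≤? j) p | dec-true (j ℕ.≤? r ℕ.+ deg) q
  ... | _ | _ | refl | refl = refl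

  band-suc : ∀ a deg r j → band a deg (suc r) (suc j) ≡ band a deg r j
  band-suc a deg r j rewrite ≤?-suc r j | ≤?-suc j (r ℕ.+ deg) | ℕ.+-suc deg r = refl

  band-deg : ∀ a deg j → band a (suc deg) 0 (suc j) ≡ band a deg 0 j
  band-deg a deg j rewrite ≤?-suc j deg = refl

  -- Column `j` stands for the power t^(r + deg + e - j), as there are `e` columns to the right of
  -- the band. Read this way, row `r` is the polynomial t^e · a.
  band-pairing : ∀ a g r deg e → ∑ℕ (r ℕ.+ (suc deg ℕ.+ e)) (λ j → band a deg r j * g (r ℕ.+ (deg ℕ.+ e) ∸ j)) ≡ lin g (applyUpTo a (suc deg)) e
  band-pairing a g (suc r) deg e = trans (∑-suc _) (trans (cong₂ _+_
    (cong (_* g (suc r ℕ.+ (deg ℕ.+ e))) (band-before a deg (suc r) 0 (s≤s z≤n)))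
    (trans (∑-cong λ j → cong (_* g (r ℕ.+ (deg ℕ.+ e) ∸ toℕ j)) (band-suc a deg r (toℕ j))) (band-pairing a g r deg e)))
    (ℤ.+-identityˡ _))
  band-pairing a g zero zero e = trans (∑-suc _) (cong₂ _+_
    (cong (_* g e) (band-within a 0 0 0 z≤n z≤n))
    (∑-zeros λ j → cong (_* g (e ∸ suc (toℕ j))) (band-beyond a 0 0 (suc (toℕ j)) (s≤s z≤n))))
  band-pairing a g zero (suc deg) e = trans (∑-suc _) (trans (ℤ.+-comm (band a (suc deg) 0 0 * g (suc deg ℕ.+ e)) _) (trans (cong₂ _+_
    (trans (∑-cong λ j → cong (_* g (deg ℕ.+ e ∸ toℕ j)) (band-deg a deg (toℕ j))) (band-pairing a g zero deg e))
    (cong (_* g (suc deg ℕ.+ e)) (trans (band-within a (suc deg) 0 0 z≤n z≤n) (cong a (ℕ.+-identityʳ (suc deg))))))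
    (sym (lin-snoc g a (suc deg) e))))

  ≡ᵇ-false : ∀ k m → k ≢ m → (k ≡ᵇ m) ≡ false
  ≡ᵇ-false zero zero p = contradiction refl p
  ≡ᵇ-false zero (suc m) p = refl
  ≡ᵇ-false (suc k) zero p = refl
  ≡ᵇ-false (suc k) (suc m) p = ≡ᵇ-false k m (p ∘ cong suc)

  ≡ᵇ-true : ∀ k → (k ≡ᵇ k) ≡ true
  ≡ᵇ-true zero = refl
  ≡ᵇ-true (suc k) = ≡ᵇ-true k

  lin-cyc : ∀ g m .{{_ : NonZero m}} e → g (m ℕ.+ e) ≡ g e → lin g (applyUpTo (cycCoeff m) (suc m)) e ≡ 0ℤ
  lin-cyc g (suc m) e h = trans (lin-snoc g (cycCoeff (suc m)) (suc m) e)
    (trans (cong₂ _+_ (trans (cong (_+_ (-1ℤ * g e)) (lin-zero g (cycCoeff (suc m) ∘ suc) m (suc e) middle)) (ℤ.+-identityʳ (-1ℤ * g e))) (cong₂ _*_ top h))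
      (sym (ℤ.*-distribʳ-+ (g e) -1ℤ 1ℤ)))
    where
    middle : ∀ k → k < m → cycCoeff (suc m) (suc k) ≡ 0ℤ
    middle k p rewrite ≡ᵇ-false k m (ℕ.<⇒≢ p) = refl
    top : cycCoeff (suc m) (suc m) ≡ 1ℤ
    top rewrite ≡ᵇ-true m = refl

  module Cyclic (m : ℕ) .{{_ : NonZero m}} where
    suc-mod : ∀ k → suc (toℕ (k mod m)) mod m ≡ suc k mod m
    suc-mod k = Fin.toℕ-injective (trans (Fin.toℕ-fromℕ< _) (trans (cong (λ x → suc x % m) (Fin.toℕ-fromℕ< _))
      (trans (trans (%-distribˡ-+ 1 (k % m) m) (trans (cong (λ x → (1 % m ℕ.+ x) % m) (m%n%n≡m%n k m)) (sym (%-distribˡ-+ 1 k m)))) (sym (Fin.toℕ-fromℕ< _)))))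

    periodic : ∀ k → (m ℕ.+ k) mod m ≡ k mod m
    periodic k = Fin.toℕ-injective (trans (Fin.toℕ-fromℕ< _) (trans (cong (_% m) (ℕ.+-comm m k)) (trans ([m+n]%n≡m%n k m) (sym (Fin.toℕ-fromℕ< _)))))

    toℕ-mod : ∀ {k} → k < m → toℕ (k mod m) ≡ k
    toℕ-mod p = trans (Fin.toℕ-fromℕ< _) (m<n⇒m%n≡m p)

    mod-toℕ : ∀ i → toℕ i mod m ≡ i
    mod-toℕ i = Fin.toℕ-injective (toℕ-mod (Fin.toℕ<n i))

    cyc : Mat m m
    cyc i = I (suc (toℕ i) mod m)

    cyc-· : ∀ {n} (X : Mat m n) i j → (cyc · X) i j ≡ X (suc (toℕ i) mod m) j
    cyc-· X i j = ∑-I (suc (toℕ i) mod m) (λ k → X k j)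

    -- Row `k` of f(P) is the residue of t^k · f modulo t^m - 1.
    eval-cyc : ∀ as k j → eval cyc as (k mod m) j ≡ lin (λ e → I (e mod m) j) as k
    eval-cyc [] k j = refl
    eval-cyc (a ∷ as) k j = cong (_+_ (a * I (k mod m) j)) (trans (cyc-· (eval cyc as) (k mod m) j)
      (trans (cong (λ x → eval cyc as x j) (suc-mod k)) (eval-cyc as (suc k) j)))

  coefficients : ∀ {d} → (Fin (suc d) → ℤ) → List ℤ
  coefficients {d} c = applyUpTo (coeffN d c) (suc d)

  value₁-applyUpTo : ∀ b n → value₁ (applyUpTo b n) ≡ ∑ℕ n b
  value₁-applyUpTo b zero = sym ∑-zero
  value₁-applyUpTo b (suc n) = trans (cong (_+_ (b 0)) (value₁-applyUpTo (b ∘ suc) n)) (sym (∑-suc _))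

  value₁-coefficients : ∀ {d} (c : Fin (suc d) → ℤ) → value₁ (coefficients c) ≡ evalAt1 d c
  value₁-coefficients {d} c = trans (value₁-applyUpTo (coeffN d c) (suc d)) (trans (∑-cong coeff) (sym (sumℤ-tabulate c id)))
    where
    coeff : ∀ i → coeffN d c (toℕ i) ≡ c i
    coeff i with toℕ i ℕ.<? suc d
    ... | yes p = cong c (Fin.toℕ-injective (Fin.toℕ-fromℕ< p))
    ... | no ¬p = contradiction (Fin.toℕ<n i) ¬p

  module _ (m d : ℕ) .{{_ : NonZero m}} (b : ℕ → ℤ) where
    open Cyclic m

    private
      N = d ℕ.+ m
      bs = applyUpTo b (suc d)

      entry : ℕ → ℕ → ℤ
      entry i j = if does (i ℕ.<? d) then band (cycCoeff m) m i j else band b d (i ∸ d) j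

      entry-A : ∀ i j → i < d → entry i j ≡ band (cycCoeff m) m i j
      entry-A i j p with does (i ℕ.<? d) | dec-true (i ℕ.<? d) p
      ... | _ | refl = refl

      entry-B : ∀ i j → entry (d ℕ.+ i) j ≡ band b d i j
      entry-B i j with does (d ℕ.+ i ℕ.<? d) | dec-false (d ℕ.+ i ℕ.<? d) (ℕ.<⇒≱ (s≤s (ℕ.m≤m+n d i)))
      ... | _ | refl = cong (λ x → band b d x j) (ℕ.m+n∸m≡n d i)

      syl : Mat N N
      syl i j = entry (toℕ i) (toℕ j)

      power : Fin m → ℕ → ℤ
      power c e = I (e mod m) (opposite c)

      reduced : ℕ → Fin m → ℤ
      reduced j c = power c (d ℕ.+ m ∸ suc j)

      -- Column `j` of the Sylvester matrix stands for t^(d+m-1-j). The last `m` columns of `W`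
      -- contain these powers reduced modulo t^m - 1, so multiplying by `W` puts the remainder of
      -- each row polynomial into the right block. The remainder is zero for the rows that come from
      -- t^m - 1.
      W : Mat N N
      W = blk I (λ i → reduced (toℕ i)) O I

      -- The order-reversing permutation: the Sylvester matrix lists powers of t in descending
      -- order, the cyclic shift in ascending order.
      J : Mat m m
      J i = I (opposite i)

      J-· : ∀ {n} (X : Mat m n) i j → (J · X) i j ≡ X (opposite i) j
      J-· X i j = ∑-I (opposite i) (λ k → X k j)

      opposite-fin : ∀ (r : Fin m) → (m ∸ suc (toℕ r)) mod m ≡ opposite r
      opposite-fin r = trans (cong (_mod m) (sym (Fin.opposite-prop r))) (mod-toℕ (opposite r))

      J-J : J · J ≋ I
      J-J i j = trans (J-· J i j) (cong (λ x → I x j) (Fin.opposite-involutive i))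

      J-sym : ∀ i j → J i j ≡ I i (opposite j)
      J-sym i j with i Fin.≟ opposite j
      ... | yes refl = trans (trans (cong (λ x → I x j) (Fin.opposite-involutive j)) (I-diag j)) (sym (I-diag (opposite j)))
      ... | no p = trans (I-off (opposite i) j (λ q → p (trans (sym (Fin.opposite-involutive i)) (cong opposite q)))) (sym (I-off i (opposite j) p))

      T : Mat d d
      T i j = entry (toℕ i) (toℕ j)

      -- The diagonal entries are the leading coefficient of t^m - 1.
      det-T : det T ≡ 1ℤ
      det-T = det-unitriangular T
        (λ i → trans (entry-A (toℕ i) (toℕ i) (Fin.toℕ<n i)) (trans (band-within (cycCoeff m) m (toℕ i) (toℕ i) ℕ.≤-refl (ℕ.m≤m+n _ m))
           (trans (cong (cycCoeff m) (ℕ.m+n∸n≡m m (toℕ i))) (monic m))))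
        (λ i j p → trans (entry-A (toℕ i) (toℕ j) (Fin.toℕ<n i)) (band-before (cycCoeff m) m (toℕ i) (toℕ j) p))
        where
        monic : ∀ m .{{_ : NonZero m}} → cycCoeff m m ≡ 1ℤ
        monic (suc m) rewrite ≡ᵇ-true m = refl

      F : Mat m m
      F = J · eval cyc bs · J

      syl-W : syl · W ≋ blk T O (λ i j → entry (d ℕ.+ toℕ i) (toℕ j)) F
      syl-W = ≋-blk T O _ F
        (λ i j → trans (left (i ↑ˡ m) j) (cong₂ entry (Fin.toℕ-↑ˡ i m) (Fin.toℕ-↑ˡ j m)))
        (λ i c → trans (right (i ↑ˡ m) c) (trans (∑-cong {N} λ j → cong (_* reduced (toℕ j) c) (trans (cong (λ x → entry x (toℕ j)) (Fin.toℕ-↑ˡ i m)) (entry-A (toℕ i) (toℕ j) (Fin.toℕ<n i)))) (rowA i c)))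
        (λ i j → trans (left (d ↑ʳ i) j) (cong₂ entry (Fin.toℕ-↑ʳ d i) (Fin.toℕ-↑ˡ j m)))
        (λ i c → trans (right (d ↑ʳ i) c) (trans (∑-cong {N} λ j → cong (_* reduced (toℕ j) c) (trans (cong (λ x → entry x (toℕ j)) (Fin.toℕ-↑ʳ d i)) (entry-B (toℕ i) (toℕ j)))) (trans (rowB i c) (sym (F-entry i c)))))
        where
        left : ∀ r (c : Fin d) → (syl · W) r (c ↑ˡ m) ≡ syl r (c ↑ˡ m)
        left r c = trans (∑-split d _) (trans (cong₂ _+_
          (trans (∑-cong λ i → cong (syl r (i ↑ˡ m) *_) (blk-A I (λ i → reduced (toℕ i)) O I i c))
            (·-identityʳ (λ (_ : Fin 1) i → syl r (i ↑ˡ m)) zero c))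
          (∑-zeros λ i → trans (cong (syl r (d ↑ʳ i) *_) (blk-C I (λ i → reduced (toℕ i)) O I i c)) (ℤ.*-zeroʳ (syl r (d ↑ʳ i)))))
          (ℤ.+-identityʳ _))

        W-right : ∀ j c → W j (d ↑ʳ c) ≡ reduced (toℕ j) c
        W-right = split-elim d _
          (λ j c → trans (blk-B I (λ i → reduced (toℕ i)) O I j c) (cong (λ x → reduced x c) (sym (Fin.toℕ-↑ˡ j m))))
          (λ j c → trans (blk-D {d} {m} {d} {m} I (λ i → reduced (toℕ i)) O I j c) (sym (trans (cong (λ x → reduced x c) (Fin.toℕ-↑ʳ d j))
            (trans (cong (power c) (trans (cong ((d ℕ.+ m) ∸_) (sym (ℕ.+-suc d (toℕ j)))) (ℕ.[m+n]∸[m+o]≡n∸o d m (suc (toℕ j)))))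
              (trans (cong (λ x → I x (opposite c)) (opposite-fin j)) (trans (J-sym j (opposite c)) (cong (I j) (Fin.opposite-involutive c))))))))

        right : ∀ r c → (syl · W) r (d ↑ʳ c) ≡ ∑ {N} λ j → syl r j * reduced (toℕ j) c
        right r c = ∑-cong λ j → cong (syl r j *_) (W-right j c)

        pairing : ∀ a deg (r : ℕ) e c → r ℕ.+ (suc deg ℕ.+ e) ≡ N → ∑ℕ N (λ j → band a deg r j * reduced j c) ≡ lin (power c) (applyUpTo a (suc deg)) e
        pairing a deg r e c eq = trans (sum-N eq) (band-pairing a (power c) r deg e)
          where
          sum-N : ∀ {n} → r ℕ.+ (suc deg ℕ.+ e) ≡ n → ∑ℕ n (λ j → band a deg r j * power c (n ∸ suc j)) ≡ ∑ℕ (r ℕ.+ (suc deg ℕ.+ e)) (λ j → band a deg r j * power c (r ℕ.+ (deg ℕ.+ e) ∸ j))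
          sum-N refl = ∑-cong {r ℕ.+ (suc deg ℕ.+ e)} λ j → cong (λ x → band a deg r (toℕ j) * power c (x ∸ suc (toℕ j))) (ℕ.+-suc r (deg ℕ.+ e))

        rowA : ∀ (i : Fin d) c → ∑ℕ N (λ j → band (cycCoeff m) m (toℕ i) j * reduced j c) ≡ 0ℤ
        rowA i c = trans (pairing (cycCoeff m) m (toℕ i) (d ∸ suc (toℕ i)) c size)
          (lin-cyc (power c) m (d ∸ suc (toℕ i)) (cong (λ x → I x (opposite c)) (periodic (d ∸ suc (toℕ i)))))
          where
          size : toℕ i ℕ.+ (suc m ℕ.+ (d ∸ suc (toℕ i))) ≡ N
          size = trans (ℕ.+-suc (toℕ i) _) (trans (cong (suc (toℕ i) ℕ.+_) (ℕ.+-comm m _)) (trans (sym (ℕ.+-assoc (suc (toℕ i)) _ m)) (cong (ℕ._+ m) (ℕ.m+[n∸m]≡n (Fin.toℕ<n i)))))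

        rowB : ∀ (i : Fin m) c → ∑ℕ N (λ j → band b d (toℕ i) j * reduced j c) ≡ lin (power c) bs (m ∸ suc (toℕ i))
        rowB i c = pairing b d (toℕ i) (m ∸ suc (toℕ i)) c size
          where
          size : toℕ i ℕ.+ (suc d ℕ.+ (m ∸ suc (toℕ i))) ≡ N
          size = trans (ℕ.+-suc (toℕ i) _) (trans (cong (suc (toℕ i) ℕ.+_) (ℕ.+-comm d _)) (trans (sym (ℕ.+-assoc (suc (toℕ i)) _ d)) (trans (cong (ℕ._+ d) (ℕ.m+[n∸m]≡n (Fin.toℕ<n i))) (ℕ.+-comm m d))))

        F-entry : ∀ i c → F i c ≡ lin (power c) bs (m ∸ suc (toℕ i))
        F-entry i c = trans (∑-cong λ k → cong₂ _*_ (J-· (eval cyc bs) i k) (J-sym k c))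
          (trans (·-identityʳ (eval cyc bs) (opposite i) (opposite c)) (trans (cong (λ x → eval cyc bs x (opposite c)) (sym (opposite-fin i)))
            (eval-cyc bs (m ∸ suc (toℕ i)) (opposite c))))

      det-F : det F ≡ det (eval cyc bs)
      det-F = trans (det-· (J · eval cyc bs) J) (trans (cong (_* det J) (det-· J (eval cyc bs)))
        (trans (ℤ.*-comm (det J * det (eval cyc bs)) (det J)) (trans (sym (ℤ.*-assoc (det J) (det J) _))
          (trans (cong (_* det (eval cyc bs)) (trans (sym (det-· J J)) (trans (det-cong J-J) (det-I {m})))) (ℤ.*-identityˡ _)))))

    resultant-cyc : resultant m (cycCoeff m) d b ≡ det (eval cyc (applyUpTo b (suc d)))
    resultant-cyc = begin
      D.det (m ℕ.+ d) (sylvester m d (cycCoeff m) b) ≡⟨ det-frozen (m ℕ.+ d) _ ⟩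
      det (sylvester m d (cycCoeff m) b) ≡⟨ det-cast (ℕ.+-comm m d) entry ⟩
      det syl ≡⟨ ℤ.*-identityʳ _ ⟨
      det syl * 1ℤ ≡⟨ cong (det syl *_) (trans (det-blk-I-upper d (λ i → reduced (toℕ i)) I) (det-I {m})) ⟨
      det syl * det W ≡⟨ det-· syl W ⟨
      det (syl · W) ≡⟨ det-cong syl-W ⟩
      det (blk T O _ F) ≡⟨ det-blk T (λ i j → entry (d ℕ.+ toℕ i) (toℕ j)) F ⟩
      det T * det F ≡⟨ cong₂ _*_ det-T det-F ⟩
      1ℤ * det (eval cyc bs) ≡⟨ ℤ.*-identityˡ _ ⟩
      det (eval cyc bs) ∎
      where open ≡-Reasoning

-- The companion matrix of Φ and the factorization of the cyclic shift.

module Companion where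
  open Sylvester
  open import Data.Nat.DivMod using (_mod_; n%n≡0)
  open import Data.Vec.Functional using (_++_)
  open import Data.Vec.Functional.Properties using (lookup-++ˡ; lookup-++ʳ)
  open import Relation.Binary.Definitions using (tri<; tri≈; tri>)

  open Matricesℤ

  if-yes : ∀ {A B : Set} (d : Dec A) {x y : B} → A → (if does d then x else y) ≡ x
  if-yes d p rewrite dec-true d p = refl

  if-no : ∀ {A B : Set} (d : Dec A) {x y : B} → ¬ A → (if does d then x else y) ≡ y
  if-no d p rewrite dec-false d p = refl

  ∑ℕ-snoc : ∀ n f → ∑ℕ (suc n) f ≡ ∑ℕ n f + f n
  ∑ℕ-snoc zero f = trans (∑-suc _) (trans (cong (_+_ (f 0)) ∑-zero) (trans (ℤ.+-comm (f 0) 0ℤ) (cong (_+ f 0) (sym ∑-zero))))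
  ∑ℕ-snoc (suc n) f = trans (∑-suc _) (trans (cong (_+_ (f 0)) (∑ℕ-snoc n (f ∘ suc)))
    (trans (sym (ℤ.+-assoc (f 0) _ _)) (cong (_+ f (suc n)) (sym (∑-suc _)))))

  ind : ∀ {n} → ℕ → Row n
  ind k c = if k ≡ᵇ toℕ c then 1ℤ else 0ℤ

  ind-I : ∀ {n} (i c : Fin n) → ind (toℕ i) c ≡ I i c
  ind-I zero zero = refl
  ind-I zero (suc c) = refl
  ind-I (suc i) zero = refl
  ind-I (suc i) (suc c) = ind-I i c

  ind-same : ∀ {n} (c : Fin n) → ind (toℕ c) c ≡ 1ℤ
  ind-same c rewrite ≡ᵇ-true (toℕ c) = refl

  ind-other : ∀ {n} k (c : Fin n) → k ≢ toℕ c → ind k c ≡ 0ℤ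
  ind-other k c p rewrite ≡ᵇ-false k (toℕ c) p = refl

  ∑-ind : ∀ {n} (i : Fin n) (t : Row n) → ∑ (λ c → ind (toℕ i) c * t c) ≡ t i
  ∑-ind i t = trans (∑-cong λ c → cong (_* t c) (ind-I i c)) (∑-I i t)

  det-lower-unitriangular : ∀ {n} (M : Mat n n) → (∀ i → M i i ≡ 1ℤ) → (∀ i j → toℕ i < toℕ j → M i j ≡ 0ℤ) → det M ≡ 1ℤ
  det-lower-unitriangular {zero} M d u = refl
  det-lower-unitriangular {suc n} M d u = trans (det-row₀ M λ j → u zero (suc j) (s≤s z≤n))
    (cong₂ _*_ (d zero) (det-lower-unitriangular (minor M zero) (λ i → d (suc i)) λ i j p → u (suc i) (suc j) (s≤s p)))

  -- In the expansion along row 0 only column 1 contributes, and its entry -1 cancels the cofactor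
  -- sign. The minor has the same shape, and the lower left corner is what remains at the end.
  det-shift : ∀ {n} (B : Mat (suc n) (suc n)) → (∀ i j → suc (toℕ i) < suc n → B i j ≡ - ind (suc (toℕ i)) j) →
              det B ≡ B (Fin.fromℕ n) zero
  det-shift {zero} B h = trans (det-row₀ B λ ()) (ℤ.*-identityʳ (B zero zero))
  det-shift {suc n} B h = begin
    det B ≡⟨ ∑-suc _ ⟩
    1ℤ * B zero zero * det (minor B zero) + _ ≡⟨ cong₂ _+_ (cong (λ x → 1ℤ * x * det (minor B zero)) (h zero zero (s≤s (s≤s z≤n)))) (∑-suc _) ⟩
    0ℤ + (-1ℤ * B zero (suc zero) * det (minor B (suc zero)) + _) ≡⟨ ℤ.+-identityˡ _ ⟩
    -1ℤ * B zero (suc zero) * det (minor B (suc zero)) + _ ≡⟨ cong₂ _+_ (cong (λ x → -1ℤ * x * det (minor B (suc zero))) (h zero (suc zero) (s≤s (s≤s z≤n))))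
       (∑-zeros λ j → cong (_* det (minor B (suc (suc j)))) (trans (cong (- - sgn (toℕ j) *_) (h zero (suc (suc j)) (s≤s (s≤s z≤n)))) (ℤ.*-zeroʳ (- - sgn (toℕ j))))) ⟩
    1ℤ * det (minor B (suc zero)) + 0ℤ ≡⟨ trans (ℤ.+-identityʳ _) (ℤ.*-identityˡ _) ⟩
    det (minor B (suc zero)) ≡⟨ det-shift (minor B (suc zero)) (λ { i zero p → h (suc i) zero (s≤s p) ; i (suc j) p → h (suc i) (suc (suc j)) (s≤s p) }) ⟩
    B (suc (Fin.fromℕ n)) zero ∎
    where open ≡-Reasoning

  mono : ℕ → List ℤ
  mono zero = 1ℤ ∷ []
  mono (suc k) = 0ℤ ∷ mono k

  value₁-mono : ∀ k → value₁ (mono k) ≡ 1ℤ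
  value₁-mono zero = refl
  value₁-mono (suc k) = trans (ℤ.+-identityˡ _) (value₁-mono k)

  value₁-⊕ : ∀ as bs → value₁ (as ⊕ bs) ≡ value₁ as + value₁ bs
  value₁-⊕ [] bs = sym (ℤ.+-identityˡ _)
  value₁-⊕ (a ∷ as) [] = sym (ℤ.+-identityʳ _)
  value₁-⊕ (a ∷ as) (b ∷ bs) = trans (cong (_+_ (a + b)) (value₁-⊕ as bs)) (interchange a b _ _)
    where open import Algebra.Properties.CommutativeSemigroup (CommutativeRing.+-commutativeSemigroup ℤ.+-*-commutativeRing) using (interchange)

  geometric : ℕ → ℕ → List ℤ
  geometric q zero = []
  geometric q (suc s) = mono (s ℕ.* q) ⊕ geometric q s

  value₁-geometric : ∀ q s → value₁ (geometric q s) ≡ + s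
  value₁-geometric q zero = refl
  value₁-geometric q (suc s) = trans (value₁-⊕ (mono (s ℕ.* q)) _) (cong₂ _+_ (value₁-mono (s ℕ.* q)) (value₁-geometric q s))

  module _ {n} (Z : Mat n n) where
    pow : ℕ → Mat n n
    pow k = eval Z (mono k)

    pow-0 : pow 0 ≋ I
    pow-0 i j = trans (cong₂ _+_ (ℤ.*-identityˡ (I i j)) (∑-zeros λ k → ℤ.*-zeroʳ (Z i k))) (ℤ.+-identityʳ (I i j))

    pow-suc : ∀ k → pow (suc k) ≋ Z · pow k
    pow-suc k i j = ℤ.+-identityˡ _

    pow-+ : ∀ k l → pow (k ℕ.+ l) ≋ pow k · pow l
    pow-+ zero l = ≋-sym (≋-trans (·-cong {B = pow l} pow-0 ≋-refl) (·-identityˡ (pow l)))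
    pow-+ (suc k) l = ≋-trans (pow-suc (k ℕ.+ l)) (≋-trans (·-cong {A = Z} ≋-refl (pow-+ k l))
      (≋-trans (≋-sym (·-assoc Z (pow k) (pow l))) (·-cong {B = pow l} (≋-sym (pow-suc k)) ≋-refl)))

    pow-sucʳ : ∀ k → pow (suc k) ≋ pow k · Z
    pow-sucʳ k = ≋-trans (pow-suc k) (eval-comm Z (mono k))

    -- This is (t^q - 1)(1 + t^q + ⋯ + t^((s-1)q)) = t^(sq) - 1 with the negative terms moved
    -- across.
    geometric-telescope : ∀ q s → pow q · eval Z (geometric q s) ⊞ I ≋ eval Z (geometric q s) ⊞ pow (s ℕ.* q)
    geometric-telescope q zero i j = cong₂ _+_ (∑-zeros λ k → ℤ.*-zeroʳ (pow q i k)) (sym (pow-0 i j))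
    geometric-telescope q (suc s) i j = begin
      (pow q · eval Z (geometric q (suc s))) i j + I i j
        ≡⟨ cong (_+ I i j) (trans (·-cong {A = pow q} ≋-refl (eval-⊕ Z (mono (s ℕ.* q)) (geometric q s)) i j) (·-distribˡ (pow q) (pow (s ℕ.* q)) (eval Z (geometric q s)) i j)) ⟩
      (pow q · pow (s ℕ.* q)) i j + (pow q · G) i j + I i j ≡⟨ cong (λ x → x + (pow q · G) i j + I i j) (pow-+ q (s ℕ.* q) i j) ⟨
      pow (suc s ℕ.* q) i j + (pow q · G) i j + I i j ≡⟨ ℤ.+-assoc (pow (suc s ℕ.* q) i j) _ _ ⟩
      pow (suc s ℕ.* q) i j + ((pow q · G) i j + I i j) ≡⟨ cong (_+_ (pow (suc s ℕ.* q) i j)) (geometric-telescope q s i j) ⟩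
      pow (suc s ℕ.* q) i j + (G i j + pow (s ℕ.* q) i j) ≡⟨ ℤ.+-comm (pow (suc s ℕ.* q) i j) _ ⟩
      G i j + pow (s ℕ.* q) i j + pow (suc s ℕ.* q) i j ≡⟨ cong (_+ pow (suc s ℕ.* q) i j) (ℤ.+-comm (G i j) _) ⟩
      pow (s ℕ.* q) i j + G i j + pow (suc s ℕ.* q) i j ≡⟨ cong (_+ pow (suc s ℕ.* q) i j) (eval-⊕ Z (mono (s ℕ.* q)) (geometric q s) i j) ⟨
      eval Z (geometric q (suc s)) i j + pow (suc s ℕ.* q) i j ∎
      where
      open ≡-Reasoning
      G = eval Z (geometric q s)

  -- The companion matrix Z of Φ(t) = 1 + t^q + ⋯ + t^(p′ q), and the block decomposition of the cyclic
  -- shift on ℤ[t]/(t^(q + p′ q) − 1) along the ideal generated by Φ.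
  module Cyclotomic (q p′ : ℕ) .{{_ : NonZero q}} .{{_ : NonZero p′}} where
    r = p′ ℕ.* q
    n = q ℕ.+ r

    Z : Mat r r
    Z j = if does (suc (toℕ j) ℕ.<? r) then ind (suc (toℕ j)) else λ c → - ∑ℕ p′ λ s → ind (s ℕ.* q) c

    private
      instance
        n≢0 : NonZero n
        n≢0 = ℕ.≢-nonZero λ e → ℕ.≢-nonZero⁻¹ q (ℕ.m+n≡0⇒m≡0 q e)
        r≢0 : NonZero r
        r≢0 = ℕ.m*n≢0 p′ q

      module P = Cyclic n
      module Q = Cyclic q

    Z-step : ∀ j → suc (toℕ j) < r → ∀ c → Z j c ≡ ind (suc (toℕ j)) c
    Z-step j p c = cong-app (if-yes (suc (toℕ j) ℕ.<? r) p) c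

    Z-last : ∀ j → suc (toℕ j) ≡ r → ∀ c → Z j c ≡ - ∑ℕ p′ λ s → ind (s ℕ.* q) c
    Z-last j p c = cong-app (if-no (suc (toℕ j) ℕ.<? r) (ℕ.<-irrefl p)) c

    step-or-last : ∀ (j : Fin r) {A : Set} → (suc (toℕ j) < r → A) → (suc (toℕ j) ≡ r → A) → A
    step-or-last j f g with suc (toℕ j) ℕ.<? r
    ... | yes p = f p
    ... | no ¬p = g (ℕ.≤-antisym (Fin.toℕ<n j) (ℕ.≮⇒≥ ¬p))

    private
      ρ : ℕ → Row n
      ρ k = I (k mod n)

      G : ℕ → Row n
      G i c = ∑ℕ (suc p′) λ s → ρ (i ℕ.+ s ℕ.* q) c

      -- A basis of ℤ[t]/(t^n - 1): first t^i · Φ for i < q (rows `G`), which spans the ideal of Φ,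
      -- then t^(q+j) for j < r. In it multiplication by t has the matrix `T`.
      S : Mat n n
      S = _++_ {m = q} {n = r} (λ i → G (toℕ i)) (λ j → ρ (q ℕ.+ toℕ j))

      -- The only product that leaves the span of the powers t^(q+j) is t · t^(n-1) = 1 = Φ - (t^q +
      -- ⋯ + t^(p′q)). It contributes the term Φ to `C` and the last row to `Z`.
      C : Mat r q
      C j = if does (suc (toℕ j) ℕ.<? r) then O {1} zero else ind 0

      C-step : ∀ j → suc (toℕ j) < r → ∀ c → C j c ≡ 0ℤ
      C-step j p c = cong-app (if-yes (suc (toℕ j) ℕ.<? r) p) c

      C-last : ∀ j → suc (toℕ j) ≡ r → ∀ c → C j c ≡ ind 0 c
      C-last j p c = cong-app (if-no (suc (toℕ j) ℕ.<? r) (ℕ.<-irrefl p)) c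

      T : Mat n n
      T = blk Q.cyc O C Z

      ρ-· : ∀ k c → ∑ (λ l → ρ k l * P.cyc l c) ≡ ρ (suc k) c
      ρ-· k c = trans (∑-I (k mod n) (λ l → P.cyc l c)) (cong (λ x → I x c) (P.suc-mod k))

      G-· : ∀ i c → ∑ (λ l → G i l * P.cyc l c) ≡ G (suc i) c
      G-· i c = trans (∑-cong λ l → ∑-* (P.cyc l c) _) (trans (∑-comm _) (∑-cong λ s → ρ-· (i ℕ.+ toℕ s ℕ.* q) c))

      -- Because (t^q - 1) · Φ = t^n - 1, multiplication by t permutes the vectors t^i · Φ
      -- cyclically with period `q`.
      G-periodic : ∀ c → G q c ≡ G 0 c
      G-periodic c = trans (∑ℕ-snoc p′ (λ s → ρ (q ℕ.+ s ℕ.* q) c)) (trans (cong (_+_ (∑ℕ p′ λ s → ρ (q ℕ.+ s ℕ.* q) c)) (trans (cong (λ x → I x c) (trans (cong (_mod n) (sym (ℕ.+-identityʳ n))) (P.periodic 0))) refl))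
        (trans (ℤ.+-comm _ (ρ 0 c)) (sym (∑-suc _))))

      G-mod : ∀ i → i < q → ∀ c → G (toℕ (suc i mod q)) c ≡ G (suc i) c
      G-mod i i<q c with suc i ℕ.<? q
      ... | yes p = cong (λ x → G x c) (Q.toℕ-mod p)
      ... | no ¬p with ℕ.≤-antisym i<q (ℕ.≮⇒≥ ¬p)
      ...   | refl = trans (cong (λ x → G x c) (trans (Fin.toℕ-fromℕ< _) (n%n≡0 q))) (sym (G-periodic c))

      S-top : ∀ i c → S (i ↑ˡ r) c ≡ G (toℕ i) c
      S-top i c = cong-app (lookup-++ˡ {m = q} {n = r} (λ i → G (toℕ i)) (λ j → ρ (q ℕ.+ toℕ j)) i) c
      S-bot : ∀ j c → S (q ↑ʳ j) c ≡ ρ (q ℕ.+ toℕ j) c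
      S-bot j c = cong-app (lookup-++ʳ {m = q} {n = r} (λ i → G (toℕ i)) (λ j → ρ (q ℕ.+ toℕ j)) j) c

      TS-top : ∀ i c → (T · S) (i ↑ˡ r) c ≡ G (toℕ (suc (toℕ i) mod q)) c
      TS-top i c = trans (∑-split q _) (trans (cong₂ _+_
        (trans (∑-cong λ k → cong₂ _*_ (blk-A Q.cyc O C Z i k) (S-top k c)) (∑-I (suc (toℕ i) mod q) (λ k → G (toℕ k) c)))
        (∑-zeros λ k → cong (_* S (q ↑ʳ k) c) (blk-B Q.cyc O C Z i k))) (ℤ.+-identityʳ _))

      TS-bot : ∀ j c → (T · S) (q ↑ʳ j) c ≡ ∑ (λ k → C j k * G (toℕ k) c) + ∑ (λ k → Z j k * ρ (q ℕ.+ toℕ k) c)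
      TS-bot j c = trans (∑-split q _) (cong₂ _+_
        (∑-cong λ k → cong₂ _*_ (blk-C Q.cyc O C Z j k) (S-top k c))
        (∑-cong λ k → cong₂ _*_ (blk-D Q.cyc O C Z j k) (S-bot k c)))

      ∑-ind-ℕ : ∀ {n} k → k < n → (t : ℕ → ℤ) → ∑ {n} (λ c → ind k c * t (toℕ c)) ≡ t k
      ∑-ind-ℕ k p t = trans (trans (∑-cong λ c → cong (λ x → ind x c * t (toℕ c)) (sym (Fin.toℕ-fromℕ< p))) (∑-ind (fromℕ< p) (t ∘ toℕ))) (cong t (Fin.toℕ-fromℕ< p))

      q>0 : 0 < q
      q>0 = ℕ.n≢0⇒n>0 (ℕ.≢-nonZero⁻¹ q)

      TS-bot-eq : ∀ j c → (T · S) (q ↑ʳ j) c ≡ ρ (suc (q ℕ.+ toℕ j)) c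
      TS-bot-eq j c = step-or-last j
        (λ lt → trans (TS-bot j c) (trans (cong₂ _+_ (∑-zeros λ k → cong (_* G (toℕ k) c) (C-step j lt k))
           (trans (∑-cong λ k → cong (_* ρ (q ℕ.+ toℕ k) c) (Z-step j lt k)) (∑-ind-ℕ (suc (toℕ j)) lt (λ k → ρ (q ℕ.+ k) c))))
           (trans (ℤ.+-identityˡ _) (cong (λ x → ρ x c) (ℕ.+-suc q (toℕ j))))))
        (λ eq → trans (TS-bot j c) (trans (cong₂ _+_
           (trans (∑-cong λ k → cong (_* G (toℕ k) c) (C-last j eq k)) (∑-ind-ℕ 0 q>0 (λ k → G k c)))
           (trans (∑-cong λ k → cong (_* ρ (q ℕ.+ toℕ k) c) (Z-last j eq k)) (neg-part c)))
           (trans (cong (_+ - rest) (∑-suc (λ s → ρ (toℕ s ℕ.* q) c))) (trans (ℤ.+-assoc (ρ 0 c) rest (- rest)) (trans (cong (_+_ (ρ 0 c)) (ℤ.+-inverseʳ rest))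
             (trans (ℤ.+-identityʳ _) (sym (trans (cong (λ x → ρ x c) (trans (sym (ℕ.+-suc q (toℕ j))) (cong (q ℕ.+_) eq)))
               (cong (λ x → I x c) (trans (cong (_mod n) (sym (ℕ.+-identityʳ n))) (P.periodic 0)))))))))))
        where
        rest : ℤ
        rest = ∑ℕ p′ λ s → ρ (q ℕ.+ s ℕ.* q) c
        neg-part : ∀ c → ∑ (λ k → (- ∑ℕ p′ λ s → ind (s ℕ.* q) k) * ρ (q ℕ.+ toℕ k) c) ≡ - ∑ℕ p′ λ s → ρ (q ℕ.+ s ℕ.* q) c
        neg-part c = begin
          ∑ (λ k → (- ∑ℕ p′ λ s → ind (s ℕ.* q) k) * ρ (q ℕ.+ toℕ k) c) ≡⟨ ∑-cong (λ k → trans (sym (ℤ.neg-distribˡ-* (∑ℕ p′ λ s → ind (s ℕ.* q) k) (ρ (q ℕ.+ toℕ k) c))) (trans (sym (ℤ.-1*i≡-i _)) (cong (-1ℤ *_) (∑-* (ρ (q ℕ.+ toℕ k) c) (λ s → ind (toℕ s ℕ.* q) k))))) ⟩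
          ∑ (λ k → -1ℤ * ∑ℕ p′ (λ s → ind (s ℕ.* q) k * ρ (q ℕ.+ toℕ k) c)) ≡⟨ *-∑ -1ℤ _ ⟨
          -1ℤ * ∑ (λ k → ∑ℕ p′ (λ s → ind (s ℕ.* q) k * ρ (q ℕ.+ toℕ k) c)) ≡⟨ cong (-1ℤ *_) (∑-comm _) ⟩
          -1ℤ * ∑ℕ p′ (λ s → ∑ (λ k → ind (s ℕ.* q) k * ρ (q ℕ.+ toℕ k) c)) ≡⟨ cong (-1ℤ *_) (∑-cong λ s → ∑-ind-ℕ (toℕ s ℕ.* q) (ℕ.*-monoˡ-< q (Fin.toℕ<n s)) (λ k → ρ (q ℕ.+ k) c)) ⟩
          -1ℤ * ∑ℕ p′ (λ s → ρ (q ℕ.+ s ℕ.* q) c) ≡⟨ ℤ.-1*i≡-i _ ⟩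
          - ∑ℕ p′ (λ s → ρ (q ℕ.+ s ℕ.* q) c) ∎
          where open ≡-Reasoning

      S-P : S · P.cyc ≋ T · S
      S-P = split-elim q _
        (λ i c → trans (∑-cong λ l → cong (_* P.cyc l c) (S-top i l)) (trans (G-· (toℕ i) c) (sym (trans (TS-top i c) (G-mod (toℕ i) (Fin.toℕ<n i) c)))))
        (λ j c → trans (∑-cong λ l → cong (_* P.cyc l c) (S-bot j l)) (trans (ρ-· (q ℕ.+ toℕ j) c) (sym (TS-bot-eq j c))))

      ρ-ind : ∀ k → k < n → ∀ c → ρ k c ≡ ind k c
      ρ-ind k p c = trans (sym (ind-I (k mod n) c)) (cong (λ x → ind x c) (P.toℕ-mod p))

      S-ind : ∀ i → i < q → ∀ c → G i c ≡ ind i c + ∑ℕ p′ λ s → ind (i ℕ.+ suc s ℕ.* q) c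
      S-ind i p c = trans (∑-suc _) (cong₂ _+_ (trans (cong (λ x → ρ x c) (ℕ.+-identityʳ i)) (ρ-ind i (ℕ.<-≤-trans p (ℕ.m≤m+n q r)) c))
        (∑-cong λ s → ρ-ind (i ℕ.+ suc (toℕ s) ℕ.* q) (ℕ.+-mono-<-≤ p (ℕ.*-monoˡ-≤ q (Fin.toℕ<n s))) c))

      bound : ∀ i c s → c ≤ i → i ℕ.+ suc s ℕ.* q ≢ c
      bound i c s p e = ℕ.<-irrefl refl (ℕ.<-≤-trans (ℕ.m<m+n i (ℕ.<-≤-trans q>0 (ℕ.m≤m+n q (s ℕ.* q)))) (ℕ.≤-trans (ℕ.≤-reflexive e) p))

      -- The lowest terms of the basis vectors are t^0, ..., t^(n-1) in this order, each with
      -- coefficient 1.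
      det-S : det S ≡ 1ℤ
      det-S = det-unitriangular S
        (split-elim q _
          (λ i → trans (S-top i (i ↑ˡ r)) (trans (S-ind (toℕ i) (Fin.toℕ<n i) (i ↑ˡ r)) (cong₂ _+_
             (trans (cong (λ x → ind x (i ↑ˡ r)) (sym (Fin.toℕ-↑ˡ i r))) (ind-same (i ↑ˡ r)))
             (∑-zeros λ s → ind-other _ (i ↑ˡ r) (bound (toℕ i) _ (toℕ s) (ℕ.≤-reflexive (Fin.toℕ-↑ˡ i r)))))))
          (λ j → trans (S-bot j (q ↑ʳ j)) (trans (ρ-ind (q ℕ.+ toℕ j) (ℕ.+-monoʳ-< q (Fin.toℕ<n j)) (q ↑ʳ j))
             (trans (cong (λ x → ind x (q ↑ʳ j)) (sym (Fin.toℕ-↑ʳ q j))) (ind-same (q ↑ʳ j))))))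
        (split-elim q _
          (λ i c p → let p′ = subst (toℕ c <_) (Fin.toℕ-↑ˡ i r) p in trans (S-top i c) (trans (S-ind (toℕ i) (Fin.toℕ<n i) c) (cong₂ _+_
             (ind-other (toℕ i) c (λ e → ℕ.<-irrefl (sym e) p′)) (∑-zeros λ s → ind-other _ c (bound (toℕ i) _ (toℕ s) (ℕ.<⇒≤ p′))))))
          (λ j c p → trans (S-bot j c) (trans (ρ-ind (q ℕ.+ toℕ j) (ℕ.+-monoʳ-< q (Fin.toℕ<n j)) c)
             (ind-other (q ℕ.+ toℕ j) c (λ e → ℕ.<-irrefl (sym (trans (Fin.toℕ-↑ʳ q j) e)) p)))))

    det-cyc-factor : ∀ as → det (eval P.cyc as) ≡ det (eval Q.cyc as) * det (eval Z as)
    det-cyc-factor as with eval-blk Q.cyc C Z as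
    ... | E , h = begin
      det (eval P.cyc as) ≡⟨ ℤ.*-identityˡ _ ⟨
      1ℤ * det (eval P.cyc as) ≡⟨ cong (_* det (eval P.cyc as)) det-S ⟨
      det S * det (eval P.cyc as) ≡⟨ det-· S (eval P.cyc as) ⟨
      det (S · eval P.cyc as) ≡⟨ det-cong (eval-intertwine P.cyc T S S-P as) ⟩
      det (eval T as · S) ≡⟨ det-· (eval T as) S ⟩
      det (eval T as) * det S ≡⟨ trans (cong (det (eval T as) *_) det-S) (ℤ.*-identityʳ _) ⟩
      det (eval T as) ≡⟨ det-cong h ⟩
      det (blk (eval Q.cyc as) O E (eval Z as)) ≡⟨ det-blk (eval Q.cyc as) E (eval Z as) ⟩
      det (eval Q.cyc as) * det (eval Z as) ∎
      where open ≡-Reasoning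

    private
      r>0 : 0 < r
      r>0 = ℕ.n≢0⇒n>0 (ℕ.≢-nonZero⁻¹ r)

      e₀ : Fin r
      e₀ = fromℕ< r>0

      pow-row₀ : ∀ k → k < r → ∀ c → pow Z k e₀ c ≡ ind k c
      pow-row₀ zero p c = trans (pow-0 Z e₀ c) (trans (sym (ind-I e₀ c)) (cong (λ x → ind x c) (Fin.toℕ-fromℕ< r>0)))
      pow-row₀ (suc k) p c = trans (pow-sucʳ Z k e₀ c) (trans (∑-cong λ l → cong (_* Z l c) (trans (pow-row₀ k (ℕ.<⇒≤ p) l) (cong (λ x → ind x l) (sym k≡))))
        (trans (∑-ind (fromℕ< (ℕ.<⇒≤ p)) (λ l → Z l c)) (trans (Z-step _ (subst (λ x → suc x < r) (sym k≡) p) c) (cong (λ x → ind (suc x) c) k≡))))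
        where
        k≡ : toℕ (fromℕ< (ℕ.<⇒≤ p)) ≡ k
        k≡ = Fin.toℕ-fromℕ< (ℕ.<⇒≤ p)

      pow-row₀-last : ∀ c → pow Z r e₀ c ≡ - ∑ℕ p′ λ s → ind (s ℕ.* q) c
      pow-row₀-last c = trans (cong (λ x → pow Z x e₀ c) (sym r≡)) (trans (pow-sucʳ Z r-1 e₀ c) (trans (∑-cong λ l → cong (_* Z l c) (trans (pow-row₀ r-1 lt l) (cong (λ x → ind x l) (sym k≡))))
        (trans (∑-ind (fromℕ< lt) (λ l → Z l c)) (Z-last _ (trans (cong suc k≡) r≡) c))))
        where
        r-1 = ℕ.pred r
        r≡ : suc r-1 ≡ r
        r≡ = ℕ.suc-pred r
        lt : r-1 < r
        lt = ℕ.≤-reflexive r≡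
        k≡ : toℕ (fromℕ< lt) ≡ r-1
        k≡ = Fin.toℕ-fromℕ< lt

      geometric-row₀ : ∀ s → s ≤ p′ → ∀ c → eval Z (geometric q s) e₀ c ≡ ∑ℕ s λ s → ind (s ℕ.* q) c
      geometric-row₀ zero p c = sym ∑-zero
      geometric-row₀ (suc s) p c = trans (eval-⊕ Z (mono (s ℕ.* q)) (geometric q s) e₀ c) (trans (cong₂ _+_
        (pow-row₀ (s ℕ.* q) (ℕ.*-monoˡ-< q p) c) (geometric-row₀ s (ℕ.<⇒≤ p) c)) (trans (ℤ.+-comm (ind (s ℕ.* q) c) _) (sym (∑ℕ-snoc s (λ s → ind (s ℕ.* q) c)))))

    Φ : List ℤ
    Φ = geometric q (suc p′)

    -- Row 0 is a cyclic vector: row `i` of Φ(Z) is row 0 of Z^i · Φ(Z) = Φ(Z) · Z^i. So it suffices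
    -- that row 0 vanishes, where the last row of `Z` cancels the lower terms of Φ.
    Φ-Z : eval Z Φ ≋ O
    Φ-Z i c = begin
      eval Z Φ i c ≡⟨ ∑-I i (λ l → eval Z Φ l c) ⟨
      ∑ (λ l → I i l * eval Z Φ l c) ≡⟨ ∑-cong (λ l → cong (_* eval Z Φ l c) (sym (trans (pow-row₀ (toℕ i) (Fin.toℕ<n i) l) (ind-I i l)))) ⟩
      (pow Z (toℕ i) · eval Z Φ) e₀ c ≡⟨ eval-intertwine Z Z (pow Z (toℕ i)) (≋-sym (eval-comm Z (mono (toℕ i)))) Φ e₀ c ⟩
      (eval Z Φ · pow Z (toℕ i)) e₀ c ≡⟨ ∑-zeros (λ l → cong (_* pow Z (toℕ i) l c) (Φ-row₀ l)) ⟩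
      0ℤ ∎
      where
      open ≡-Reasoning
      Φ-row₀ : ∀ c → eval Z Φ e₀ c ≡ 0ℤ
      Φ-row₀ c = trans (eval-⊕ Z (mono r) (geometric q p′) e₀ c) (trans (cong₂ _+_ (pow-row₀-last c) (geometric-row₀ p′ ℕ.≤-refl c)) (ℤ.+-inverseˡ (∑ℕ p′ λ s → ind (s ℕ.* q) c)))

    -- Since t^n - 1 = (t^q - 1) · Φ, this is a consequence of Φ(Z) = 0.
    pow-n : pow Z n ≋ I
    pow-n i j = begin
      pow Z n i j ≡⟨ ℤ.+-identityˡ _ ⟨
      0ℤ + pow Z n i j ≡⟨ cong (_+ pow Z n i j) (Φ-Z i j) ⟨
      eval Z Φ i j + pow Z n i j ≡⟨ geometric-telescope Z q (suc p′) i j ⟨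
      (pow Z q · eval Z Φ) i j + I i j ≡⟨ cong (_+ I i j) (∑-zeros λ k → trans (cong (pow Z q i k *_) (Φ-Z k j)) (ℤ.*-zeroʳ (pow Z q i k))) ⟩
      0ℤ + I i j ≡⟨ ℤ.+-identityˡ _ ⟩
      I i j ∎
      where open ≡-Reasoning

    I-Z : Mat r r
    I-Z = I ⊞ ⊟ Z

    -- Multiplication by the unitriangular matrix `U` of ones turns 1 - Z into the shape of
    -- `det-shift`. The corner entry becomes the sum of the last row of 1 - Z, which is Φ(1) = 1 +
    -- p′.
    det-I-Z : det I-Z ≡ + suc p′
    det-I-Z = trans (sym (trans (cong (det I-Z *_) det-U) (ℤ.*-identityʳ _))) (trans (sym (det-· I-Z U)) (det-B (I-Z · U) refl step last))
      where
      U : Mat r r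
      U j k = if does (toℕ k ℕ.≤? toℕ j) then 1ℤ else 0ℤ

      U-≤ : ∀ j k → toℕ k ≤ toℕ j → U j k ≡ 1ℤ
      U-≤ j k p = if-yes (toℕ k ℕ.≤? toℕ j) p
      U-> : ∀ j k → toℕ j < toℕ k → U j k ≡ 0ℤ
      U-> j k p = if-no (toℕ k ℕ.≤? toℕ j) (ℕ.<⇒≱ p)

      det-U : det U ≡ 1ℤ
      det-U = det-lower-unitriangular U (λ i → U-≤ i i ℕ.≤-refl) U->

      entry : ∀ i k → (I-Z · U) i k ≡ U i k - ∑ (λ j → Z i j * U j k)
      entry i k = trans (·-distribʳ U I (⊟ Z) i k) (cong₂ _+_ (·-identityˡ U i k)
        (trans (∑-cong λ j → sym (ℤ.neg-distribˡ-* (Z i j) (U j k))) (trans (∑-cong λ j → sym (ℤ.-1*i≡-i _)) (trans (sym (*-∑ -1ℤ _)) (ℤ.-1*i≡-i _)))))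

      U-next : ∀ i j k → toℕ j ≡ suc (toℕ i) → U i k - U j k ≡ - ind (suc (toℕ i)) k
      U-next i j k e with ℕ.<-cmp (toℕ j) (toℕ k)
      ... | tri< a b _ = trans (cong₂ _-_ (U-> i k (ℕ.<-trans (ℕ.≤-reflexive (sym e)) a)) (U-> j k a)) (cong -_ (sym (ind-other (suc (toℕ i)) k (λ x → b (trans e x)))))

      ... | tri≈ _ b _ = trans (cong₂ _-_ (U-> i k (ℕ.≤-reflexive (trans (sym e) b))) (U-≤ j k (ℕ.≤-reflexive (sym b)))) (cong -_ (sym (trans (cong (λ x → ind x k) (trans (sym e) b)) (ind-same k))))
      ... | tri> _ b c = trans (cong₂ _-_ (U-≤ i k (ℕ.≤-pred (ℕ.≤-trans c (ℕ.≤-reflexive e)))) (U-≤ j k (ℕ.<⇒≤ c))) (cong -_ (sym (ind-other (suc (toℕ i)) k (λ x → b (trans e x)))))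

      step : ∀ i k → suc (toℕ i) < r → (I-Z · U) i k ≡ - ind (suc (toℕ i)) k
      step i k p = trans (entry i k) (trans (cong (_-_ (U i k)) (trans (∑-cong λ j → cong (_* U j k) (trans (Z-step i p j) (cong (λ x → ind x j) (sym next≡)))) (∑-ind (fromℕ< p) (λ j → U j k))))
        (U-next i (fromℕ< p) k next≡))
        where
        next≡ : toℕ (fromℕ< p) ≡ suc (toℕ i)
        next≡ = Fin.toℕ-fromℕ< p

      ∑ℕ-ones : ∀ s → ∑ℕ s (λ _ → 1ℤ) ≡ + s
      ∑ℕ-ones zero = ∑-zero
      ∑ℕ-ones (suc s) = trans (∑-suc _) (cong (_+_ 1ℤ) (∑ℕ-ones s))

      last : ∀ i k → toℕ k ≡ 0 → suc (toℕ i) ≡ r → (I-Z · U) i k ≡ + suc p′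
      last i k k≡0 e = begin
        (I-Z · U) i k ≡⟨ entry i k ⟩
        U i k - ∑ (λ j → Z i j * U j k) ≡⟨ cong₂ _-_ (U₀ i) (∑-cong λ j → trans (cong₂ _*_ (Z-last i e j) (U₀ j)) (trans (ℤ.*-identityʳ _) (sym (ℤ.-1*i≡-i _)))) ⟩
        1ℤ - ∑ (λ j → -1ℤ * ∑ℕ p′ λ s → ind (s ℕ.* q) j) ≡⟨ cong (_-_ 1ℤ) (*-∑ -1ℤ _) ⟨
        1ℤ - -1ℤ * ∑ {r} (λ j → ∑ℕ p′ λ s → ind (s ℕ.* q) j) ≡⟨ cong (λ x → 1ℤ - -1ℤ * x) (trans (∑-comm _) (trans (∑-cong ind-total) (∑ℕ-ones p′))) ⟩
        1ℤ - -1ℤ * + p′ ≡⟨ cong (_-_ 1ℤ) (ℤ.-1*i≡-i (+ p′)) ⟩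
        1ℤ - - (+ p′) ≡⟨ cong (_+_ 1ℤ) (ℤ.neg-involutive (+ p′)) ⟩
        + suc p′ ∎
        where
        open ≡-Reasoning
        U₀ : ∀ j → U j k ≡ 1ℤ
        U₀ j = U-≤ j k (ℕ.≤-trans (ℕ.≤-reflexive k≡0) z≤n)
        s<r : ∀ (s : Fin p′) → toℕ s ℕ.* q < r
        s<r s = ℕ.*-monoˡ-< q (Fin.toℕ<n s)
        ind-total : ∀ (s : Fin p′) → ∑ {r} (λ j → ind (toℕ s ℕ.* q) j) ≡ 1ℤ
        ind-total s = trans (∑-cong λ j → trans (sym (ℤ.*-identityʳ _)) (cong (λ x → ind x j * 1ℤ) (sym (Fin.toℕ-fromℕ< (s<r s))))) (∑-ind (fromℕ< (s<r s)) (λ _ → 1ℤ))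

      -- The size is abstracted from the product `r`, so that it can be matched as a successor for
      -- `det-shift`.
      det-B : ∀ {m} (B : Mat m m) → m ≡ r → (∀ i k → suc (toℕ i) < r → B i k ≡ - ind (suc (toℕ i)) k) → (∀ i k → toℕ k ≡ 0 → suc (toℕ i) ≡ r → B i k ≡ + suc p′) → det B ≡ + suc p′
      det-B {zero} B e f g = contradiction (sym e) (ℕ.≢-nonZero⁻¹ r)
      det-B {suc m} B e f g = trans (det-shift B (λ i k p → f i k (subst (suc (toℕ i) <_) e p))) (g (Fin.fromℕ m) zero refl (trans (cong suc (Fin.toℕ-fromℕ m)) e))

-- Diagonalization of integer matrices by invertible row and column operations.

module Diagonalization where
  open import Data.Integer.DivMod using (_/_; _%_; a≡a%n+[a/n]*n; n%d<d)

  open Matricesℤ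

  infix 8 _ᵀ
  _ᵀ : ∀ {m n} → Mat m n → Mat n m
  (A ᵀ) i j = A j i

  ᵀ-· : ∀ {l m n} (A : Mat l m) (B : Mat m n) → (A · B) ᵀ ≋ B ᵀ · A ᵀ
  ᵀ-· A B i j = ∑-cong λ k → ℤ.*-comm (A j k) (B k i)

  I-ᵀ : ∀ {n} → I {n} ᵀ ≋ I
  I-ᵀ i j = I-sym j i

  ᵀ-inverse : ∀ {n} {A B : Mat n n} → A · B ≋ I → B ᵀ · A ᵀ ≋ I
  ᵀ-inverse {A = A} {B} h i j = trans (sym (ᵀ-· A B i j)) (trans (h j i) (I-ᵀ i j))

  infix 4 _~_
  -- The inverses are carried as data, because `part-of-det` conjugates `Z` by `U` and by `V`.
  record _~_ {n} (X Y : Mat n n) : Set where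
    field
      U U⁻ V V⁻ : Mat n n
      UU⁻ : U · U⁻ ≋ I
      U⁻U : U⁻ · U ≋ I
      VV⁻ : V · V⁻ ≋ I
      V⁻V : V⁻ · V ≋ I
      UXV : U · X · V ≋ Y

  cancel-inner : ∀ {n} (A B B⁻ A⁻ : Mat n n) → B · B⁻ ≋ I → A · A⁻ ≋ I → A · B · (B⁻ · A⁻) ≋ I
  cancel-inner A B B⁻ A⁻ b a = ≋-trans (·-assoc A B (B⁻ · A⁻)) (≋-trans (·-cong {A = A} ≋-refl (≋-sym (·-assoc B B⁻ A⁻)))
    (≋-trans (·-cong {A = A} ≋-refl (≋-trans (·-cong {B = A⁻} b ≋-refl) (·-identityˡ A⁻))) a))

  ~-trans : ∀ {n} {X Y W : Mat n n} → X ~ Y → Y ~ W → X ~ W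
  ~-trans {X = X} {Y} {W} p q = record
    { U = Q.U · P.U ; U⁻ = P.U⁻ · Q.U⁻ ; V = P.V · Q.V ; V⁻ = Q.V⁻ · P.V⁻
    ; UU⁻ = cancel-inner Q.U P.U P.U⁻ Q.U⁻ P.UU⁻ Q.UU⁻ ; U⁻U = cancel-inner P.U⁻ Q.U⁻ Q.U P.U Q.U⁻U P.U⁻U
    ; VV⁻ = cancel-inner P.V Q.V Q.V⁻ P.V⁻ Q.VV⁻ P.VV⁻ ; V⁻V = cancel-inner Q.V⁻ P.V⁻ P.V Q.V P.V⁻V Q.V⁻V
    ; UXV = begin
        Q.U · P.U · X · (P.V · Q.V) ≈⟨ ≋-sym (·-assoc (Q.U · P.U · X) P.V Q.V) ⟩
        Q.U · P.U · X · P.V · Q.V ≈⟨ ·-cong {B = Q.V} (≋-trans (·-cong {B = P.V} (·-assoc Q.U P.U X) ≋-refl) (≋-trans (·-assoc Q.U (P.U · X) P.V) (·-cong {A = Q.U} ≋-refl P.UXV))) ≋-refl ⟩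
        Q.U · Y · Q.V ≈⟨ Q.UXV ⟩
        W ∎ }
    where
    module P = _~_ p
    module Q = _~_ q
    open import Relation.Binary.Reasoning.Setoid (Ring.setoid (matRing _))

  ~-left : ∀ {n} {X Y : Mat n n} (U U⁻ : Mat n n) → U · U⁻ ≋ I → U⁻ · U ≋ I → U · X ≋ Y → X ~ Y
  ~-left {X = X} {Y} U U⁻ p q e = record { U = U ; U⁻ = U⁻ ; V = I ; V⁻ = I ; UU⁻ = p ; U⁻U = q
    ; VV⁻ = ·-identityˡ I ; V⁻V = ·-identityˡ I ; UXV = ≋-trans (·-identityʳ (U · X)) e }

  ~-reflexive : ∀ {n} {X Y : Mat n n} → X ≋ Y → X ~ Y
  ~-reflexive {X = X} e = ~-left I I (·-identityˡ I) (·-identityˡ I) (≋-trans (·-identityˡ X) e)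

  ~-ᵀ : ∀ {n} {X Y : Mat n n} → X ~ Y → X ᵀ ~ Y ᵀ
  ~-ᵀ {X = X} {Y} p = record { U = V ᵀ ; U⁻ = V⁻ ᵀ ; V = U ᵀ ; V⁻ = U⁻ ᵀ
    ; UU⁻ = ᵀ-inverse {A = V⁻} {V} V⁻V ; U⁻U = ᵀ-inverse {A = V} {V⁻} VV⁻ ; VV⁻ = ᵀ-inverse {A = U⁻} {U} U⁻U ; V⁻V = ᵀ-inverse {A = U} {U⁻} UU⁻
    ; UXV = λ i j → trans (·-assoc (V ᵀ) (X ᵀ) (U ᵀ) i j) (trans (∑-cong λ k → cong (V k i *_) (sym (ᵀ-· U X k j)))
            (trans (sym (ᵀ-· (U · X) V i j)) (UXV j i))) }
    where open _~_ p

  module _ {n : ℕ} where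
    -- Multiplication on the left adds `f i` times row 0 to row i + 1. The transpose acts in the
    -- opposite direction and adds multiples of the lower rows to row 0.
    low : Row n → Mat (suc n) (suc n)
    low f zero j = I zero j
    low f (suc i) zero = f i
    low f (suc i) (suc j) = I i j

    low-row₀ : ∀ f (X : Mat (suc n) (suc n)) j → (low f · X) zero j ≡ X zero j
    low-row₀ f X j = ∑-I zero (λ k → X k j)

    low-row : ∀ f (X : Mat (suc n) (suc n)) i j → (low f · X) (suc i) j ≡ f i * X zero j + X (suc i) j
    low-row f X i j = trans (∑-suc _) (cong (_+_ (f i * X zero j)) (∑-I i (λ k → X (suc k) j)))

    low-inverse : ∀ f g → (∀ i → f i + g i ≡ 0ℤ) → low f · low g ≋ I
    low-inverse f g h zero j = low-row₀ f (low g) j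
    low-inverse f g h (suc i) zero = trans (low-row f (low g) i zero) (trans (cong (_+ g i) (ℤ.*-identityʳ (f i))) (h i))
    low-inverse f g h (suc i) (suc j) = trans (low-row f (low g) i (suc j)) (trans (cong (_+ I i j) (ℤ.*-zeroʳ (f i))) (ℤ.+-identityˡ _))

    ~-low : ∀ f X → X ~ low f · X
    ~-low f X = ~-left (low f) (low (λ i → - f i)) (low-inverse f _ λ i → ℤ.+-inverseʳ (f i)) (low-inverse _ f λ i → ℤ.+-inverseˡ (f i)) ≋-refl

    ~-up : ∀ f X → X ~ low f ᵀ · X
    ~-up f X = ~-left (low f ᵀ) (low (λ i → - f i) ᵀ)
      (ᵀ-inverse {A = low (λ i → - f i)} {low f} (low-inverse _ f λ i → ℤ.+-inverseˡ (f i)))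
      (ᵀ-inverse {A = low f} {low (λ i → - f i)} (low-inverse f _ λ i → ℤ.+-inverseʳ (f i))) ≋-refl

    up-row₀ : ∀ k (X : Mat (suc n) (suc n)) j → (low (I k) ᵀ · X) zero j ≡ X zero j + X (suc k) j
    up-row₀ k X j = trans (∑-suc _) (cong₂ _+_ (ℤ.*-identityˡ (X zero j)) (∑-I k (λ l → X (suc l) j)))

    up-row : ∀ k (X : Mat (suc n) (suc n)) i j → (low (I k) ᵀ · X) (suc i) j ≡ X (suc i) j
    up-row k X i j = trans (∑-suc _) (trans (ℤ.+-identityˡ _) (trans (∑-cong λ l → cong (_* X (suc l) j) (I-sym l i)) (∑-I i (λ l → X (suc l) j))))

    -- A Euclidean step with additions only. The two entries of column 0 run through (x, a), (x, ρ),
    -- (x + ρ, ρ), (x + ρ, -x), (ρ, -x), where ρ is the remainder of a by x.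
    remainder-step : (X : Mat (suc n) (suc n)) .{{_ : ℤ.NonZero (X zero zero)}} (i : Fin n) → X (suc i) zero % X zero zero ≢ 0 →
                     ∃ λ Y → X ~ Y × ℤ.NonZero (Y zero zero) × ∣ Y zero zero ∣ < ∣ X zero zero ∣
    remainder-step X i bad = X₄ , ~-trans (~-low f X) (~-trans (~-up (I i) X₁) (~-trans (~-low g X₂) (~-up (I i) X₃)))
      , subst ℤ.NonZero (sym X₄≡ρ) (ℤ.≢-nonZero (bad ∘ ℤ.+-injective))
      , subst (λ y → ∣ y ∣ < ∣ x ∣) (sym X₄≡ρ) (n%d<d (X (suc i) zero) x)
      where
      x = X zero zero
      a = X (suc i) zero
      ρ = + (a % x)
      f g : Row n
      f j = - (a / x) * I i j
      g j = - I i j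
      X₁ = low f · X
      X₂ = low (I i) ᵀ · X₁
      X₃ = low g · X₂
      X₄ = low (I i) ᵀ · X₃
      cancel : ∀ q ρ x → - q * 1ℤ * x + (ρ + q * x) ≡ ρ
      cancel = solve-∀
      remainder : ∀ q a ρ x → a ≡ ρ + q * x → - q * 1ℤ * x + a ≡ ρ
      remainder q a ρ x refl = cancel q ρ x
      X₁-i : X₁ (suc i) zero ≡ ρ
      X₁-i = trans (low-row f X i zero) (trans (cong (λ δ → - (a / x) * δ * x + a) (I-diag i)) (remainder (a / x) a ρ x (a≡a%n+[a/n]*n a x)))
      X₁-0 : X₁ zero zero ≡ x
      X₁-0 = low-row₀ f X zero
      X₂-0 : X₂ zero zero ≡ x + ρ
      X₂-0 = trans (up-row₀ i X₁ zero) (cong₂ _+_ X₁-0 X₁-i)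
      X₃-i : X₃ (suc i) zero ≡ - 1ℤ * (x + ρ) + ρ
      X₃-i = trans (low-row g X₂ i zero) (cong₂ _+_ (cong₂ (λ δ y → - δ * y) (I-diag i) X₂-0) (trans (up-row i X₁ i zero) X₁-i))
      final : ∀ x ρ → x + ρ + (- 1ℤ * (x + ρ) + ρ) ≡ ρ
      final = solve-∀
      X₄≡ρ : X₄ zero zero ≡ ρ
      X₄≡ρ = trans (up-row₀ i X₃ zero) (trans (cong₂ _+_ (trans (low-row₀ g X₂ zero) X₂-0) X₃-i) (final x ρ))

    clear-column : (X : Mat (suc n) (suc n)) .{{_ : ℤ.NonZero (X zero zero)}} → (∀ i → X (suc i) zero % X zero zero ≡ 0) →
                   ∃ λ Y → X ~ Y × (∀ j → Y zero j ≡ X zero j) × (∀ i → Y (suc i) zero ≡ 0ℤ)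
    clear-column X h = low f · X , ~-low f X , low-row₀ f X , λ i →
      trans (low-row f X i zero) (cancels (X (suc i) zero / X zero zero) (X (suc i) zero) (X zero zero)
        (trans (a≡a%n+[a/n]*n (X (suc i) zero) (X zero zero)) (cong (λ ρ → + ρ + X (suc i) zero / X zero zero * X zero zero) (h i))))
      where
      f : Row n
      f i = - (X (suc i) zero / X zero zero)
      cancels : ∀ q a x → a ≡ 0ℤ + q * x → - q * x + a ≡ 0ℤ
      cancels q a x refl = cancel q x
        where
        cancel : ∀ q x → - q * x + (0ℤ + q * x) ≡ 0ℤ
        cancel = solve-∀

    Cleared : Mat (suc n) (suc n) → Set
    Cleared Y = (∀ j → Y zero (suc j) ≡ 0ℤ) × (∀ i → Y (suc i) zero ≡ 0ℤ)

    reduce : (X : Mat (suc n) (suc n)) → ℤ.NonZero (X zero zero) → Acc _<_ ∣ X zero zero ∣ → ∃ λ Y → X ~ Y × Cleared Y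
    reduce X nz (acc rs) with Fin.any? (λ i → ¬? ((X (suc i) zero % X zero zero) {{nz}} ℕ.≟ 0))
    ... | yes (i , bad) = let Y , X~Y , nz′ , lt = remainder-step X {{nz}} i bad
                              W , Y~W , cl = reduce Y nz′ (rs lt)
                          in W , ~-trans X~Y Y~W , cl
    ... | no col with Fin.any? (λ j → ¬? ((X zero (suc j) % X zero zero) {{nz}} ℕ.≟ 0))
    ...   | yes (j , bad) = let Y , X~Y , nz′ , lt = remainder-step (X ᵀ) {{nz}} j bad
                                W , Y~W , cl = reduce Y nz′ (rs lt)
                            in W ᵀ , ~-ᵀ (~-trans X~Y Y~W) , (proj₂ cl , proj₁ cl)
    -- Clearing the column leaves row 0 unchanged, so its entries are still multiples of the corner.
    -- Clearing the transpose then preserves the zeros already obtained.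
    ...   | no row =
      let Y , X~Y , Y₀ , Yc = clear-column X {{nz}} (λ i → decidable-stable (_ ℕ.≟ 0) λ b → col (i , b))
          nz′ = subst ℤ.NonZero (sym (Y₀ zero)) nz
          W , Y~W , W₀ , Wc = clear-column (Y ᵀ) {{nz′}} (λ j → trans (%-cong (Y₀ (suc j)) (Y₀ zero) {{nz′}} {{nz}}) (decidable-stable (_ ℕ.≟ 0) λ b → row (j , b)))
      in W ᵀ , ~-trans X~Y (~-ᵀ Y~W) , Wc , λ i → trans (W₀ (suc i)) (Yc i)
      where
      %-cong : ∀ {a b x y} → a ≡ b → x ≡ y → .{{_ : ℤ.NonZero x}} .{{_ : ℤ.NonZero y}} → a % x ≡ b % y
      %-cong refl refl = refl

    clear : (X : Mat (suc n) (suc n)) → ∃ λ Y → X ~ Y × Cleared Y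
    clear X with Fin.any? (λ i → Fin.any? λ j → ¬? (X i j ℤ.≟ 0ℤ))
    ... | no none = X , ~-reflexive ≋-refl , (λ j → zeros zero (suc j)) , (λ i → zeros (suc i) zero)
      where
      zeros : ∀ i j → X i j ≡ 0ℤ
      zeros i j = decidable-stable (X i j ℤ.≟ 0ℤ) λ b → none (i , j , b)
    ... | yes (i , j , nz) =
      let Y , X~Y , nzY = to-row₀ X i j nz
          W , Y~W , nzW = to-row₀ (Y ᵀ) j zero nzY
          R , W~R , cl = reduce (W ᵀ) (ℤ.≢-nonZero nzW) (<-wellFounded _)
      in R , ~-trans X~Y (~-trans (~-ᵀ Y~W) W~R) , cl
      where
      -- Applied to the matrix and then to its transpose, this moves a nonzero entry to the corner.
      to-row₀ : ∀ X i j → X i j ≢ 0ℤ → ∃ λ Y → X ~ Y × Y zero j ≢ 0ℤ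
      to-row₀ X i j nz with X zero j ℤ.≟ 0ℤ
      ... | no nz₀ = X , ~-reflexive ≋-refl , nz₀
      to-row₀ X zero j nz | yes z = contradiction z nz
      to-row₀ X (suc i) j nz | yes z = low (I i) ᵀ · X , ~-up (I i) X , λ e →
        nz (trans (sym (ℤ.+-identityˡ _)) (trans (cong (_+ X (suc i) j) (sym z)) (trans (sym (up-row₀ i X j)) e)))

    ext : ℤ → Mat n n → Mat (suc n) (suc n)
    ext x U zero zero = x
    ext x U zero (suc j) = 0ℤ
    ext x U (suc i) zero = 0ℤ
    ext x U (suc i) (suc j) = U i j

    ext-· : ∀ x U y V → ext x U · ext y V ≋ ext (x * y) (U · V)
    ext-· x U y V zero zero = trans (∑-suc _) (trans (cong (_+_ (x * y)) (∑-zeros λ k → refl)) (ℤ.+-identityʳ _))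
    ext-· x U y V zero (suc j) = trans (∑-suc _) (cong₂ _+_ (ℤ.*-zeroʳ x) (∑-zeros λ k → refl))
    ext-· x U y V (suc i) zero = trans (∑-suc _) (cong (_+_ 0ℤ) (∑-zeros λ k → ℤ.*-zeroʳ (U i k)))
    ext-· x U y V (suc i) (suc j) = trans (∑-suc _) (ℤ.+-identityˡ _)

    ext-cong : ∀ {x y U V} → x ≡ y → U ≋ V → ext x U ≋ ext y V
    ext-cong p q zero zero = p
    ext-cong p q zero (suc j) = refl
    ext-cong p q (suc i) zero = refl
    ext-cong p q (suc i) (suc j) = q i j

    ext-I : ext 1ℤ I ≋ I
    ext-I zero zero = refl
    ext-I zero (suc j) = refl
    ext-I (suc i) zero = refl
    ext-I (suc i) (suc j) = refl

    ext-inverse : ∀ {U V} → U · V ≋ I → ext 1ℤ U · ext 1ℤ V ≋ I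
    ext-inverse {U} {V} h = ≋-trans (ext-· 1ℤ U 1ℤ V) (≋-trans (ext-cong refl h) ext-I)

    ~-ext : ∀ x {X Y} → X ~ Y → ext x X ~ ext x Y
    ~-ext x {X} p = record { U = ext 1ℤ U ; U⁻ = ext 1ℤ U⁻ ; V = ext 1ℤ V ; V⁻ = ext 1ℤ V⁻
      ; UU⁻ = ext-inverse UU⁻ ; U⁻U = ext-inverse U⁻U ; VV⁻ = ext-inverse VV⁻ ; V⁻V = ext-inverse V⁻V
      ; UXV = ≋-trans (·-cong {B = ext 1ℤ V} (ext-· 1ℤ U x X) ≋-refl) (≋-trans (ext-· (1ℤ * x) (U · X) 1ℤ V)
                (ext-cong (trans (ℤ.*-identityʳ _) (ℤ.*-identityˡ x)) UXV)) }
      where open _~_ p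

  Diagonal : ∀ {n} → Mat n n → Set
  Diagonal D = ∀ i j → i ≢ j → D i j ≡ 0ℤ

  diagonalize : ∀ {n} (X : Mat n n) → ∃ λ D → X ~ D × Diagonal D
  diagonalize {zero} X = X , ~-reflexive ≋-refl , λ ()
  diagonalize {suc n} X =
    let Y , X~Y , row , col = clear X
        D , Y~D , diag = diagonalize (minor Y zero)
    in ext (Y zero zero) D , ~-trans X~Y (~-trans (~-reflexive (split Y row col)) (~-ext (Y zero zero) Y~D)) , ext-diagonal diag
    where
    split : ∀ Y → (∀ j → Y zero (suc j) ≡ 0ℤ) → (∀ i → Y (suc i) zero ≡ 0ℤ) → Y ≋ ext (Y zero zero) (minor Y zero)
    split Y row col zero zero = refl
    split Y row col zero (suc j) = row j
    split Y row col (suc i) zero = col i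
    split Y row col (suc i) (suc j) = refl
    ext-diagonal : ∀ {x D} → Diagonal D → Diagonal (ext x D)
    ext-diagonal d zero zero p = contradiction refl p
    ext-diagonal d zero (suc j) p = refl
    ext-diagonal d (suc i) zero p = refl
    ext-diagonal d (suc i) (suc j) p = d i j (p ∘ cong suc)

-- Norms modulo p.

module ModP where
  open Sylvester
  open Companion
  open FrobeniusMap
  open import Data.Integer.Divisibility.Signed using (_∣_; divides; ∣ᵤ⇒∣; ∣⇒∣ᵤ; ∣m∣n⇒∣m+n; ∣m⇒∣-m; ∣n⇒∣m*n; ∣m⇒∣m*n)
  open import Data.Integer.DivMod using (a≡a%ℕn+[a/ℕn]*n; _%ℕ_; _/ℕ_)

  module Modular (n : ℕ) where
    infix 4 _≈_
    -- A record instead of the bare divisibility, so that `a` and `b` can be inferred from a proof.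
    record _≈_ (a b : ℤ) : Set where
      constructor mod
      field difference : + n ∣ a - b
    open _≈_ public

    ≡⇒≈ : ∀ {a b} → a ≡ b → a ≈ b
    ≡⇒≈ {a} refl = mod (divides 0ℤ (ℤ.+-inverseʳ a))

    private
      via : ∀ {a b x} → x ≡ a - b → + n ∣ x → a ≈ b
      via refl d = mod d

    ≈-sym : ∀ {a b} → a ≈ b → b ≈ a
    ≈-sym {a} {b} (mod d) = via (e a b) (∣m⇒∣-m d)
      where
      e : ∀ a b → - (a - b) ≡ b - a
      e = solve-∀
    ≈-trans : ∀ {a b c} → a ≈ b → b ≈ c → a ≈ c
    ≈-trans {a} {b} {c} (mod d) (mod d′) = via (e a b c) (∣m∣n⇒∣m+n d d′)
      where
      e : ∀ a b c → a - b + (b - c) ≡ a - c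
      e = solve-∀
    +-cong : ∀ {a b c d} → a ≈ b → c ≈ d → a + c ≈ b + d
    +-cong {a} {b} {c} {d} (mod x) (mod y) = via (e a b c d) (∣m∣n⇒∣m+n x y)
      where
      e : ∀ a b c d → a - b + (c - d) ≡ a + c - (b + d)
      e = solve-∀
    *-cong : ∀ {a b c d} → a ≈ b → c ≈ d → a * c ≈ b * d
    *-cong {a} {b} {c} {d} (mod x) (mod y) = via (e a b c d) (∣m∣n⇒∣m+n (∣m⇒∣m*n c x) (∣n⇒∣m*n b y))
      where
      e : ∀ a b c d → (a - b) * c + b * (c - d) ≡ a * c - b * d
      e = solve-∀
    -‿cong : ∀ {a b} → a ≈ b → - a ≈ - b
    -‿cong {a} {b} (mod x) = via (e a b) (∣m⇒∣-m x)
      where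
      e : ∀ a b → - (a - b) ≡ - a - - b
      e = solve-∀

    ℤ/n : CommutativeRing 0ℓ 0ℓ
    ℤ/n = record
      { Carrier = ℤ ; _≈_ = _≈_ ; _+_ = _+_ ; _*_ = _*_ ; -_ = -_ ; 0# = 0ℤ ; 1# = 1ℤ
      ; isCommutativeRing = record
        { isRing = record
          { +-isAbelianGroup = record
            { isGroup = record
              { isMonoid = record
                { isSemigroup = record
                  { isMagma = record
                    { isEquivalence = record { refl = ≡⇒≈ refl ; sym = ≈-sym ; trans = ≈-trans }
                    ; ∙-cong = +-cong }
                  ; assoc = λ a b c → ≡⇒≈ (ℤ.+-assoc a b c) }
                ; identity = (λ a → ≡⇒≈ (ℤ.+-identityˡ a)) , (λ a → ≡⇒≈ (ℤ.+-identityʳ a)) }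
              ; inverse = (λ a → ≡⇒≈ (ℤ.+-inverseˡ a)) , (λ a → ≡⇒≈ (ℤ.+-inverseʳ a))
              ; ⁻¹-cong = -‿cong }
            ; comm = λ a b → ≡⇒≈ (ℤ.+-comm a b) }
          ; *-cong = *-cong
          ; *-assoc = λ a b c → ≡⇒≈ (ℤ.*-assoc a b c)
          ; *-identity = (λ a → ≡⇒≈ (ℤ.*-identityˡ a)) , (λ a → ≡⇒≈ (ℤ.*-identityʳ a))
          ; distrib = (λ a b c → ≡⇒≈ (ℤ.*-distribˡ-+ a b c)) , (λ a b c → ≡⇒≈ (ℤ.*-distribʳ-+ a b c)) }
        ; *-comm = λ a b → ≡⇒≈ (ℤ.*-comm a b) } }

    n≈0 : ∀ a → + n * a ≈ 0ℤ
    n≈0 a = mod (divides a (trans (ℤ.+-identityʳ _) (ℤ.*-comm (+ n) a)))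

  module ModPrime {p : ℕ} (pr : Prime p) where
    open Modular p
    open CommutativeRing ℤ/n using (semiring; ring) renaming (setoid to modSetoid)
    open LinAlg ℤ/n
    open BlockMatrices ℤ/n
    open MatrixPolynomials ℤ/n
    open import Algebra.Properties.Semiring.Mult semiring using () renaming (_×_ to _×ₚ_)

    module FZ = Frobenius semiring pr
    open FZ using () renaming (_^_ to _^ₚ_)

    ×ₚ-* : ∀ k a → k ×ₚ a ≡ + k * a
    ×ₚ-* zero a = refl
    ×ₚ-* (suc k) a = trans (cong (_+_ a) (×ₚ-* k a)) (trans (cong (_+ + k * a) (sym (ℤ.*-identityˡ a))) (sym (ℤ.*-distribʳ-+ a 1ℤ (+ k))))

    charₚ : ∀ a → p ×ₚ a ≈ 0ℤ
    charₚ a = ≈-trans (≡⇒≈ (×ₚ-* p a)) (n≈0 a)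

    private
      0^p : ∀ k .{{_ : NonZero k}} → 0ℤ ^ₚ k ≡ 0ℤ
      0^p (suc k) = refl
      1^ : ∀ k → 1ℤ ^ₚ k ≡ 1ℤ
      1^ zero = refl
      1^ (suc k) = trans (ℤ.*-identityˡ _) (1^ k)

    fermat-ℕ : ∀ a → (+ a) ^ₚ p ≈ + a
    fermat-ℕ zero = ≡⇒≈ (0^p p {{prime⇒nonZero pr}})
    fermat-ℕ (suc a) = ≈-trans (FZ.frobenius charₚ 1ℤ (+ a) (≡⇒≈ (ℤ.*-comm 1ℤ (+ a)))) (+-cong (≡⇒≈ (1^ p)) (fermat-ℕ a))

    fermat : ∀ a → a ^ₚ p ≈ a
    fermat a = ≈-trans (FZ.^-congˡ p a≈) (≈-trans (fermat-ℕ (a %ℕ p)) (≈-sym a≈))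
      where
      instance
        p≢0 : NonZero p
        p≢0 = prime⇒nonZero pr
      a≈ : a ≈ + (a %ℕ p)
      a≈ = mod (divides (a /ℕ p) (trans (cong (_- + (a %ℕ p)) (a≡a%ℕn+[a/ℕn]*n a p)) (e (+ (a %ℕ p)) (a /ℕ p * + p))))
        where
        e : ∀ x y → x + y - x ≡ y
        e = solve-∀

    fermat-iterate : ∀ k a → a ^ₚ (p ℕ.^ k) ≈ a
    fermat-iterate zero a = ≡⇒≈ (ℤ.*-identityʳ a)
    fermat-iterate (suc k) a = ≈-trans (≈-sym (FZ.^-assocʳ a p (p ℕ.^ k))) (≈-trans (FZ.^-congˡ (p ℕ.^ k) (fermat a)) (fermat-iterate k a))

    prime∣* : ∀ a b → a * b ≈ 0ℤ → ¬ (a ≈ 0ℤ) → b ≈ 0ℤ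
    prime∣* a b (mod d) ¬a with euclidsLemma ∣ a ∣ ∣ b ∣ pr (subst (p ℕ.∣_) (ℤ.abs-* a b) (subst (λ x → p ℕ.∣ ∣ x ∣) (ℤ.+-identityʳ (a * b)) (∣⇒∣ᵤ d)))
    ... | inj₁ e = contradiction (mod (subst (+ p ∣_) (sym (ℤ.+-identityʳ a)) (∣ᵤ⇒∣ e))) ¬a
    ... | inj₂ e = mod (subst (+ p ∣_) (sym (ℤ.+-identityʳ b)) (∣ᵤ⇒∣ e))

    fermat-unit : ∀ a → ¬ (a ≈ 0ℤ) → ∀ {p-1} → suc p-1 ≡ p → a ^ₚ p-1 ≈ 1ℤ
    fermat-unit a ¬a {p-1} refl = mod (subst (+ p ∣_) (ℤ.+-identityʳ _) (difference (prime∣* a (a ^ₚ p-1 - 1ℤ) (mod (subst (+ p ∣_) (e a (a ^ₚ p-1)) (difference (fermat a)))) ¬a)))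
      where
      e : ∀ a x → a * x - a ≡ a * (x - 1ℤ) - 0ℤ
      e = solve-∀

    module _ {n : ℕ} where
      module FM = Frobenius (Ring.semiring (matRing n)) pr
      open FM using () renaming (_^_ to _^ᴹ_) public
      open import Algebra.Properties.Semiring.Mult (Ring.semiring (matRing n)) using () renaming (_×_ to _×ᴹ_)

      ×ᴹ-entry : ∀ k A i j → (k ×ᴹ A) i j ≡ k ×ₚ A i j
      ×ᴹ-entry zero A i j = refl
      ×ᴹ-entry (suc k) A i j = cong (_+_ (A i j)) (×ᴹ-entry k A i j)

      charᴹ : ∀ A → p ×ᴹ A ≋ O
      charᴹ A i j = ≈-trans (≡⇒≈ (×ᴹ-entry p A i j)) (charₚ (A i j))

      scalar-^ : ∀ a k → (a ⊙ I {n}) ^ᴹ k ≋ (a ^ₚ k) ⊙ I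
      scalar-^ a zero i j = ≡⇒≈ (sym (ℤ.*-identityˡ (I i j)))
      scalar-^ a (suc k) = ≋-trans (·-cong {A = a ⊙ I} ≋-refl (scalar-^ a k)) (≋-trans (⊙-· a I ((a ^ₚ k) ⊙ I))
        (λ i j → ≈-trans (*-cong (≡⇒≈ (refl {x = a})) (·-identityˡ ((a ^ₚ k) ⊙ I) i j)) (≡⇒≈ (sym (ℤ.*-assoc a (a ^ₚ k) (I i j))))))

      scalar-comm : ∀ a (A : Mat n n) → (a ⊙ I) · A ≋ A · (a ⊙ I)
      scalar-comm a A = ≋-trans (⊙-· a I A) (≋-trans (⊙-cong {a = a} {a} (≡⇒≈ refl) (≋-trans (·-identityˡ A) (≋-sym (·-identityʳ A)))) (≋-sym (·-⊙ a A I)))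

      -- Frobenius is additive on the commuting terms of Horner's scheme, and by Fermat it fixes the
      -- coefficients.
      eval-frobenius : ∀ (Z : Mat n n) as → eval Z as ^ᴹ p ≋ eval (Z ^ᴹ p) as
      eval-frobenius Z [] = zero-^ p {{prime⇒nonZero pr}}
        where
        zero-^ : ∀ k .{{_ : NonZero k}} → O ^ᴹ k ≋ O {n}
        zero-^ (suc k) i j = ∑-zeros λ l → ≡⇒≈ refl
      eval-frobenius Z (a ∷ as) = begin
        (a ⊙ I ⊞ Z · E) ^ᴹ p ≈⟨ FM.frobenius charᴹ (a ⊙ I) (Z · E) (scalar-comm a (Z · E)) ⟩
        (a ⊙ I) ^ᴹ p ⊞ (Z · E) ^ᴹ p ≈⟨ (λ i j → +-cong (≈-trans (scalar-^ a p i j) (*-cong (fermat a) (≡⇒≈ (refl {x = I i j})))) (FM.^-distrib Z E (eval-comm Z as) p i j)) ⟩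
        a ⊙ I ⊞ Z ^ᴹ p · E ^ᴹ p ≈⟨ (λ i j → +-cong (≡⇒≈ (refl {x = a * I i j})) (·-cong {A = Z ^ᴹ p} ≋-refl (eval-frobenius Z as) i j)) ⟩
        a ⊙ I ⊞ Z ^ᴹ p · eval (Z ^ᴹ p) as ∎
        where
        E = eval Z as
        open import Relation.Binary.Reasoning.Setoid (Ring.setoid (matRing n))

      eval-cong : ∀ {Z Y : Mat n n} → Z ≋ Y → ∀ as → eval Z as ≋ eval Y as
      eval-cong h [] = ≋-refl
      eval-cong {Z} {Y} h (a ∷ as) i j = +-cong (≡⇒≈ (refl {x = a * I i j})) (·-cong h (eval-cong h as) i j)

      eval-frobenius-iterate : ∀ k (Z : Mat n n) as → eval Z as ^ᴹ (p ℕ.^ k) ≋ eval (Z ^ᴹ (p ℕ.^ k)) as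
      eval-frobenius-iterate zero Z as = ≋-trans (·-identityʳ (eval Z as)) (eval-cong {Z} {Z · I} (≋-sym (·-identityʳ Z)) as)
      eval-frobenius-iterate (suc k) Z as = ≋-trans (≋-sym (FM.^-assocʳ (eval Z as) p (p ℕ.^ k))) (≋-trans (FM.^-congˡ (p ℕ.^ k) (eval-frobenius Z as))
        (≋-trans (eval-frobenius-iterate k (Z ^ᴹ p) as) (eval-cong (FM.^-assocʳ Z p (p ℕ.^ k)) as)))

      eval-I : ∀ as → eval (I {n}) as ≋ value₁ as ⊙ I
      eval-I [] i j = ≡⇒≈ refl
      eval-I (a ∷ as) i j = ≈-trans (+-cong (≡⇒≈ (refl {x = a * I i j})) (≈-trans (·-identityˡ (eval I as) i j) (eval-I as i j))) (≡⇒≈ (sym (ℤ.*-distribʳ-+ (I i j) a (value₁ as))))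

      det-^ : ∀ (A : Mat n n) k → det (A ^ᴹ k) ≈ det A ^ₚ k
      det-^ A zero = det-I {n}
      det-^ A (suc k) = ≈-trans (det-· A (A ^ᴹ k)) (*-cong (≡⇒≈ (refl {x = det A})) (det-^ A k))

    det-scalar : ∀ {n} a → det (a ⊙ I {n}) ≈ a ^ₚ n
    det-scalar {n} a = ≈-trans (det-diagonal (a ⊙ I {n}) (λ i j h → ≈-trans (*-cong (≡⇒≈ (refl {x = a})) (I-off i j h)) (≡⇒≈ (ℤ.*-zeroʳ a)))) (diag n)
      where
      diag : ∀ n → ∏ (λ i → (a ⊙ I {n}) i i) ≈ a ^ₚ n
      diag zero = ≡⇒≈ refl
      diag (suc n) = *-cong (≡⇒≈ (ℤ.*-identityʳ a)) (diag n)

    -- Fermat fixes the determinant, so modulo p it equals its own p^k-th power det f(Z^(p^k)) = det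
    -- f(1), the determinant of a scalar matrix.
    det-unipotent : ∀ {n} (Z : Mat n n) k → Z ^ᴹ (p ℕ.^ k) ≋ I → ∀ as → det (eval Z as) ≈ value₁ as ^ₚ n
    det-unipotent {n} Z k h as = begin
      det (eval Z as) ≈⟨ ≈-sym (fermat-iterate k _) ⟩
      det (eval Z as) ^ₚ (p ℕ.^ k) ≈⟨ ≈-sym (det-^ (eval Z as) (p ℕ.^ k)) ⟩
      det (eval Z as ^ᴹ (p ℕ.^ k)) ≈⟨ det-cong (≋-trans (eval-frobenius-iterate k Z as) (≋-trans (eval-cong h as) (eval-I as))) ⟩
      det (value₁ as ⊙ I {n}) ≈⟨ det-scalar {n} (value₁ as) ⟩
      value₁ as ^ₚ n ∎
      where open import Relation.Binary.Reasoning.Setoid modSetoid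

  module _ {p : ℕ} (pr : Prime p) where
    private
      module L = LinAlg ℤ.+-*-commutativeRing
      module B = BlockMatrices ℤ.+-*-commutativeRing
      module P = MatrixPolynomials ℤ.+-*-commutativeRing
    open Modular p
    open ModPrime pr
    open LinAlg ℤ/n
    open BlockMatrices ℤ/n
    open MatrixPolynomials ℤ/n
    open Homomorphism ℤ.+-*-commutativeRing ℤ/n

    -- The ring ℤ/p has carrier ℤ with a coarser equality, so reduction is the identity map.
    reduction : IsHom id
    reduction = record { +-homo = λ a b → ≡⇒≈ refl ; *-homo = λ a b → ≡⇒≈ refl ; -‿homo = λ a → ≡⇒≈ refl
      ; 0-homo = ≡⇒≈ refl ; 1-homo = ≡⇒≈ refl ; φ-cong = ≡⇒≈ }
    open IsHom reduction

    pow-reduce : ∀ {n} (Z : L.Mat n n) k i j → pow Z k i j ≈ (Z ^ᴹ k) i j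
    pow-reduce Z zero i j = ≈-trans (≡⇒≈ (pow-0 Z i j)) (I-homo i j)
    pow-reduce Z (suc k) i j = ≈-trans (≡⇒≈ (pow-suc Z k i j)) (≈-trans (·-homo Z (pow Z k) i j) (∑-cong λ l → *-cong (≡⇒≈ (refl {x = Z i l})) (pow-reduce Z k l j)))

    eval-reduce : ∀ {n} (Z : L.Mat n n) as i j → P.eval Z as i j ≈ eval Z as i j
    eval-reduce Z as i j = subst (λ bs → P.eval Z as i j ≈ eval Z bs i j) (map-id as) (eval-homo Z as i j)
      where open import Data.List.Properties using (map-id)

    -- Z is unipotent modulo p, with eigenvalue 1 only.
    det-mod-p : ∀ q p-1 → suc p-1 ≡ p → (Z : L.Mat (p-1 ℕ.* q) (p-1 ℕ.* q)) → ∀ k → pow Z (p ℕ.^ k) L.≋ B.I →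
                ∀ as → ¬ (P.value₁ as ≈ 0ℤ) → L.det (P.eval Z as) ≈ 1ℤ
    det-mod-p q p-1 eq Z k h as v≢0 = begin
      L.det (P.eval Z as) ≈⟨ det-homo (P.eval Z as) ⟩
      det (P.eval Z as) ≈⟨ det-cong (eval-reduce Z as) ⟩
      det (eval Z as) ≈⟨ det-unipotent Z k (λ i j → ≈-trans (≈-sym (pow-reduce Z (p ℕ.^ k) i j)) (≈-trans (≡⇒≈ (h i j)) (I-homo i j))) as ⟩
      -- The size of `Z` is a multiple of p - 1, so Fermat's theorem for units removes the
      -- dependence on f(1).
      value₁ as ^ₚ (p-1 ℕ.* q) ≈⟨ ≈-sym (FZ.^-assocʳ (value₁ as) p-1 q) ⟩
      (value₁ as ^ₚ p-1) ^ₚ q ≈⟨ FZ.^-congˡ q (fermat-unit (value₁ as) v≢0 eq) ⟩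
      1ℤ ^ₚ q ≡⟨ 1^ q ⟩
      1ℤ ∎
      where
      open import Relation.Binary.Reasoning.Setoid (CommutativeRing.setoid ℤ/n)
      open FZ using () renaming (_^_ to _^ₚ_)
      1^ : ∀ k → 1ℤ ^ₚ k ≡ 1ℤ
      1^ zero = refl
      1^ (suc k) = trans (ℤ.*-identityˡ _) (1^ k)

-- Counting the elements of the cokernel.

module Counting where
  open Sylvester
  open Companion
  open Diagonalization
  open Orbits
  open import Data.Integer.Divisibility.Signed using (_∣_; divides; ∣ᵤ⇒∣; ∣⇒∣ᵤ; ∣m∣n⇒∣m+n; ∣m⇒∣-m; ∣m⇒∣m*n; ∣-trans)
  open import Data.Integer.DivMod using (a≡a%ℕn+[a/ℕn]*n; _%ℕ_; _/ℕ_; n%ℕd<d)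

  open Matricesℤ

  ∣∑ : ∀ {n d} (t : Row n) → (∀ i → d ∣ t i) → d ∣ ∑ t
  ∣∑ {zero} {d} t h = subst (d ∣_) (sym ∑-zero) (divides 0ℤ refl)
  ∣∑ {suc n} {d} t h = subst (d ∣_) (sym (∑-suc t)) (∣m∣n⇒∣m+n (h zero) (∣∑ _ (h ∘ suc)))

  ∏ℕ : ∀ {n} → (Fin n → ℕ) → ℕ
  ∏ℕ {zero} e = 1
  ∏ℕ {suc n} e = e zero ℕ.* ∏ℕ (e ∘ suc)

  -- Mixed radix notation: it enumerates the group ∏ ℤ/eᵢ as a type `Fin N`, the form required by
  -- `unique-fixed-point`.
  encode : ∀ {n} (e : Fin n → ℕ) → (∀ i → Fin (e i)) → Fin (∏ℕ e)
  encode {zero} e f = zero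
  encode {suc n} e f = Fin.combine (f zero) (encode (e ∘ suc) (f ∘ suc))

  decode : ∀ {n} (e : Fin n → ℕ) → Fin (∏ℕ e) → ∀ i → Fin (e i)
  decode {suc n} e x zero = Fin.quotient (∏ℕ (e ∘ suc)) x
  decode {suc n} e x (suc i) = decode (e ∘ suc) (Fin.remainder {e zero} (∏ℕ (e ∘ suc)) x) i

  decode-encode : ∀ {n} (e : Fin n → ℕ) f i → decode e (encode e f) i ≡ f i
  decode-encode {suc n} e f zero = cong proj₁ (Fin.remQuot-combine (f zero) (encode (e ∘ suc) (f ∘ suc)))
  decode-encode {suc n} e f (suc i) = trans (cong (λ x → decode (e ∘ suc) x i) (cong proj₂ (Fin.remQuot-combine (f zero) (encode (e ∘ suc) (f ∘ suc)))))
    (decode-encode (e ∘ suc) (f ∘ suc) i)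

  decode-injective : ∀ {n} (e : Fin n → ℕ) x y → (∀ i → decode e x i ≡ decode e y i) → x ≡ y
  decode-injective {zero} e zero zero h = refl
  decode-injective {suc n} e x y h = trans (sym (Fin.combine-remQuot {e zero} (∏ℕ (e ∘ suc)) x)) (trans (cong₂ Fin.combine (h zero)
    (decode-injective (e ∘ suc) _ _ (h ∘ suc))) (Fin.combine-remQuot {e zero} (∏ℕ (e ∘ suc)) y))

  residue-unique : ∀ n {a b} → a < n → b < n → + n ∣ + a - + b → a ≡ b
  residue-unique n {a} {b} a<n b<n d = ℕ.≤-antisym (bounded a b a<n d) (bounded b a b<n (subst (+ n ∣_) (flip (+ a) (+ b)) (∣m⇒∣-m d)))
    where
    flip : ∀ a b → - (a - b) ≡ b - a
    flip = solve-∀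
    bounded : ∀ a b → a < n → + n ∣ + a - + b → a ℕ.≤ b
    bounded a b a<n d with a ℕ.≤? b
    ... | yes p = p
    ... | no ¬p = contradiction (ℕ.∣⇒≤ {{ℕ.>-nonZero (ℕ.m<n⇒0<n∸m (ℕ.≰⇒> ¬p))}} (subst (λ x → n ℕ.∣ ∣ x ∣) (trans (ℤ.m-n≡m⊖n a b) (ℤ.⊖-≥ (ℕ.<⇒≤ (ℕ.≰⇒> ¬p)))) (∣⇒∣ᵤ d)))
                     (ℕ.<⇒≱ (ℕ.≤-<-trans (ℕ.m∸n≤m a b) a<n))

  -- The matrix A acts on ∏ ℤ/eᵢ; a fixed point of A^(p^k) is killed by p = Φ(1), hence zero.
  module _ {r : ℕ} (e : Fin r → ℕ) (e≢0 : ∀ i → NonZero (e i)) {p : ℕ} (pr : Prime p) (k : ℕ) (A : Mat r r) where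
    private
      infix 4 _∼_
      record _∼_ (v w : Mat r 1) : Set where
        constructor congruent
        field entrywise : ∀ i → + e i ∣ v i zero - w i zero
      open _∼_

      ≋⇒∼ : ∀ {v w} → v ≋ w → v ∼ w
      ≋⇒∼ {v} {w} h = congruent λ i → divides 0ℤ (trans (cong (_- w i zero) (h i zero)) (ℤ.+-inverseʳ (w i zero)))
      ∼-sym : ∀ {v w} → v ∼ w → w ∼ v
      ∼-sym {v} {w} h = congruent λ i → subst (+ e i ∣_) (f (v i zero) (w i zero)) (∣m⇒∣-m (entrywise h i))
        where
        f : ∀ a b → - (a - b) ≡ b - a
        f = solve-∀
      ∼-trans : ∀ {u v w} → u ∼ v → v ∼ w → u ∼ w
      ∼-trans {u} {v} {w} h h′ = congruent λ i → subst (+ e i ∣_) (f (u i zero) (v i zero) (w i zero)) (∣m∣n⇒∣m+n (entrywise h i) (entrywise h′ i))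
        where
        f : ∀ a b c → a - b + (b - c) ≡ a - c
        f = solve-∀
      ⊞-∼ : ∀ {u v w x} → u ∼ v → w ∼ x → u ⊞ w ∼ v ⊞ x
      ⊞-∼ {u} {v} {w} {x} h h′ = congruent λ i → subst (+ e i ∣_) (f (u i zero) (v i zero) (w i zero) (x i zero)) (∣m∣n⇒∣m+n (entrywise h i) (entrywise h′ i))
        where
        f : ∀ a b c d → a - b + (c - d) ≡ a + c - (b + d)
        f = solve-∀

      lift : Fin (∏ℕ e) → Mat r 1
      lift x i _ = + toℕ (decode e x i)

      reduce-mod : Mat r 1 → Fin (∏ℕ e)
      reduce-mod v = encode e λ i → fromℕ< (n%ℕd<d (v i zero) (e i) {{e≢0 i}})

      lift-reduce : ∀ v → lift (reduce-mod v) ∼ v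
      lift-reduce v = congruent λ i → divides (- (v i zero /ℕ e i) {{e≢0 i}}) (trans (cong₂ (λ x y → + x - y)
        (trans (cong toℕ (decode-encode e (λ i → fromℕ< (n%ℕd<d (v i zero) (e i) {{e≢0 i}})) i)) (Fin.toℕ-fromℕ< _)) (a≡a%ℕn+[a/ℕn]*n (v i zero) (e i) {{e≢0 i}}))
        (f (+ (v i zero %ℕ e i) {{e≢0 i}}) ((v i zero /ℕ e i) {{e≢0 i}}) (+ e i)))
        where
        f : ∀ ρ q n → ρ - (ρ + q * n) ≡ - q * n
        f = solve-∀

      lift-injective : ∀ {x y} → lift x ∼ lift y → x ≡ y
      lift-injective {x} {y} h = decode-injective e x y λ i → Fin.toℕ-injective (residue-unique (e i) (Fin.toℕ<n (decode e x i)) (Fin.toℕ<n (decode e y i)) (entrywise h i))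

      σ : Fin (∏ℕ e) → Fin (∏ℕ e)
      σ x = reduce-mod (A · lift x)

      x₀ : Fin (∏ℕ e)
      x₀ = reduce-mod O

    -- This says that A preserves the sublattice ⊕ eⱼℤ and therefore acts on the quotient ∏ ℤ/eᵢ.
    module _ (stable : ∀ i j → + e i ∣ A i j * + e j) where
      private
        act : ∀ {v w} → v ∼ w → A · v ∼ A · w
        act {v} {w} h = congruent λ i → subst (+ e i ∣_) (equation i) (∣∑ _ λ j → entry i j (entrywise h j))
          where
          entry : ∀ i j → + e j ∣ v j zero - w j zero → + e i ∣ A i j * (v j zero - w j zero)
          entry i j (divides c eq) = subst (+ e i ∣_) (trans (f (A i j) (+ e j) c) (cong (A i j *_) (sym eq))) (∣m⇒∣m*n c (stable i j))
            where
            f : ∀ a e c → a * e * c ≡ a * (c * e)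
            f = solve-∀
          f : ∀ a v w → a * v ≡ a * (v - w) + a * w
          f = solve-∀
          g : ∀ x y → x ≡ x + y - y
          g = solve-∀
          equation : ∀ i → ∑ (λ j → A i j * (v j zero - w j zero)) ≡ (A · v) i zero - (A · w) i zero
          equation i = trans (g _ ((A · w) i zero)) (cong (_- (A · w) i zero) (sym (trans (∑-cong λ j → f (A i j) (v j zero) (w j zero)) (∑-+ _ _))))

        lift-iter : ∀ n x → lift (iter σ n x) ∼ pow A n · lift x
        lift-iter zero x = ≋⇒∼ (≋-sym (≋-trans (·-cong {B = lift x} (pow-0 A) ≋-refl) (·-identityˡ (lift x))))
        lift-iter (suc n) x = ∼-trans (lift-reduce (A · lift (iter σ n x))) (∼-trans (act (lift-iter n x))
          (≋⇒∼ (≋-trans (≋-sym (·-assoc A (pow A n) (lift x))) (·-cong {B = lift x} (≋-sym (pow-suc A n)) ≋-refl))))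

      cardinality : pow A (p ^ suc k) ≋ I → eval A (geometric (p ^ k) p) ≋ O → (∀ i → Coprime (e i) p) → p ^ suc k ℕ.∣ ∏ℕ e ∸ 1
      cardinality periodic killed coprime = unique-fixed-point σ pr k x₀
        (lift-injective (∼-trans (lift-reduce (A · lift x₀)) (∼-trans (act (lift-reduce O)) (∼-trans (≋⇒∼ λ i j → ∑-zeros λ l → ℤ.*-zeroʳ (A i l)) (∼-sym (lift-reduce O))))))
        (λ x → lift-injective (∼-trans (lift-iter (p ^ suc k) x) (≋⇒∼ (≋-trans (·-cong {B = lift x} periodic ≋-refl) (·-identityˡ (lift x))))))
        (λ x fix → lift-injective (∼-trans (vanish x fix) (∼-sym (lift-reduce O))))
        where
        module _ (x : Fin (∏ℕ e)) (fix : iter σ (p ^ k) x ≡ x) where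
          fixed : ∀ s → pow A (s ℕ.* p ^ k) · lift x ∼ lift x
          fixed s = ∼-trans (∼-sym (lift-iter (s ℕ.* p ^ k) x)) (≋⇒∼ λ i j → cong (λ y → lift y i j) (iter-* σ s fix))

          sum-fixed : ∀ s → eval A (geometric (p ^ k) s) · lift x ∼ (+ s) ⊙ lift x
          sum-fixed zero = ≋⇒∼ λ i j → ∑-zeros λ l → refl
          sum-fixed (suc s) = ∼-trans (≋⇒∼ (≋-trans (·-cong {B = lift x} (eval-⊕ A (mono (s ℕ.* p ^ k)) (geometric (p ^ k) s)) ≋-refl) (·-distribʳ (lift x) (pow A (s ℕ.* p ^ k)) (eval A (geometric (p ^ k) s)))))
            (∼-trans (⊞-∼ (fixed s) (sum-fixed s)) (≋⇒∼ λ i j → f (lift x i j) (+ s)))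
            where
            f : ∀ a s → a + s * a ≡ (1ℤ + s) * a
            f = solve-∀

          vanish : lift x ∼ O
          vanish = congruent λ i → subst (+ e i ∣_) (sym (ℤ.+-identityʳ (lift x i zero))) (∣ᵤ⇒∣ (coprime-divisor (coprime i)
            (subst (e i ℕ.∣_) (ℤ.abs-* (+ p) (lift x i zero)) (subst (λ y → e i ℕ.∣ ∣ y ∣) (ℤ.+-identityʳ (+ p * lift x i zero))
              (∣⇒∣ᵤ (entrywise (∼-trans (∼-sym (sum-fixed p)) (≋⇒∼ {w = O} λ i j → trans (·-cong {B = lift x} killed ≋-refl i j) (∑-zeros λ l → refl))) i))))))

  -- Covers both the prime-to-p part and the l-part (l ≠ p) of an integer n = e · k.
  record Parts (p : ℕ) : Set₁ where
    field
      E K : ℕ → Set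
      E-1 : E 1
      E-* : ∀ {a b} → E a → E b → E (a ℕ.* b)
      K-1 : K 1
      K-* : ∀ {a b} → K a → K b → K (a ℕ.* b)
      coprime : ∀ {a b} → E a → K b → Coprime a b
      coprime-p : ∀ {a} → E a → Coprime a p
      split : ∀ n → NonZero n → ∃₂ λ e k → E e × K k × n ≡ e ℕ.* k

    Part : ℕ → ℕ → Set
    Part e n = E e × ∃ λ k → K k × n ≡ e ℕ.* k

    Part-* : ∀ {a b m n} → Part a m → Part b n → Part (a ℕ.* b) (m ℕ.* n)
    Part-* {a} {b} (Ea , k , Kk , refl) (Eb , l , Kl , refl) = E-* Ea Eb , k ℕ.* l , K-* Kk Kl , ℕ.[m*n]*[o*p]≡[m*o]*[n*p] a k b l

    Part-unique : ∀ {a b n} → Part a n → Part b n → a ≡ b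
    Part-unique {a} {b} (Ea , k , Kk , p) (Eb , l , Kl , q) = ℕ.∣-antisym (half Ea Kl p q) (half Eb Kk q p)
      where
      half : ∀ {a b k l n} → E a → K l → n ≡ a ℕ.* k → n ≡ b ℕ.* l → a ℕ.∣ b
      half {a} {b} {k} {l} Ea Kl p q = coprime-divisor (coprime Ea Kl) (subst (a ℕ.∣_) (trans (sym p) (trans q (ℕ.*-comm b l))) (ℕ.m∣m*n k))

  abs-∏ : ∀ {n} (t : Row n) → ∣ ∏ t ∣ ≡ ∏ℕ (λ i → ∣ t i ∣)
  abs-∏ {zero} t = refl
  abs-∏ {suc n} t = trans (ℤ.abs-* (t zero) _) (cong (∣ t zero ∣ ℕ.*_) (abs-∏ (t ∘ suc)))

  ∏ℕ-nonZero : ∀ {n} (e : Fin n → ℕ) → NonZero (∏ℕ e) → ∀ i → NonZero (e i)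
  ∏ℕ-nonZero {suc n} e nz zero = ℕ.m*n≢0⇒m≢0 (e zero) {{nz}}
  ∏ℕ-nonZero {suc n} e nz (suc i) = ∏ℕ-nonZero (e ∘ suc) (ℕ.m*n≢0⇒n≢0 (e zero) {{nz}}) i

  unit-abs : ∀ a b → a * b ≡ 1ℤ → ∣ a ∣ ≡ 1
  unit-abs a b h = ℕ.m*n≡1⇒m≡1 ∣ a ∣ ∣ b ∣ (trans (sym (ℤ.abs-* a b)) (cong ∣_∣ h))

  ∣det∣-inverse : ∀ {n} (U V : Mat n n) → U · V ≋ I → ∣ det U ∣ ≡ 1
  ∣det∣-inverse {n} U V h = unit-abs (det U) (det V) (trans (sym (det-· U V)) (trans (det-cong h) (det-I {n})))

  module _ {r : ℕ} {p : ℕ} (pr : Prime p) (k : ℕ) (parts : Parts p) (X Z : Mat r r) where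
    open Parts parts

    -- Diagonalizing X identifies its cokernel with ∏ ℤ/Dᵢᵢ, on which Z acts as A = U Z U⁻¹. Each
    -- |Dᵢᵢ| is split as eᵢ · kᵢ; the product of the eᵢ is the part of |det X|, and `cardinality`
    -- counts ∏ ℤ/eᵢ.
    part-of-det : X · Z ≋ Z · X → pow Z (p ^ suc k) ≋ I → eval Z (geometric (p ^ k) p) ≋ O →
                  NonZero ∣ det X ∣ → ∀ {e} → Part e ∣ det X ∣ → p ^ suc k ℕ.∣ e ∸ 1
    part-of-det XZ periodic killed nz {e} part with diagonalize X
    ... | D , X~D , diag = subst (λ e → p ^ suc k ℕ.∣ e ∸ 1) (Part-unique (∏-Part es λ i → Ees i , ks i , Kks i , es-ks i) (subst (Part e) ∣det∣≡ part))
            (cardinality es (λ i → ℕ.m*n≢0⇒m≢0 (es i) {{subst NonZero (es-ks i) (D≢0 i)}}) pr k A stable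
              (≋-trans (conjugate (mono (p ^ suc k))) (≋-trans (·-cong {B = U⁻} (≋-trans (·-cong {A = U} ≋-refl periodic) (·-identityʳ U)) ≋-refl) UU⁻))
              (≋-trans (conjugate (geometric (p ^ k) p)) (λ i j → trans (·-cong {B = U⁻} (≋-trans (·-cong {A = U} ≋-refl killed) (λ i j → ∑-zeros λ l → ℤ.*-zeroʳ (U i l))) ≋-refl i j) (∑-zeros λ l → refl)))
              (λ i → coprime-p (Ees i)))
      where
      open _~_ X~D
      A W : Mat r r
      A = U · Z · U⁻
      W = V⁻ · Z · V

      open import Relation.Binary.Reasoning.Setoid (Ring.setoid (matRing r))

      UZ : U · Z ≋ A · U
      UZ = ≋-sym (≋-trans (·-assoc (U · Z) U⁻ U) (≋-trans (·-cong {A = U · Z} ≋-refl U⁻U) (·-identityʳ (U · Z))))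

      conjugate : ∀ as → eval A as ≋ U · eval Z as · U⁻
      conjugate as = ≋-sym (≋-trans (·-cong {B = U⁻} (eval-intertwine Z A U UZ as) ≋-refl)
        (≋-trans (·-assoc (eval A as) U U⁻) (≋-trans (·-cong {A = eval A as} ≋-refl UU⁻) (·-identityʳ (eval A as)))))

      -- Here the commutation of X with Z is used: U Z X V = U X Z V. It makes A preserve the image
      -- of D.
      AD : A · D ≋ D · W
      AD = begin
        A · D ≈⟨ ·-cong {A = A} ≋-refl (≋-trans (≋-sym UXV) (·-assoc U X V)) ⟩
        A · (U · (X · V)) ≈⟨ ≋-sym (·-assoc A U (X · V)) ⟩
        A · U · (X · V) ≈⟨ ·-cong {B = X · V} (≋-sym UZ) ≋-refl ⟩
        U · Z · (X · V) ≈⟨ ≋-trans (≋-sym (·-assoc (U · Z) X V)) (·-cong {B = V} (≋-trans (·-assoc U Z X) (≋-trans (·-cong {A = U} ≋-refl (≋-sym XZ)) (≋-sym (·-assoc U X Z)))) ≋-refl) ⟩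
        U · X · Z · V ≈⟨ ≋-trans (·-assoc (U · X) Z V) (·-cong {B = Z · V} (≋-sym (≋-trans (·-assoc (U · X) V V⁻) (≋-trans (·-cong {A = U · X} ≋-refl VV⁻) (·-identityʳ (U · X))))) ≋-refl) ⟩
        U · X · V · V⁻ · (Z · V) ≈⟨ ≋-trans (·-assoc (U · X · V) V⁻ (Z · V)) (·-cong UXV (≋-sym (·-assoc V⁻ Z V))) ⟩
        D · W ∎

      D-left : ∀ (B : Mat r r) i j → (D · B) i j ≡ D i i * B i j
      D-left B i j = trans (∑-cong λ l → D-I l) (∑-I i (λ l → D i l * B l j))
        where
        D-I : ∀ l → D i l * B l j ≡ I i l * (D i l * B l j)
        D-I l with i Fin.≟ l
        ... | yes refl = sym (trans (cong (_* (D i i * B i j)) (I-diag i)) (ℤ.*-identityˡ _))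
        ... | no p = trans (cong (_* B l j) (diag i l p)) (sym (cong (_* (D i l * B l j)) (I-off i l p)))

      D-right : ∀ (B : Mat r r) i j → (B · D) i j ≡ B i j * D j j
      D-right B i j = trans (∑-cong λ l → D-I l) (∑-I j (λ l → B i l * D l j))
        where
        D-I : ∀ l → B i l * D l j ≡ I j l * (B i l * D l j)
        D-I l with j Fin.≟ l
        ... | yes refl = sym (trans (cong (_* (B i j * D j j)) (I-diag j)) (ℤ.*-identityˡ _))
        ... | no p = trans (cong (B i l *_) (diag l j (p ∘ sym))) (trans (ℤ.*-zeroʳ (B i l)) (sym (cong (_* (B i l * D l j)) (I-off j l p))))

      ∣det∣≡ : ∣ det X ∣ ≡ ∏ℕ λ i → ∣ D i i ∣
      ∣det∣≡ = trans (sym (trans (cong ∣_∣ (trans (sym (det-cong UXV)) (trans (det-· (U · X) V) (cong (_* det V) (det-· U X)))))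
        (trans (ℤ.abs-* (det U * det X) (det V)) (trans (cong₂ ℕ._*_ (trans (ℤ.abs-* (det U) (det X)) (trans (cong (ℕ._* ∣ det X ∣) (∣det∣-inverse U U⁻ UU⁻)) (ℕ.*-identityˡ _))) (∣det∣-inverse V V⁻ VV⁻)) (ℕ.*-identityʳ _)))))
        (trans (cong ∣_∣ (det-diagonal D diag)) (abs-∏ λ i → D i i))

      D≢0 : ∀ i → NonZero ∣ D i i ∣
      D≢0 = ∏ℕ-nonZero (λ i → ∣ D i i ∣) (subst NonZero ∣det∣≡ nz)

      es ks : Fin r → ℕ
      es i = proj₁ (split ∣ D i i ∣ (D≢0 i))
      ks i = proj₁ (proj₂ (split ∣ D i i ∣ (D≢0 i)))
      Ees : ∀ i → E (es i)
      Ees i = proj₁ (proj₂ (proj₂ (split ∣ D i i ∣ (D≢0 i))))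
      Kks : ∀ i → K (ks i)
      Kks i = proj₁ (proj₂ (proj₂ (proj₂ (split ∣ D i i ∣ (D≢0 i)))))
      es-ks : ∀ i → ∣ D i i ∣ ≡ es i ℕ.* ks i
      es-ks i = proj₂ (proj₂ (proj₂ (proj₂ (split ∣ D i i ∣ (D≢0 i)))))

      ∏-Part : ∀ {n} {d : Fin n → ℕ} (e : Fin n → ℕ) → (∀ i → Part (e i) (d i)) → Part (∏ℕ e) (∏ℕ d)
      ∏-Part {zero} e h = E-1 , 1 , K-1 , refl
      ∏-Part {suc n} e h = Part-* (h zero) (∏-Part (e ∘ suc) (h ∘ suc))

      -- An entry of AD = DW reads Aᵢⱼ Dⱼⱼ = Dᵢᵢ Wᵢⱼ, so eᵢ divides Aᵢⱼ eⱼ kⱼ up to sign, and eᵢ is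
      -- coprime to kⱼ.
      stable : ∀ i j → + es i ∣ A i j * + es j
      stable i j = ∣ᵤ⇒∣ (coprime-divisor (coprime (Ees i) (Kks j)) (subst (es i ℕ.∣_) rearranged (ℕ.∣-trans (ℕ.m∣m*n (ks i)) (ℕ.m∣m*n ∣ W i j ∣))))
        where
        rearranged : es i ℕ.* ks i ℕ.* ∣ W i j ∣ ≡ ks j ℕ.* ∣ A i j * + es j ∣
        rearranged = trans (cong (ℕ._* ∣ W i j ∣) (sym (es-ks i))) (trans (sym (ℤ.abs-* (D i i) (W i j))) (trans (cong ∣_∣ (trans (sym (D-left W i j)) (trans (sym (AD i j)) (D-right A i j))))
            (trans (ℤ.abs-* (A i j) (D j j)) (trans (cong (∣ A i j ∣ ℕ.*_) (es-ks j)) (trans (sym (ℕ.*-assoc ∣ A i j ∣ (es j) (ks j))) (trans (ℕ.*-comm (∣ A i j ∣ ℕ.* es j) (ks j)) (cong (ks j ℕ.*_) (sym (ℤ.abs-* (A i j) (+ es j))))))))))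

-- Determinants as norms from the Gaussian integers.

module Gaussian where
  open Sylvester
  open Companion
  open FrobeniusMap

  private
    infixl 6 _⊹_
    infixl 7 _⋆_
    _⊹_ _⋆_ : ℤ × ℤ → ℤ × ℤ → ℤ × ℤ
    (a , b) ⊹ (c , d) = a + c , b + d
    (a , b) ⋆ (c , d) = a * c - b * d , a * d + b * c

    neg conj : ℤ × ℤ → ℤ × ℤ
    neg (a , b) = - a , - b
    conj (a , b) = a , - b

    *-assoc₁ : ∀ a b c d e f → (a * c - b * d) * e - (a * d + b * c) * f ≡ a * (c * e - d * f) - b * (c * f + d * e)
    *-assoc₁ = solve-∀
    *-assoc₂ : ∀ a b c d e f → (a * c - b * d) * f + (a * d + b * c) * e ≡ a * (c * f + d * e) + b * (c * e - d * f)
    *-assoc₂ = solve-∀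
    *-comm₁ : ∀ a b c d → a * c - b * d ≡ c * a - d * b
    *-comm₁ = solve-∀
    *-comm₂ : ∀ a b c d → a * d + b * c ≡ c * b + d * a
    *-comm₂ = solve-∀
    *-identity₁ : ∀ a b → 1ℤ * a - 0ℤ * b ≡ a
    *-identity₁ = solve-∀
    *-identity₂ : ∀ a b → 1ℤ * b + 0ℤ * a ≡ b
    *-identity₂ = solve-∀
    distrib₁ : ∀ a b c d e f → a * (c + e) - b * (d + f) ≡ a * c - b * d + (a * e - b * f)
    distrib₁ = solve-∀
    distrib₂ : ∀ a b c d e f → a * (d + f) + b * (c + e) ≡ a * d + b * c + (a * f + b * e)
    distrib₂ = solve-∀

    ⋆-comm : ∀ x y → x ⋆ y ≡ y ⋆ x
    ⋆-comm (a , b) (c , d) = cong₂ _,_ (*-comm₁ a b c d) (*-comm₂ a b c d)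

    ⋆-identityˡ : ∀ x → (1ℤ , 0ℤ) ⋆ x ≡ x
    ⋆-identityˡ (a , b) = cong₂ _,_ (*-identity₁ a b) (*-identity₂ a b)

    ⋆-distribˡ : ∀ x y z → x ⋆ (y ⊹ z) ≡ x ⋆ y ⊹ x ⋆ z
    ⋆-distribˡ (a , b) (c , d) (e , f) = cong₂ _,_ (distrib₁ a b c d e f) (distrib₂ a b c d e f)

  ℤ[i] : CommutativeRing 0ℓ 0ℓ
  ℤ[i] = record
    { Carrier = ℤ × ℤ ; _≈_ = _≡_ ; _+_ = _⊹_ ; _*_ = _⋆_ ; -_ = neg ; 0# = 0ℤ , 0ℤ ; 1# = 1ℤ , 0ℤ
    ; isCommutativeRing = record
      { isRing = record
        { +-isAbelianGroup = record
          { isGroup = record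
            { isMonoid = record
              { isSemigroup = record
                { isMagma = record { isEquivalence = isEquivalence ; ∙-cong = cong₂ _⊹_ }
                ; assoc = λ x y z → cong₂ _,_ (ℤ.+-assoc (proj₁ x) (proj₁ y) (proj₁ z)) (ℤ.+-assoc (proj₂ x) (proj₂ y) (proj₂ z)) }
              ; identity = (λ x → cong₂ _,_ (ℤ.+-identityˡ (proj₁ x)) (ℤ.+-identityˡ (proj₂ x))) , (λ x → cong₂ _,_ (ℤ.+-identityʳ (proj₁ x)) (ℤ.+-identityʳ (proj₂ x))) }
            ; inverse = (λ x → cong₂ _,_ (ℤ.+-inverseˡ (proj₁ x)) (ℤ.+-inverseˡ (proj₂ x))) , (λ x → cong₂ _,_ (ℤ.+-inverseʳ (proj₁ x)) (ℤ.+-inverseʳ (proj₂ x)))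
            ; ⁻¹-cong = cong neg }
          ; comm = λ x y → cong₂ _,_ (ℤ.+-comm (proj₁ x) (proj₁ y)) (ℤ.+-comm (proj₂ x) (proj₂ y)) }
        ; *-cong = cong₂ _⋆_
        ; *-assoc = λ (a , b) (c , d) (e , f) → cong₂ _,_ (*-assoc₁ a b c d e f) (*-assoc₂ a b c d e f)
        ; *-identity = ⋆-identityˡ , λ x → trans (⋆-comm x _) (⋆-identityˡ x)
        ; distrib = ⋆-distribˡ , λ x y z → trans (⋆-comm (y ⊹ z) x) (trans (⋆-distribˡ x y z) (cong₂ _⊹_ (⋆-comm x y) (⋆-comm x z))) }
      ; *-comm = ⋆-comm } }

  private
    module G where
      open LinAlg ℤ[i] public
      open BlockMatrices ℤ[i] public
      open MatrixPolynomials ℤ[i] public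
      open Homomorphism ℤ.+-*-commutativeRing ℤ[i] public renaming (IsHom to IsHomℤ)
      open Homomorphism ℤ[i] ℤ[i] public

  open Matricesℤ

  private
    ι : ℤ → ℤ × ℤ
    ι a = a , 0ℤ

    ι-hom : G.IsHomℤ ι
    ι-hom = record { +-homo = λ a b → refl ; *-homo = λ a b → cong₂ _,_ (f a b) (g a b) ; -‿homo = λ a → refl ; 0-homo = refl ; 1-homo = refl ; φ-cong = cong ι }
      where
      f : ∀ a b → a * b ≡ a * b - 0ℤ * 0ℤ
      f = solve-∀
      g : ∀ a b → 0ℤ ≡ a * 0ℤ + 0ℤ * b
      g = solve-∀

    conj-hom : G.IsHom conj
    conj-hom = record { +-homo = λ x y → cong₂ _,_ refl (ℤ.neg-distrib-+ (proj₂ x) (proj₂ y)) ; *-homo = λ (a , b) (c , d) → cong₂ _,_ (f a b c d) (g a b c d)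
      ; -‿homo = λ x → refl ; 0-homo = refl ; 1-homo = refl ; φ-cong = cong conj }
      where
      f : ∀ a b c d → a * c - b * d ≡ a * c - - b * - d
      f = solve-∀
      g : ∀ a b c d → - (a * d + b * c) ≡ a * - d + - b * c
      g = solve-∀

  -- [[A, B], [−B, A]] is equivalent over ℤ[i] to a block triangular matrix with diagonal blocks A − iB and A + iB.
  module _ {h : ℕ} (A B : Mat h h) where
    private
      A′ B′ P Q : G.Mat h h
      A′ i j = ι (A i j)
      B′ i j = ι (B i j)
      P i j = A i j , - B i j
      Q i j = A i j , B i j

      𝐢 -𝐢 : ℤ × ℤ
      𝐢 = 0ℤ , 1ℤ
      -𝐢 = 0ℤ , - 1ℤ

      L R M : G.Mat (h ℕ.+ h) (h ℕ.+ h)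
      L = G.blk {h} {h} {h} {h} G.I (𝐢 G.⊙ G.I) G.O G.I
      R = G.blk {h} {h} {h} {h} G.I (-𝐢 G.⊙ G.I) G.O G.I
      M = G.blk A′ B′ (G.⊟ B′) A′

      𝐢-left : ∀ t (X : G.Mat h h) → t G.⊙ G.I G.· X G.≋ t G.⊙ X
      𝐢-left t X i j = trans (G.⊙-· t G.I X i j) (cong (t ⋆_) (G.·-identityˡ X i j))
      𝐢-right : ∀ t (X : G.Mat h h) → X G.· (t G.⊙ G.I) G.≋ t G.⊙ X
      𝐢-right t X i j = trans (G.·-⊙ t X G.I i j) (cong (t ⋆_) (G.·-identityʳ X i j))

      zero-left : ∀ (X : G.Mat h h) i j → (G.O {h} {h} G.· X) i j ≡ (0ℤ , 0ℤ)
      zero-left X i j = G.∑-zeros λ k → CommutativeRing.zeroˡ ℤ[i] (X k j)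
      zero-right : ∀ (X : G.Mat h h) i j → (X G.· G.O {h} {h}) i j ≡ (0ℤ , 0ℤ)
      zero-right X i j = G.∑-zeros λ k → CommutativeRing.zeroʳ ℤ[i] (X i k)

      B+𝐢A : G.Mat h h
      B+𝐢A i j = B i j , A i j

      LM : L G.· M G.≋ G.blk P B+𝐢A (G.⊟ B′) A′
      LM = G.≋-trans (G.blk-· G.I (𝐢 G.⊙ G.I) G.O G.I A′ B′ (G.⊟ B′) A′) (G.blk-cong
        (λ i j → trans (cong₂ _⊹_ (G.·-identityˡ A′ i j) (𝐢-left 𝐢 (G.⊟ B′) i j)) (cong₂ _,_ (f₁ (A i j) (B i j)) (f₂ (A i j) (B i j))))
        (λ i j → trans (cong₂ _⊹_ (G.·-identityˡ B′ i j) (𝐢-left 𝐢 A′ i j)) (cong₂ _,_ (f₃ (A i j) (B i j)) (f₄ (A i j) (B i j))))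
        (λ i j → trans (cong₂ _⊹_ (zero-left A′ i j) (G.·-identityˡ (G.⊟ B′) i j)) (CommutativeRing.+-identityˡ ℤ[i] _))
        (λ i j → trans (cong₂ _⊹_ (zero-left B′ i j) (G.·-identityˡ A′ i j)) (CommutativeRing.+-identityˡ ℤ[i] _)))
        where
        f₁ : ∀ a b → a + (0ℤ * - b - 1ℤ * - 0ℤ) ≡ a
        f₁ = solve-∀
        f₂ : ∀ a b → 0ℤ + (0ℤ * - 0ℤ + 1ℤ * - b) ≡ - b
        f₂ = solve-∀
        f₃ : ∀ a b → b + (0ℤ * a - 1ℤ * 0ℤ) ≡ b
        f₃ = solve-∀
        f₄ : ∀ a b → 0ℤ + (0ℤ * 0ℤ + 1ℤ * a) ≡ a
        f₄ = solve-∀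

      LMR : L G.· M G.· R G.≋ G.blk P G.O (G.⊟ B′) Q
      LMR = G.≋-trans (G.·-cong {B = R} LM G.≋-refl) (G.≋-trans (G.blk-· P B+𝐢A (G.⊟ B′) A′ G.I (-𝐢 G.⊙ G.I) G.O G.I) (G.blk-cong
        (λ i j → trans (cong₂ _⊹_ (G.·-identityʳ P i j) (zero-right B+𝐢A i j)) (CommutativeRing.+-identityʳ ℤ[i] _))
        (λ i j → trans (cong₂ _⊹_ (𝐢-right -𝐢 P i j) (G.·-identityʳ B+𝐢A i j)) (cong₂ _,_ (f₁ (A i j) (B i j)) (f₂ (A i j) (B i j))))
        (λ i j → trans (cong₂ _⊹_ (G.·-identityʳ (G.⊟ B′) i j) (zero-right A′ i j)) (CommutativeRing.+-identityʳ ℤ[i] _))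
        (λ i j → trans (cong₂ _⊹_ (𝐢-right -𝐢 (G.⊟ B′) i j) (G.·-identityʳ A′ i j)) (cong₂ _,_ (f₃ (A i j) (B i j)) (f₄ (A i j) (B i j))))))
        where
        f₁ : ∀ a b → 0ℤ * a - - 1ℤ * - b + b ≡ 0ℤ
        f₁ = solve-∀
        f₂ : ∀ a b → 0ℤ * - b + - 1ℤ * a + a ≡ 0ℤ
        f₂ = solve-∀
        f₃ : ∀ a b → 0ℤ * - b - - 1ℤ * - 0ℤ + a ≡ a
        f₃ = solve-∀
        f₄ : ∀ a b → 0ℤ * - 0ℤ + - 1ℤ * - b + 0ℤ ≡ b
        f₄ = solve-∀

      det-unit : ∀ t → G.det (G.blk {h} {h} {h} {h} G.I (t G.⊙ G.I) G.O G.I) ≡ (1ℤ , 0ℤ)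
      det-unit t = trans (G.det-blk-I-upper h (t G.⊙ G.I) G.I) (G.det-I {h})

    -- The two diagonal blocks are complex conjugates, so the determinant is the norm of det (A +
    -- iB).
    det-complex : ∃₂ λ a b → det (blk A B (⊟ B) A) ≡ a * a + b * b
    det-complex = a , b , cong proj₁ (begin
      ι (det (blk A B (⊟ B) A)) ≡⟨ G.IsHomℤ.det-homo ι-hom (blk A B (⊟ B) A) ⟩
      G.det (λ i j → ι (blk A B (⊟ B) A i j)) ≡⟨ G.det-cong (G.≋-blk A′ B′ (G.⊟ B′) A′
          (λ i j → cong ι (blk-A A B (⊟ B) A i j)) (λ i j → cong ι (blk-B A B (⊟ B) A i j)) (λ i j → cong ι (blk-C A B (⊟ B) A i j)) (λ i j → cong ι (blk-D A B (⊟ B) A i j))) ⟩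
      G.det M ≡⟨ trans (cong (_⋆ G.det M) (det-unit 𝐢)) (⋆-identityˡ (G.det M)) ⟨
      G.det L ⋆ G.det M ≡⟨ G.det-· L M ⟨
      G.det (L G.· M) ≡⟨ trans (cong (G.det (L G.· M) ⋆_) (det-unit -𝐢)) (CommutativeRing.*-identityʳ ℤ[i] _) ⟨
      G.det (L G.· M) ⋆ G.det R ≡⟨ G.det-· (L G.· M) R ⟨
      G.det (L G.· M G.· R) ≡⟨ G.det-cong LMR ⟩
      G.det (G.blk P G.O (G.⊟ B′) Q) ≡⟨ G.det-blk P (G.⊟ B′) Q ⟩
      G.det P ⋆ G.det Q ≡⟨ cong (_⋆ G.det Q) (sym (G.IsHom.det-homo conj-hom Q)) ⟩
      conj (G.det Q) ⋆ G.det Q ≡⟨ cong (_, proj₂ (conj (G.det Q) ⋆ G.det Q)) (f a b) ⟩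
      (a * a + b * b , _) ∎)
      where
      open ≡-Reasoning
      a b : ℤ
      a = proj₁ (G.det Q)
      b = proj₂ (G.det Q)
      f : ∀ a b → a * a - - b * b ≡ a * a + b * b
      f = solve-∀

  -- For Z with Z^(2h) = −1 the matrix Z^h is a complex structure commuting with every polynomial in Z.
  det-sum-of-squares : ∀ h r → r ≡ h ℕ.+ h → (Z : Mat r r) → (∀ j → suc (toℕ j) < r → ∀ c → Z j c ≡ ind (suc (toℕ j)) c) →
                       (∀ i j → pow Z r i j ≡ - I i j) → ∀ as → ∃₂ λ a b → det (eval Z as) ≡ a * a + b * b
  det-sum-of-squares h r refl Z step minus as = let a , b , eq = det-complex A B in a , b , trans (det-cong X≋) eq
    where
    X : Mat (h ℕ.+ h) (h ℕ.+ h)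
    X = eval Z as
    A B : Mat h h
    A i j = X (i ↑ˡ h) (j ↑ˡ h)
    B i j = X (i ↑ˡ h) (h ↑ʳ j)

    pow-row : ∀ k j → toℕ j ℕ.+ k < h ℕ.+ h → ∀ c → pow Z k j c ≡ ind (toℕ j ℕ.+ k) c
    pow-row zero j p c = trans (pow-0 Z j c) (trans (sym (ind-I j c)) (cong (λ x → ind x c) (sym (ℕ.+-identityʳ (toℕ j)))))
    pow-row (suc k) j p c = trans (pow-sucʳ Z k j c) (trans (∑-cong λ l → cong (_* Z l c) (trans (pow-row k j lt l) (cong (λ x → ind x l) (sym here))))
      (trans (∑-ind (fromℕ< lt) (λ l → Z l c)) (trans (step (fromℕ< lt) (subst (λ x → suc x < h ℕ.+ h) (sym here) p′) c) (cong (λ x → ind x c) (trans (cong suc here) (sym (ℕ.+-suc (toℕ j) k)))))))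
      where
      p′ : suc (toℕ j ℕ.+ k) < h ℕ.+ h
      p′ = subst (_< h ℕ.+ h) (ℕ.+-suc (toℕ j) k) p
      lt : toℕ j ℕ.+ k < h ℕ.+ h
      lt = ℕ.<⇒≤ p′
      here : toℕ (fromℕ< lt) ≡ toℕ j ℕ.+ k
      here = Fin.toℕ-fromℕ< lt

    J : Mat (h ℕ.+ h) (h ℕ.+ h)
    J = pow Z h

    -- The shape of the rows of Z makes Z^h shift the upper half onto the lower half; the lower half
    -- then follows from J² = -1. In blocks J is [[0, 1], [-1, 0]].
    J-top : ∀ i c → J (i ↑ˡ h) c ≡ I (h ↑ʳ i) c
    J-top i c = trans (pow-row h (i ↑ˡ h) (subst (λ x → x ℕ.+ h < h ℕ.+ h) (sym (Fin.toℕ-↑ˡ i h)) (ℕ.+-monoˡ-< h (Fin.toℕ<n i))) c)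
      (trans (cong (λ x → ind x c) (trans (cong (ℕ._+ h) (Fin.toℕ-↑ˡ i h)) (trans (ℕ.+-comm (toℕ i) h) (sym (Fin.toℕ-↑ʳ h i))))) (ind-I (h ↑ʳ i) c))

    J-bot : ∀ i c → J (h ↑ʳ i) c ≡ - I (i ↑ˡ h) c
    J-bot i c = trans (sym (∑-I (h ↑ʳ i) (λ l → J l c))) (trans (∑-cong λ l → cong (_* J l c) (sym (J-top i l)))
      (trans (sym (pow-+ Z h h (i ↑ˡ h) c)) (minus (i ↑ˡ h) c)))

    JX-top : ∀ i c → (J · X) (i ↑ˡ h) c ≡ X (h ↑ʳ i) c
    JX-top i c = trans (∑-cong λ l → cong (_* X l c) (J-top i l)) (∑-I (h ↑ʳ i) (λ l → X l c))

    XJ-right : ∀ s l → (X · J) s (h ↑ʳ l) ≡ X s (l ↑ˡ h)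
    XJ-right s l = trans (∑-split h _) (trans (cong₂ _+_
      (trans (∑-cong λ k → trans (cong (X s (k ↑ˡ h) *_) (trans (J-top k (h ↑ʳ l)) (trans (I-↑ʳ h k l) (I-sym k l)))) (ℤ.*-comm (X s (k ↑ˡ h)) (I l k))) (∑-I l (λ k → X s (k ↑ˡ h))))
      (∑-zeros λ k → trans (cong (X s (h ↑ʳ k) *_) (trans (J-bot k (h ↑ʳ l)) (cong -_ (I-off (k ↑ˡ h) (h ↑ʳ l) (↑ˡ≢↑ʳ h))))) (ℤ.*-zeroʳ (X s (h ↑ʳ k)))))
      (ℤ.+-identityʳ _))

    XJ-left : ∀ s l → (X · J) s (l ↑ˡ h) ≡ - X s (h ↑ʳ l)
    XJ-left s l = trans (∑-split h _) (trans (cong₂ _+_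
      (∑-zeros λ k → trans (cong (X s (k ↑ˡ h) *_) (trans (J-top k (l ↑ˡ h)) (I-off (h ↑ʳ k) (l ↑ˡ h) (λ e → ↑ˡ≢↑ʳ h (sym e))))) (ℤ.*-zeroʳ (X s (k ↑ˡ h))))
      (trans (∑-cong λ k → trans (cong (X s (h ↑ʳ k) *_) (trans (J-bot k (l ↑ˡ h)) (cong -_ (trans (I-↑ˡ k l) (I-sym k l))))) (f (X s (h ↑ʳ k)) (I l k))) (∑-I l (λ k → - X s (h ↑ʳ k)))))
      (ℤ.+-identityˡ _))
      where
      f : ∀ x e → x * - e ≡ e * - x
      f = solve-∀

    commute : X · J ≋ J · X
    commute = ≋-sym (eval-intertwine Z Z J (≋-sym (eval-comm Z (mono h))) as)

    -- Left multiplication by J moves the lower rows of X to the top and right multiplication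
    -- permutes its columns up to sign. Equality of the two determines the lower blocks from the
    -- upper ones.
    X≋ : X ≋ blk A B (⊟ B) A
    X≋ = ≋-blk A B (⊟ B) A (λ i j → refl) (λ i j → refl)
      (λ i j → trans (sym (JX-top i (j ↑ˡ h))) (trans (sym (commute (i ↑ˡ h) (j ↑ˡ h))) (XJ-left (i ↑ˡ h) j)))
      (λ i j → trans (sym (JX-top i (h ↑ʳ j))) (trans (sym (commute (i ↑ˡ h) (h ↑ʳ j))) (XJ-right (i ↑ˡ h) j)))

open Sylvester
open Companion
open ModP
open Counting
open Gaussian
open import Data.Integer.Divisibility using (_∣_)
import Data.Integer.Divisibility.Signed as S
open S using (∣ᵤ⇒∣; ∣⇒∣ᵤ)

open Matricesℤ

-- Prime valuations, parts of integers and p-adic limits.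

prime≢1 : ∀ {p} → Prime p → p ≢ 1
prime≢1 pr refl = ℕ.<-irrefl refl (ℕ.nonTrivial⇒n>1 1 {{prime⇒nonTrivial pr}})

prime∤⇒coprime : ∀ {p e} → Prime p → ¬ (p ℕ.∣ e) → Coprime e p
prime∤⇒coprime pr p∤e (d∣e , d∣p) with prime⇒irreducible pr d∣p
... | inj₁ d≡1 = d≡1
... | inj₂ refl = contradiction d∣e p∤e

prime∤⇒coprime-^ : ∀ {p e} → Prime p → ¬ (p ℕ.∣ e) → ∀ s → Coprime e (p ^ s)
prime∤⇒coprime-^ pr p∤e zero (_ , d∣1) = ℕ.∣1⇒≡1 d∣1
prime∤⇒coprime-^ {p} pr p∤e (suc s) (d∣e , d∣) = prime∤⇒coprime-^ pr p∤e s
  (d∣e , coprime-divisor (λ (c∣d , c∣p) → prime∤⇒coprime pr p∤e (ℕ.∣-trans c∣d d∣e , c∣p)) d∣)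

prime∤* : ∀ {p a b} → Prime p → ¬ (p ℕ.∣ a) → ¬ (p ℕ.∣ b) → ¬ (p ℕ.∣ a ℕ.* b)
prime∤* {p} {a} {b} pr p∤a p∤b d = [ p∤a , p∤b ]′ (euclidsLemma a b pr d)

prime∤1 : ∀ {p} → Prime p → ¬ (p ℕ.∣ 1)
prime∤1 pr d = prime≢1 pr (ℕ.∣1⇒≡1 d)

valuation : ∀ {p} → Prime p → ∀ n → NonZero n → ∃₂ λ e s → ¬ (p ℕ.∣ e) × n ≡ e ℕ.* p ^ s
valuation {p} pr n nz = go n nz (<-wellFounded n)
  where
  go : ∀ n → NonZero n → Acc _<_ n → ∃₂ λ e s → ¬ (p ℕ.∣ e) × n ≡ e ℕ.* p ^ s
  go n nz (acc rs) with p ℕ.∣? n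
  ... | no p∤n = n , 0 , p∤n , sym (ℕ.*-identityʳ n)
  ... | yes (ℕ.divides c refl) =
    let nzc = ℕ.m*n≢0⇒m≢0 c {{nz}}
        e , s , p∤e , eq = go c nzc (rs (ℕ.m<m*n c p {{nzc}} (ℕ.nonTrivial⇒n>1 p {{prime⇒nonTrivial pr}})))
    in e , suc s , p∤e , trans (cong (ℕ._* p) eq) (trans (ℕ.*-assoc e (p ^ s) p) (cong (e ℕ.*_) (ℕ.*-comm (p ^ s) p)))

valuation-ℤ : ∀ {p} → Prime p → ∀ x → NonZero ∣ x ∣ → ∃₂ λ u s → ¬ (+ p ∣ u) × x ≡ u * + (p ^ s)
valuation-ℤ pr (+ n) nz = let e , s , p∤e , eq = valuation pr n nz in + e , s , p∤e , trans (cong +_ eq) (ℤ.pos-* e _)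
valuation-ℤ {p} pr -[1+ n ] nz = let e , s , p∤e , eq = valuation pr (suc n) nz in
  - + e , s , subst (λ x → ¬ (p ℕ.∣ x)) (sym (ℤ.∣-i∣≡∣i∣ (+ e))) p∤e , trans (cong (-_ ∘ +_) eq) (trans (cong -_ (ℤ.pos-* e (p ^ s))) (ℤ.neg-distribˡ-* (+ e) (+ (p ^ s))))

nonPPart-unique : ∀ {p} → Prime p → ∀ r s {m m′} → ¬ (+ p ∣ m) → ¬ (+ p ∣ m′) → m * + (p ^ r) ≡ m′ * + (p ^ s) → m ≡ m′
nonPPart-unique pr zero zero {m} {m′} h h′ eq = trans (sym (ℤ.*-identityʳ m)) (trans eq (ℤ.*-identityʳ m′))
nonPPart-unique {p} pr zero (suc s) {m} {m′} h h′ eq = contradiction (subst (+ p ∣_) (trans (sym eq) (ℤ.*-identityʳ m)) (subst (p ℕ.∣_) (sym (ℤ.abs-* m′ (+ (p ^ suc s)))) (ℕ.∣n⇒∣m*n ∣ m′ ∣ (ℕ.m∣m*n (p ^ s))))) h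
nonPPart-unique {p} pr (suc r) zero {m} {m′} h h′ eq = contradiction (subst (+ p ∣_) (trans eq (ℤ.*-identityʳ m′)) (subst (p ℕ.∣_) (sym (ℤ.abs-* m (+ (p ^ suc r)))) (ℕ.∣n⇒∣m*n ∣ m ∣ (ℕ.m∣m*n (p ^ r))))) h′
nonPPart-unique {p} pr (suc r) (suc s) {m} {m′} h h′ eq = nonPPart-unique pr r s h h′
  (ℤ.*-cancelʳ-≡ (m * + (p ^ r)) (m′ * + (p ^ s)) (+ p) {{prime⇒nonZero pr}} (trans (shuffle m r) (trans eq (sym (shuffle m′ s)))))
  where
  shuffle : ∀ m r → m * + (p ^ r) * + p ≡ m * + (p ^ suc r)
  shuffle m r = trans (ℤ.*-assoc m (+ (p ^ r)) (+ p)) (cong (m *_) (trans (ℤ.*-comm (+ (p ^ r)) (+ p)) (sym (ℤ.pos-* p (p ^ r)))))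

prime-to : ∀ {p} → Prime p → Parts p
prime-to {p} pr = record
  { E = λ e → ¬ (p ℕ.∣ e) ; K = λ k → ∃ λ s → k ≡ p ^ s
  ; E-1 = prime∤1 pr ; E-* = prime∤* pr
  ; K-1 = 0 , refl ; K-* = λ { (r , refl) (s , refl) → r ℕ.+ s , sym (ℕ.^-distribˡ-+-* p r s) }
  ; coprime = λ { h (s , refl) → prime∤⇒coprime-^ pr h s }
  ; coprime-p = prime∤⇒coprime pr
  ; split = λ n nz → let e , s , h , eq = valuation pr n nz in e , p ^ s , h , (s , refl) , eq }

prime-powers : ∀ {p l} → Prime p → Prime l → l ≢ p → Parts p
prime-powers {p} {l} pr prl l≢p = record
  { E = λ e → ∃ λ s → e ≡ l ^ s ; K = λ k → ¬ (l ℕ.∣ k)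
  ; E-1 = 0 , refl ; E-* = λ { (r , refl) (s , refl) → r ℕ.+ s , sym (ℕ.^-distribˡ-+-* l r s) }
  ; K-1 = prime∤1 prl ; K-* = prime∤* prl
  ; coprime = λ { (s , refl) h → coprime-sym (prime∤⇒coprime-^ prl h s) }
  ; coprime-p = λ { (s , refl) → coprime-sym (prime∤⇒coprime-^ prl l∤p s) }
  ; split = λ n nz → let k , s , h , eq = valuation prl n nz in l ^ s , k , (s , refl) , h , trans eq (ℕ.*-comm k (l ^ s)) }
  where
  l∤p : ¬ (l ℕ.∣ p)
  l∤p d = [ prime≢1 prl , l≢p ]′ (prime⇒irreducible pr d)

∣∸1⇒∣-1 : ∀ {d} e → NonZero e → d ℕ.∣ e ∸ 1 → + d ∣ + e - 1ℤ
∣∸1⇒∣-1 {d} (suc e) _ h = subst (d ℕ.∣_) (cong ∣_∣ (sym (ℤ.⊖-≥ {suc e} {1} (s≤s z≤n)))) h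

∣-step : ∀ {d} a b → + d ∣ b - 1ℤ → + d ∣ a * b - a
∣-step {d} a b h = ∣⇒∣ᵤ (subst (+ d S.∣_) (f a b) (S.∣n⇒∣m*n a (∣ᵤ⇒∣ h)))
  where
  f : ∀ a b → a * (b - 1ℤ) ≡ a * b - a
  f = solve-∀

-- The step from a 0 to a 1 is left out because for p = 2 the norm at level 0 may be negative.
module _ (p : ℕ) (a : ℕ → ℤ) (step : ∀ k → + (p ^ suc (suc k)) ∣ a (suc (suc k)) - a (suc k)) where
  private
    ∣-^ : ∀ k j x → + (p ^ (j ℕ.+ k)) ∣ x → + (p ^ k) ∣ x
    ∣-^ k j x h = ℕ.∣-trans (subst (p ^ k ℕ.∣_) (sym (ℕ.^-distribˡ-+-* p j k)) (ℕ.n∣m*n (p ^ j))) h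

    far : ∀ k j → + (p ^ k) ∣ a (j ℕ.+ suc k) - a (suc k)
    far k zero = subst (λ x → p ^ k ℕ.∣ ∣ x ∣) (sym (ℤ.+-inverseʳ (a (suc k)))) (ℕ._∣0 (p ^ k))
    far k (suc j) = ∣⇒∣ᵤ (subst (+ (p ^ k) S.∣_) (f (a (suc j ℕ.+ suc k)) (a (j ℕ.+ suc k)) (a (suc k)))
      (S.∣m∣n⇒∣m+n {m = a (suc j ℕ.+ suc k) - a (j ℕ.+ suc k)} {a (j ℕ.+ suc k) - a (suc k)}
        (∣ᵤ⇒∣ (subst (λ i → + (p ^ k) ∣ a (suc i) - a i) (sym (ℕ.+-suc j k)) (∣-^ k (suc (suc j)) (a (suc (suc (j ℕ.+ k))) - a (suc (j ℕ.+ k))) (step (j ℕ.+ k))))) (∣ᵤ⇒∣ (far k j))))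
      where
      f : ∀ x y z → x - y + (y - z) ≡ x - z
      f = solve-∀

  limit : ℤp p
  limit = record { approx = a ∘ suc ; coherent = λ k → ∣-^ k 2 (a (suc (suc k)) - a (suc k)) (step k) }

  converges : ConvergesTo p a limit
  converges k = suc k , λ n k<n → subst (λ i → + (p ^ k) ∣ a i - a (suc k)) (ℕ.m∸n+n≡m k<n) (far k (n ∸ suc k))

  -- The approximation of the limit modulo p^1 is `a 2`, on account of the shift of index in
  -- `limit`.
  limit-nonzero : ¬ (+ p ∣ a 2) → ¬ IsZeroℤp p limit
  limit-nonzero h z = h (subst (λ x → + x ∣ a 2) (ℕ.*-identityʳ p) (z 1))

constant : (p : ℕ) → ℤ → ℤp p
constant p x = record { approx = λ _ → x ; coherent = λ k → subst (λ y → p ^ k ℕ.∣ ∣ y ∣) (sym (ℤ.+-inverseʳ x)) (ℕ._∣0 (p ^ k)) }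

converges-zero : ∀ p a → (∀ k → + (p ^ k) ∣ a k) → ConvergesTo p a (constant p 0ℤ)
converges-zero p a h k = k , λ n k≤n → subst (λ x → p ^ k ℕ.∣ ∣ x ∣) (sym (ℤ.+-identityʳ (a n)))
  (ℕ.∣-trans (subst (λ x → p ^ k ℕ.∣ p ^ x) (ℕ.m∸n+n≡m k≤n) (subst (p ^ k ℕ.∣_) (sym (ℕ.^-distribˡ-+-* p (n ∸ k) k)) (ℕ.n∣m*n (p ^ (n ∸ k))))) (h n))

zero-constant : ∀ p → IsZeroℤp p (constant p 0ℤ)
zero-constant p k = ℕ._∣0 (p ^ k)

-- The tower of resultants and norms, and the convergence statements.

module Tower (p′ : ℕ) (pr : Prime (suc p′)) where
  p : ℕ
  p = suc p′

  open Modular p using (_≈_; mod; ≈-sym; ≈-trans; ≡⇒≈) renaming (difference to ≈⇒∣)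

  instance
    p′≢0 : NonZero p′
    p′≢0 = ℕ.≢-nonZero λ { refl → prime≢1 pr refl }

  p^k≢0 : ∀ k → NonZero (p ^ k)
  p^k≢0 k = ℕ.m^n≢0 p k

  module Z k = Cyclotomic (p ^ k) p′ {{p^k≢0 k}}

  shift : ∀ k → Mat (p ^ k) (p ^ k)
  shift k = Cyclic.cyc (p ^ k) {{p^k≢0 k}}

  -- R k f = Res(t^(p^k) − 1, f) and N k f is the norm of f(ζ) for ζ of order p^(k+1).
  opaque
    R N : ℕ → List ℤ → ℤ
    R k as = det (eval (shift k) as)
    N k as = det (eval (Z.Z k) as)

    R≡det : ∀ k as → R k as ≡ det (eval (shift k) as)
    R≡det k as = refl

    N≡det : ∀ k as → N k as ≡ det (eval (Z.Z k) as)
    N≡det k as = refl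

    R-suc : ∀ k as → R (suc k) as ≡ R k as * N k as
    R-suc k as = Z.det-cyc-factor k as

  R-zero : ∀ as → R 0 as ≡ value₁ as
  R-zero as = trans (R≡det 0 as) (trans (det-row₀ (eval (Cyclic.cyc 1) as) λ ()) (trans (ℤ.*-identityʳ _) (entry as zero)))
    where
    Fin1 : ∀ (i : Fin 1) → i ≡ zero
    Fin1 zero = refl
    entry : ∀ as i → eval (Cyclic.cyc 1) as i zero ≡ value₁ as
    entry [] i = refl
    entry (a ∷ as) i = cong₂ _+_ (trans (cong (λ i → a * I i zero) (Fin1 i)) (ℤ.*-identityʳ a)) (trans (Cyclic.cyc-· 1 (eval (Cyclic.cyc 1) as) i zero) (entry as _))

  ≈0⇒∣ : ∀ {x} → x ≈ 0ℤ → + p ∣ x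
  ≈0⇒∣ {x} h = subst (+ p ∣_) (ℤ.+-identityʳ x) (∣⇒∣ᵤ (≈⇒∣ h))

  ∣⇒≈0 : ∀ {x} → + p ∣ x → x ≈ 0ℤ
  ∣⇒≈0 {x} h = mod (∣ᵤ⇒∣ (subst (+ p ∣_) (sym (ℤ.+-identityʳ x)) h))

  N-unit : ∀ k as → ¬ (+ p ∣ value₁ as) → N k as ≈ 1ℤ
  N-unit k as h = ≈-trans (≡⇒≈ (N≡det k as)) (det-mod-p pr (p ^ k) p′ refl (Z.Z k) (suc k) (Z.pow-n k) as (h ∘ ≈0⇒∣))

  1≉0 : ¬ (1ℤ ≈ 0ℤ)
  1≉0 h = prime∤1 pr (≈0⇒∣ h)

  N-unit-∤ : ∀ k as → ¬ (+ p ∣ value₁ as) → ¬ (+ p ∣ N k as)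
  N-unit-∤ k as h d = 1≉0 (≈-trans (≈-sym (N-unit k as h)) (∣⇒≈0 {N k as} d))

  -- Both f(1) ≡ 0 and p = Φ(1) are multiples of 1 − t modulo Φ, and 1 − t has norm p.
  N-divide : ∀ k as → + p ∣ value₁ as → ∃ λ bs → N k as ≡ + p * N k bs
  N-divide k as d with ∣ᵤ⇒∣ d
  ... | S.divides c v≡ = bs , trans (N≡det k as) (trans (det-cong factored) (trans (det-· I-Z (eval Y bs)) (cong₂ _*_ (Z.det-I-Z k) (sym (N≡det k bs)))))
    where
    Y = Z.Z k
    I-Z = Z.I-Z k
    Φ = Z.Φ k
    H = quotient₁ Φ
    Q = quotient₁ as
    -- With f(1) = c · p one has f = c · p - (1 - t) Q, and Φ = p - (1 - t) H vanishes at Z. Hence f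
    -- = (1 - t)(c H - Q) at Z.
    bs = map (c *_) H ⊕ map (-1ℤ *_) Q

    ∸I≋ : ∀ i j → ∸I Y i j ≡ - I-Z i j
    ∸I≋ i j = f (Y i j) (I i j)
      where
      f : ∀ y e → y + -1ℤ * e ≡ - (e + - y)
      f = solve-∀

    ∸I-· : ∀ (B : Mat (p′ ℕ.* p ^ k) (p′ ℕ.* p ^ k)) i j → (∸I Y · B) i j ≡ - (I-Z · B) i j
    ∸I-· B i j = trans (∑-cong λ l → trans (cong (_* B l j) (∸I≋ i l)) (f (I-Z i l) (B l j))) (trans (sym (*-∑ -1ℤ _)) (ℤ.-1*i≡-i _))
      where
      f : ∀ x b → - x * b ≡ -1ℤ * (x * b)
      f = solve-∀

    pI : ∀ i j → + p * I i j ≡ (I-Z · eval Y H) i j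
    pI i j = trans (cong (_* I i j) (sym (value₁-geometric (p ^ k) p))) (g (value₁ Φ * I i j) _ (trans (sym (cong (_+_ (value₁ Φ * I i j)) (∸I-· (eval Y H) i j))) (trans (sym (eval-quotient₁ Y Φ i j)) (Z.Φ-Z k i j))))
      where
      g : ∀ x y → x - y ≡ 0ℤ → x ≡ y
      g x y h = trans (f x y) (trans (cong (_+ y) h) (ℤ.+-identityˡ y))
        where
        f : ∀ x y → x ≡ x - y + y
        f = solve-∀

    factored : eval Y as ≋ I-Z · eval Y bs
    factored i j = begin
      eval Y as i j ≡⟨ trans (eval-quotient₁ Y as i j) (cong (λ v → v * I i j + (∸I Y · eval Y Q) i j) {value₁ as} v≡) ⟩
      c * + p * I i j + (∸I Y · eval Y Q) i j ≡⟨ cong₂ _+_ (trans (ℤ.*-assoc c (+ p) (I i j)) (cong (c *_) (pI i j))) (trans (∸I-· (eval Y Q) i j) (sym (ℤ.-1*i≡-i ((I-Z · eval Y Q) i j)))) ⟩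
      c * (I-Z · eval Y H) i j + -1ℤ * (I-Z · eval Y Q) i j ≡⟨ cong₂ _+_ (·-⊙ c I-Z (eval Y H) i j) (·-⊙ -1ℤ I-Z (eval Y Q) i j) ⟨
      (I-Z · (c ⊙ eval Y H)) i j + (I-Z · (-1ℤ ⊙ eval Y Q)) i j ≡⟨ ·-distribˡ I-Z (c ⊙ eval Y H) (-1ℤ ⊙ eval Y Q) i j ⟨
      (I-Z · (c ⊙ eval Y H ⊞ -1ℤ ⊙ eval Y Q)) i j ≡⟨ ·-cong {A = I-Z} ≋-refl (λ i j → sym (trans (eval-⊕ Y (map (c *_) H) (map (-1ℤ *_) Q) i j) (cong₂ _+_ (eval-map Y c H i j) (eval-map Y -1ℤ Q i j)))) i j ⟩
      (I-Z · eval Y bs) i j ∎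
      where open ≡-Reasoning

  N-∣ : ∀ k as → + p ∣ value₁ as → + p ∣ N k as
  N-∣ k as d = let bs , eq = N-divide k as d in subst (p ℕ.∣_) (trans (sym (ℤ.abs-* (+ p) (N k bs))) (cong ∣_∣ (sym eq))) (ℕ.m∣m*n ∣ N k bs ∣)

  N-part : ∀ (parts : Parts p) k as → NonZero ∣ N k as ∣ → ∀ {e} → Parts.Part parts e ∣ N k as ∣ → p ^ suc k ℕ.∣ e ∸ 1
  N-part parts k as nz {e} part = part-of-det pr k parts (eval (Z.Z k) as) (Z.Z k) (≋-sym (eval-comm (Z.Z k) as)) (Z.pow-n k) (Z.Φ-Z k)
    (subst (λ x → NonZero ∣ x ∣) (N≡det k as) nz) (subst (λ x → Parts.Part parts e ∣ x ∣) (N≡det k as) part)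

  -- The witness `e` is the part of the norm |N k|: parts multiply and are unique, so it must be the
  -- quotient of the two given parts.
  part-suc : ∀ (parts : Parts p) k as → R (suc k) as ≢ 0ℤ → ∀ {a b} → Parts.Part parts a ∣ R k as ∣ → Parts.Part parts b ∣ R (suc k) as ∣ →
             ∃ λ e → NonZero e × b ≡ a ℕ.* e × p ^ suc k ℕ.∣ e ∸ 1
  part-suc parts k as R≢0 {a} Pa Pb =
    let e , l , Ee , Kl , eq = Parts.split parts ∣ N k as ∣ N≢0
    in e , ℕ.m*n≢0⇒m≢0 e {{subst NonZero eq N≢0}}
     , Parts.Part-unique parts Pb (subst (Parts.Part parts (a ℕ.* e)) R≡ (Parts.Part-* parts Pa (Ee , l , Kl , eq)))
     , N-part parts k as N≢0 (Ee , l , Kl , eq)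
    where
    N≢0 : NonZero ∣ N k as ∣
    N≢0 = ℤ.≢-nonZero λ e → R≢0 (trans (R-suc k as) (trans (cong (R k as *_) e) (ℤ.*-zeroʳ (R k as))))
    R≡ : ∣ R k as ∣ ℕ.* ∣ N k as ∣ ≡ ∣ R (suc k) as ∣
    R≡ = trans (sym (ℤ.abs-* (R k as) (N k as))) (cong ∣_∣ (sym (R-suc k as)))

  Nonneg : ℤ → Set
  Nonneg u = u ≡ + ∣ u ∣

  sign? : ∀ u → Nonneg u ⊎ u ≡ - (+ ∣ u ∣)
  sign? (+ n) = inj₁ refl
  sign? -[1+ n ] = inj₂ refl

  pos^ : ∀ s → + (p ^ suc s) ≡ + p * + (p ^ s)
  pos^ s = ℤ.pos-* p (p ^ s)

  -- Induction on `v`. As long as p divides f(1), splitting off a factor 1 - Z removes one p from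
  -- the norm and keeps `u`; once p does not divide f(1), the norm is ≡ 1 mod p, which forces v = 0.
  unit-part : ∀ k v as u → ¬ (+ p ∣ u) → N k as ≡ u * + (p ^ v) → u ≈ 1ℤ
  unit-part k v as u p∤u eq with p ℕ.∣? ∣ value₁ as ∣
  unit-part k zero as u p∤u eq | no p∤1 = ≈-trans (≡⇒≈ (sym (trans eq (ℤ.*-identityʳ u)))) (N-unit k as p∤1)
  unit-part k (suc v) as u p∤u eq | no p∤1 = contradiction (subst (+ p ∣_) (sym eq) (subst (p ℕ.∣_) (sym (ℤ.abs-* u (+ (p ^ suc v)))) (ℕ.∣n⇒∣m*n ∣ u ∣ (ℕ.m∣m*n (p ^ v))))) (N-unit-∤ k as p∤1)
  unit-part k zero as u p∤u eq | yes p∣1 = contradiction (subst (+ p ∣_) (trans eq (ℤ.*-identityʳ u)) (N-∣ k as p∣1)) p∤u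
  unit-part k (suc v) as u p∤u eq | yes p∣1 = let bs , eq′ = N-divide k as p∣1 in
    unit-part k v bs u p∤u (ℤ.*-cancelˡ-≡ (+ p) (N k bs) (u * + (p ^ v)) (trans (sym eq′) (trans eq (trans (cong (u *_) (pos^ v)) (f u (+ p) (+ (p ^ v)))))))
    where
    f : ∀ u p x → u * (p * x) ≡ p * (u * x)
    f = solve-∀

  -- If u = -|u|, then adding the two congruences gives 0 ≡ 2 mod p.
  odd-sign : 2 < p → ∀ u → u ≈ 1ℤ → + ∣ u ∣ ≈ 1ℤ → Nonneg u
  odd-sign 2<p u h h′ with sign? u
  ... | inj₁ nn = nn
  ... | inj₂ neg = contradiction (ℕ.∣⇒≤ (≈0⇒∣ {+ 2} (mod (subst (+ p S.∣_) (trans (f u (+ ∣ u ∣)) (trans (cong (λ x → + 2 - (x + + ∣ u ∣)) neg) (g (+ ∣ u ∣)))) (S.∣m⇒∣-m (S.∣m∣n⇒∣m+n (≈⇒∣ h) (≈⇒∣ h′))))))) (ℕ.<⇒≱ 2<p)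
    where
    f : ∀ u v → - (u - 1ℤ + (v - 1ℤ)) ≡ + 2 - (u + v)
    f = solve-∀
    g : ∀ v → + 2 - (- v + v) ≡ + 2 - 0ℤ
    g = solve-∀

  square-nonneg : ∀ a → ∃ λ n → a * a ≡ + n
  square-nonneg (+ n) = n ℕ.* n , sym (ℤ.pos-* n n)
  square-nonneg -[1+ n ] = suc n ℕ.* suc n , refl

  even-sign : p ≡ 2 → ∀ k v as u → N (suc k) as ≡ u * + (p ^ v) → Nonneg u
  even-sign refl k v as u eq with det-sum-of-squares (p ^ k) (p′ ℕ.* p ^ suc k) (trans (ℕ.+-identityʳ _) (cong (p ^ k ℕ.+_) (ℕ.+-identityʳ _))) (Z.Z (suc k)) (Z.Z-step (suc k)) minus as
    where
    -- For p = 2 the polynomial Φ is 1 + t^r, so Φ(Z) = 0 reads Z^r = -1. At level k + 1 the size r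
    -- = 2^(k+1) splits into two halves 2^k; at level 0 it is 1.
    minus : ∀ i j → pow (Z.Z (suc k)) (p′ ℕ.* p ^ suc k) i j ≡ - I i j
    minus i j = f (pow (Z.Z (suc k)) (p′ ℕ.* p ^ suc k) i j) (I i j) (trans (cong (_+_ (pow (Z.Z (suc k)) (p′ ℕ.* p ^ suc k) i j)) (sym (pow-0 (Z.Z (suc k)) i j)))
      (trans (sym (eval-⊕ (Z.Z (suc k)) (mono (p′ ℕ.* p ^ suc k)) (mono 0) i j)) (Z.Φ-Z (suc k) i j)))
      where
      f : ∀ x y → x + y ≡ 0ℤ → x ≡ - y
      f x y h = trans (g x y) (trans (cong (_- y) h) (ℤ.+-identityˡ (- y)))
        where
        g : ∀ x y → x ≡ x + y - y
        g = solve-∀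
  ... | a , b , sq = let m , a² = square-nonneg a ; n , b² = square-nonneg b in nonneg u (m ℕ.+ n) (trans (sym eq) (trans (N≡det (suc k) as) (trans sq (cong₂ _+_ a² b²))))
    where
    nonneg : ∀ u n → u * + (p ^ v) ≡ + n → Nonneg u
    nonneg (+ u) n h = refl
    nonneg -[1+ u ] n h with p ^ v | p^k≢0 v
    nonneg -[1+ u ] n () | suc x | _

  -- The orbit count gives the congruence for |u|; it carries over to `u` once `u` is known to be
  -- nonnegative, by a congruence for odd p and by sums of squares for p = 2.
  nonPPart-N : ∀ k as u v → ¬ (+ p ∣ u) → N (suc k) as ≡ u * + (p ^ v) → + (p ^ suc (suc k)) ∣ u - 1ℤ
  nonPPart-N k as u v p∤u eq = subst (λ x → + (p ^ suc (suc k)) ∣ x - 1ℤ) (sym nonneg) abs≡1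
    where
    u≢0 : NonZero ∣ u ∣
    u≢0 = ℕ.≢-nonZero λ e → p∤u (subst (p ℕ.∣_) (sym e) (ℕ._∣0 p))
    N≡ : ∣ N (suc k) as ∣ ≡ ∣ u ∣ ℕ.* p ^ v
    N≡ = trans (cong ∣_∣ eq) (ℤ.abs-* u (+ (p ^ v)))
    abs≡1 : + (p ^ suc (suc k)) ∣ + ∣ u ∣ - 1ℤ
    abs≡1 = ∣∸1⇒∣-1 ∣ u ∣ u≢0 (N-part (prime-to pr) (suc k) as (subst NonZero (sym N≡) (ℕ.m*n≢0 ∣ u ∣ (p ^ v) {{u≢0}} {{p^k≢0 v}})) (p∤u , p ^ v , (v , refl) , N≡))
    nonneg : Nonneg u
    nonneg with 2 ℕ.<? p
    ... | yes 2<p = odd-sign 2<p u (unit-part (suc k) v as u p∤u eq) (mod (∣ᵤ⇒∣ (ℕ.∣-trans (ℕ.m∣m*n (p ^ suc k)) abs≡1)))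
    ... | no 2≮p = even-sign (ℕ.≤-antisym (ℕ.≮⇒≥ 2≮p) (ℕ.nonTrivial⇒n>1 p {{prime⇒nonTrivial pr}})) k v as u eq

  R-unit : ∀ as → ¬ (+ p ∣ value₁ as) → ∀ k → ¬ (+ p ∣ R k as)
  R-unit as h zero = subst (λ x → ¬ (+ p ∣ x)) (sym (R-zero as)) h
  R-unit as h (suc k) d = prime∤* pr (R-unit as h k) (N-unit-∤ k as h) (subst (p ℕ.∣_) (trans (cong ∣_∣ (R-suc k as)) (ℤ.abs-* (R k as) (N k as))) d)

  R-∣ : ∀ as → + p ∣ value₁ as → ∀ k → + (p ^ suc k) ∣ R k as
  R-∣ as h zero = subst₂ (λ m x → + m ∣ x) (sym (ℕ.*-identityʳ p)) (sym (R-zero as)) h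
  R-∣ as h (suc k) = subst₂ ℕ._∣_ (ℕ.*-comm (p ^ suc k) p) (trans (sym (ℤ.abs-* (R k as) (N k as))) (cong ∣_∣ (sym (R-suc k as)))) (ℕ.*-pres-∣ (R-∣ as h k) (N-∣ k as h))

  module _ (as : List ℤ) (a : ℕ → ℤ) (a≡R : ∀ k → a k ≡ R k as) where
    private
      ∣-^ : ∀ k {x} → + (p ^ suc k) ∣ x → + (p ^ k) ∣ x
      ∣-^ k = ℕ.∣-trans (ℕ.n∣m*n p)

    resultants-converge : Σ (ℤp p) λ L → ConvergesTo p a L × (IsZeroℤp p L ⇔ (+ p ∣ value₁ as))
    resultants-converge with p ℕ.∣? ∣ value₁ as ∣
    ... | yes d = constant p 0ℤ , converges-zero p a (λ k → subst (+ (p ^ k) ∣_) (sym (a≡R k)) (∣-^ k {R k as} (R-∣ as d k))) , mk⇔ (λ _ → d) (λ _ → zero-constant p)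
    ... | no ¬d = limit p a step , converges p a step , mk⇔ (λ z → contradiction z (limit-nonzero p a step (subst (λ x → ¬ (+ p ∣ x)) (sym (a≡R 2)) (R-unit as ¬d 2)))) (λ d → contradiction d ¬d)
      where
      step : ∀ k → + (p ^ suc (suc k)) ∣ a (suc (suc k)) - a (suc k)
      -- In this case the norm is prime to p, hence its own non-p part with exponent 0, and the
      -- difference of consecutive resultants is R (k + 1) · (N (k + 1) - 1).
      step k = subst₂ (λ x y → + (p ^ suc (suc k)) ∣ x - y) (trans (sym (R-suc (suc k) as)) (sym (a≡R (suc (suc k))))) (sym (a≡R (suc k)))
        (∣-step (R (suc k) as) (N (suc k) as) (nonPPart-N k as (N (suc k) as) 0 (N-unit-∤ (suc k) as ¬d) (sym (ℤ.*-identityʳ _))))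

    module _ (a≢0 : ∀ k → a k ≢ 0ℤ) where
      private
        R≢0 : ∀ k → R k as ≢ 0ℤ
        R≢0 k = subst (_≢ 0ℤ) (a≡R k) (a≢0 k)

      nonPParts-converge : ∀ m → (∀ k → IsNonPPart p (a k) (m k)) → Σ (ℤp p) λ L → ConvergesTo p m L × ¬ IsZeroℤp p L
      nonPParts-converge m part = limit p m step , converges p m step , limit-nonzero p m step (proj₂ (proj₂ (part 2)))
        where
        -- With `u` the non-p part of N (k + 1), uniqueness gives m (k + 2) = m (k + 1) · u, signs
        -- included, and u ≡ 1 mod p^(k+2).
        step : ∀ k → + (p ^ suc (suc k)) ∣ m (suc (suc k)) - m (suc k)
        step k with part (suc k) | part (suc (suc k)) | valuation-ℤ pr (N (suc k) as) (ℤ.≢-nonZero λ e → R≢0 (suc (suc k)) (trans (R-suc (suc k) as) (trans (cong (R (suc k) as *_) e) (ℤ.*-zeroʳ (R (suc k) as)))))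
        ... | r , eq , p∤m | r′ , eq′ , p∤m′ | u , v , p∤u , eqN = subst (λ x → + (p ^ suc (suc k)) ∣ x - m (suc k))
                (nonPPart-unique pr (r ℕ.+ v) r′ {m (suc k) * u} {m (suc (suc k))} (λ d → prime∤* pr p∤m p∤u (subst (p ℕ.∣_) (ℤ.abs-* (m (suc k)) u) d)) p∤m′ product)
                (∣-step (m (suc k)) u (nonPPart-N k as u v p∤u eqN))
          where
          f : ∀ m u x y → m * u * (x * y) ≡ m * x * (u * y)
          f = solve-∀
          product : m (suc k) * u * + (p ^ (r ℕ.+ v)) ≡ m (suc (suc k)) * + (p ^ r′)
          product = begin
            m (suc k) * u * + (p ^ (r ℕ.+ v)) ≡⟨ cong (λ x → m (suc k) * u * x) (trans (cong +_ (ℕ.^-distribˡ-+-* p r v)) (ℤ.pos-* (p ^ r) (p ^ v))) ⟩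
            m (suc k) * u * (+ (p ^ r) * + (p ^ v)) ≡⟨ f (m (suc k)) u (+ (p ^ r)) (+ (p ^ v)) ⟩
            m (suc k) * + (p ^ r) * (u * + (p ^ v)) ≡⟨ cong₂ _*_ (trans (sym eq) (a≡R (suc k))) (sym eqN) ⟩
            R (suc k) as * N (suc k) as ≡⟨ R-suc (suc k) as ⟨
            R (suc (suc k)) as ≡⟨ a≡R (suc (suc k)) ⟨
            a (suc (suc k)) ≡⟨ eq′ ⟩
            m (suc (suc k)) * + (p ^ r′) ∎
            where open ≡-Reasoning

      -- Three cases. For l ≠ p consecutive parts differ by a factor ≡ 1, and a power of l is prime
      -- to p, so the limit is not zero. For l = p the parts tend to 0 when p divides f(1);
      -- otherwise every resultant is prime to p and all the parts are 1.
      lParts-converge : ∀ l → Prime l → ∀ y → (∀ k → IsLPart l (a k) (y k)) →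
                        Σ (ℤp p) λ L → ConvergesTo p y L × (IsZeroℤp p L ⇔ ((l ≡ p) × (+ p ∣ value₁ as)))
      lParts-converge l prl y part with l ℕ.≟ p
      ... | no l≢p = limit p y step , converges p y step , mk⇔ (λ z → contradiction z (limit-nonzero p y step p∤y₂)) (λ (e , _) → contradiction e l≢p)
        where
        parts = prime-powers pr prl l≢p
        e : ℕ → ℕ
        e k = l ^ proj₁ (part k)
        e-part : ∀ k → Parts.Part parts (e k) ∣ R k as ∣
        e-part k = subst (λ x → Parts.Part parts (e k) ∣ x ∣) (a≡R k) (from (part k))
          where
          from : (h : IsLPart l (a k) (y k)) → Parts.Part parts (l ^ proj₁ h) ∣ a k ∣
          from (r , _ , ℕ.divides c eq , ¬d) = (r , refl) , c , (λ (ℕ.divides c′ eq′) → ¬d (ℕ.divides c′ (trans eq (trans (cong (ℕ._* l ^ r) eq′) (ℕ.*-assoc c′ l (l ^ r)))))) , trans eq (ℕ.*-comm c (l ^ r))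
        y≡ : ∀ k → + e k ≡ y k
        y≡ k = sym (proj₁ (proj₂ (part k)))
        step : ∀ k → + (p ^ suc (suc k)) ∣ y (suc (suc k)) - y (suc k)
        step k = let u , u≢0 , eq , h = part-suc parts (suc k) as (R≢0 (suc (suc k))) (e-part (suc k)) (e-part (suc (suc k))) in
          subst₂ (λ x y → + (p ^ suc (suc k)) ∣ x - y) (trans (sym (ℤ.pos-* (e (suc k)) u)) (trans (cong +_ (sym eq)) (y≡ (suc (suc k))))) (y≡ (suc k))
            (∣-step (+ e (suc k)) (+ u) (∣∸1⇒∣-1 u u≢0 h))
        p∤y₂ : ¬ (+ p ∣ y 2)
        p∤y₂ d = prime≢1 pr (Parts.coprime-p parts (proj₁ (e-part 2)) (subst (+ p ∣_) (sym (y≡ 2)) d , ℕ.∣-refl))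
      ... | yes refl with p ℕ.∣? ∣ value₁ as ∣
      ...   | yes d = constant p 0ℤ , converges-zero p y divisible , mk⇔ (λ _ → refl , d) (λ _ → zero-constant p)
        where
        divisible : ∀ k → + (p ^ k) ∣ y k
        divisible k with part k
        -- Since p^k divides the resultant at level k, an exact exponent r < k would contradict its
        -- maximality.
        ... | r , eq , _ , ¬d with r ℕ.<? k
        ...   | yes r<k = contradiction (subst (+ (p ^ suc r) ∣_) (sym (a≡R k)) (ℕ.∣-trans (^-mono-∣ r<k) (∣-^ k {R k as} (R-∣ as d k)))) ¬d
          where
          ^-mono-∣ : ∀ {i j} → i ≤ j → p ^ i ℕ.∣ p ^ j
          ^-mono-∣ {i} {j} h = subst (λ x → p ^ i ℕ.∣ p ^ x) (ℕ.m∸n+n≡m h) (subst (p ^ i ℕ.∣_) (sym (ℕ.^-distribˡ-+-* p (j ∸ i) i)) (ℕ.n∣m*n (p ^ (j ∸ i))))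
        ...   | no r≮k = subst (+ (p ^ k) ∣_) (sym eq) (subst (λ x → p ^ k ℕ.∣ p ^ x) (ℕ.m∸n+n≡m (ℕ.≮⇒≥ r≮k)) (subst (p ^ k ℕ.∣_) (sym (ℕ.^-distribˡ-+-* p (r ∸ k) k)) (ℕ.n∣m*n (p ^ (r ∸ k)))))
      ...   | no ¬d = constant p 1ℤ , (λ k → 0 , λ n _ → subst (λ x → p ^ k ℕ.∣ ∣ x - 1ℤ ∣) (sym (y≡1 n)) (ℕ._∣0 (p ^ k))) ,
                mk⇔ (λ z → contradiction (subst (ℕ._∣ 1) (ℕ.*-identityʳ p) (z 1)) (prime∤1 pr)) (λ (_ , d) → contradiction d ¬d)
        where
        y≡1 : ∀ k → y k ≡ 1ℤ
        y≡1 k with part k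
        ... | zero , eq , _ = eq
        ... | suc r , _ , d , _ = contradiction (subst (+ p ∣_) (a≡R k) (ℕ.∣-trans (ℕ.m∣m*n (p ^ r)) d)) (R-unit as ¬d k)

theorem4p3 : (p : ℕ) → Prime p → (d : ℕ) → (c : Fin (suc d) → ℤ) → c (fromℕ d) ≢ 0ℤ →
    (Σ (ℤp p) λ L → ConvergesTo p (resSeq p d c) L × (IsZeroℤp p L ⇔ ((+ p) ∣ evalAt1 d c)))
    × ((∀ n → resSeq p d c n ≢ 0ℤ) → (m : ℕ → ℤ) → (∀ n → IsNonPPart p (resSeq p d c n) (m n)) →
    Σ (ℤp p) λ L → ConvergesTo p m L × ¬ IsZeroℤp p L)
    × ((∀ n → resSeq p d c n ≢ 0ℤ) → (l : ℕ) → Prime l → (y : ℕ → ℤ) →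
    (∀ n → IsLPart l (resSeq p d c n) (y n)) →
    Σ (ℤp p) λ L → ConvergesTo p y L × (IsZeroℤp p L ⇔ ((l ≡ p) × ((+ p) ∣ evalAt1 d c))))
theorem4p3 zero pr = contradiction pr ¬prime[0]
theorem4p3 p@(suc p′) pr d c _ =
  subst (λ v → Σ (ℤp p) λ L → ConvergesTo p (resSeq p d c) L × (IsZeroℤp p L ⇔ (+ p ∣ v))) f₁ (resultants-converge as (resSeq p d c) R≡) ,
  nonPParts-converge as (resSeq p d c) R≡ ,
  λ nz l prl y h → subst (λ v → Σ (ℤp p) λ L → ConvergesTo p y L × (IsZeroℤp p L ⇔ ((l ≡ p) × (+ p ∣ v)))) f₁
    (lParts-converge as (resSeq p d c) R≡ nz l prl y h)
  where
  open Tower p′ pr hiding (p)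
  as : List ℤ
  as = coefficients c
  f₁ : value₁ as ≡ evalAt1 d c
  f₁ = value₁-coefficients c
  R≡ : ∀ n → resSeq p d c n ≡ R n as
  R≡ n = trans (resultant-cyc (p ^ n) d {{p^k≢0 n}} (coeffN d c)) (sym (R≡det n as))
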